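{- For every $0<p<1$ there is an $\left(n^{O(s)}\cdot\log (1/p)\right)$-time (randomized) algorithm which, given an instance of $s$-Colored Exact Perfect Matching on an $n$-vertex graph, finds a solution with probability at least $1-p$ if one exists, and concludes that there is no solution otherwise.
   Context: $\mathbb{N}$ denotes the positive integers and $[s]=\{1,\dots,s\}$. All graphs are simple and undirected. $s$-Colored Exact Perfect Matching: The input is a graph $G=(V,E)$, a coloring $c\colon E\to[s]$, and $k_i\in\mathbb{N}$, $i\in[s]$. The output is (if one exists) a perfect matching $M$ in $G$ such that $|c^{ -1}(i)\cap M|=k_i$ for all $i\in[s]$; such an $M$ is called a solution. -}

module Defs where

open import Data.Bool using (Bool; true; false; not; if_then_else_)
open import Data.Fin as Fin using (Fin; toℕ)
import Data.Fin.Properties as Fin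
open import Data.Fin.Subset using (Subset; _∩_; ∣_∣)
open import Data.Integer using (+_)
open import Data.List as List using (List; []; _∷_; _++_; length; filter)
open import Data.Maybe using (Maybe; just; nothing)
import Data.Maybe.Relation.Unary.Any as Maybe
open import Data.Nat using (ℕ; zero; suc; _+_; _∸_; _^_; NonZero; _≡ᵇ_)
import Data.Nat.Properties as ℕ
open import Data.Product using (_×_; _,_; proj₁; proj₂; ∃; ∃-syntax)
open import Data.Rational as ℚ using (ℚ; 1ℚ)
open import Data.Sum using (_⊎_)
open import Data.Vec as Vec using (Vec; []; _∷_)
open import Function using (_⇔_)
open import Level using (Level)
open import Relation.Binary.PropositionalEquality using (_≡_)
open import Relation.Nullary using (¬_)
open import Relation.Nullary.Decidable using (does; _×-dec_; _⊎-dec_)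
open import Relation.Unary using (Pred; Decidable)

-- The edge set is enumerated by Fin m.  An unordered pair is stored with its
-- smaller end first, which rules out loops; injectivity of e ↦ (src e , tgt e)
-- rules out parallel edges.
record Graph (n : ℕ) : Set where
  field
    m       : ℕ
    src tgt : Fin m → Fin n
    src<tgt : ∀ e → src e Fin.< tgt e
    simple  : ∀ {e f} → src e ≡ src f → tgt e ≡ tgt f → e ≡ f

  EdgeSet : Set
  EdgeSet = Subset m

  δ : Fin n → EdgeSet
  δ v = Vec.tabulate λ e → does ((src e Fin.≟ v) ⊎-dec (tgt e Fin.≟ v))

  IsPerfectMatching : Pred EdgeSet _
  IsPerfectMatching M = ∀ v → ∣ δ v ∩ M ∣ ≡ 1

record Instance (s n : ℕ) : Set where
  field
    graph : Graph n
  open Graph graph public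
  field
    {{s≢0}} : NonZero s
    c       : Fin m → Fin s
    k       : Fin s → ℕ
    k≢0     : ∀ i → NonZero (k i)

  c⁻¹ : Fin s → EdgeSet
  c⁻¹ i = Vec.tabulate λ e → does (c e Fin.≟ i)

  IsSolution : Pred EdgeSet _
  IsSolution M = IsPerfectMatching M × (∀ i → ∣ c⁻¹ i ∩ M ∣ ≡ k i)

  IsSolution? : Decidable IsSolution
  IsSolution? M = Fin.all? (λ v → ∣ δ v ∩ M ∣ ℕ.≟ 1)
            ×-dec Fin.all? (λ i → ∣ c⁻¹ i ∩ M ∣ ℕ.≟ k i)

  Solvable : Set
  Solvable = ∃ IsSolution

-- A random access machine with while-programs as control.  Every primitive
-- acts on a bounded number of cells and has unit cost; addition and truncated
-- subtraction are the only arithmetic, so that unit cost is polynomially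
-- related to Turing machine time.
infixr 5 _⨾_

data Program : Set where
  _≔const_       : (i a : ℕ) → Program
  _≔_⊕_          : (i j l : ℕ) → Program
  _≔_⊖_          : (i j l : ℕ) → Program
  _≔mem[_]       : (i j : ℕ) → Program
  mem[_]≔_       : (i j : ℕ) → Program
  _≔coin         : (i : ℕ) → Program
  skip           : Program
  _⨾_            : Program → Program → Program
  ifPos_then_else_ : (i : ℕ) → Program → Program → Program
  whilePos_loop_   : (i : ℕ) → Program → Program

record Store : Set where
  constructor store
  field
    reg mem : ℕ → ℕ
open Store public

_[_↦_] : (ℕ → ℕ) → ℕ → ℕ → (ℕ → ℕ)
(f [ i ↦ a ]) j = if j ≡ᵇ i then a else f j

-- The list holds the programs still to be executed, first one on top.
Config : Set
Config = List Program × Store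

-- As for probabilistic Turing machines with two transition functions, a fresh
-- coin is tossed at every step; only _≔coin looks at it.
step : Bool → Config → Config
step b ([] , σ) = [] , σ
step b ((i ≔const a) ∷ K , store r h) = K , store (r [ i ↦ a ]) h
step b ((i ≔ j ⊕ l) ∷ K , store r h) = K , store (r [ i ↦ r j + r l ]) h
step b ((i ≔ j ⊖ l) ∷ K , store r h) = K , store (r [ i ↦ r j ∸ r l ]) h
step b ((i ≔mem[ j ]) ∷ K , store r h) = K , store (r [ i ↦ h (r j) ]) h
step b ((mem[ i ]≔ j) ∷ K , store r h) = K , store r (h [ r i ↦ r j ])
step b ((i ≔coin) ∷ K , store r h) = K , store (r [ i ↦ (if b then 1 else 0) ]) h
step b (skip ∷ K , σ) = K , σ
step b ((A ⨾ B) ∷ K , σ) = A ∷ B ∷ K , σ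
step b ((ifPos i then A else B) ∷ K , σ) with reg σ i
... | zero  = B ∷ K , σ
... | suc _ = A ∷ K , σ
step b ((whilePos i loop A) ∷ K , σ) with reg σ i
... | zero  = K , σ
... | suc _ = A ∷ (whilePos i loop A) ∷ K , σ

run : ∀ {T} → Vec Bool T → Config → Config
run []      κ = κ
run (b ∷ ω) κ = run ω (step b κ)

Halted : Config → Set
Halted κ = proj₁ κ ≡ []

infix 7 _/2^_

_/2^_ : ℕ → ℕ → ℚ
a /2^ t = (+ a ℚ./ 2 ^ t) {{ℕ.m^n≢0 2 t}}

coinStrings : ∀ T → List (Vec Bool T)
coinStrings zero    = [] ∷ []
coinStrings (suc T) = List.map (false ∷_) (coinStrings T)
                   ++ List.map (true ∷_) (coinStrings T)

Pr : ∀ {ℓ : Level} {T} {P : Pred (Vec Bool T) ℓ} → Decidable P → ℚ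
Pr {T = T} P? = length (filter P? (coinStrings T)) /2^ T

contents : List ℕ → ℕ → ℕ
contents []       _       = 0
contents (a ∷ as) zero    = a
contents (a ∷ as) (suc x) = contents as x

module _ {s n} (I : Instance s n) where
  open Instance I

  -- n, s, m, k₁, …, kₛ, followed by (source, target, colour) for each edge.
  input : List ℕ
  input = n ∷ s ∷ m ∷ List.tabulate k
       ++ List.concat (List.tabulate λ e →
            toℕ (src e) ∷ toℕ (tgt e) ∷ toℕ (c e) ∷ [])

  initial : Program → Config
  initial A = A ∷ [] , store (λ _ → 0) (contents input)

  -- mem[0] = 0 is the answer "there is no solution"; otherwise the edge e
  -- belongs to the returned set iff mem[1 + e] ≠ 0.
  output : Config → Maybe EdgeSet
  output (_ , σ) with mem σ 0
  ... | zero  = nothing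
  ... | suc _ = just (Vec.tabulate λ e → not (mem σ (suc (toℕ e)) ≡ᵇ 0))

  module _ (A : Program) where

    HaltsWithin : ℕ → Set
    HaltsWithin T = (ω : Vec Bool T) → Halted (run ω (initial A))

    answer : ∀ {T} → Vec Bool T → Maybe EdgeSet
    answer ω = output (run ω (initial A))

    FindsSolution : ∀ {T} → Pred (Vec Bool T) _
    FindsSolution ω = Maybe.Any IsSolution (answer ω)

    findsSolution? : ∀ {T} → Decidable (FindsSolution {T})
    findsSolution? ω = Maybe.dec IsSolution? (answer ω)

    ConcludesNone : ∀ {T} → Pred (Vec Bool T) _
    ConcludesNone ω = answer ω ≡ nothing

-- Dedekind reals: L q means that q is below the number, U q that q is above it.
record ℝ : Set₁ where
  field
    L U      : ℚ → Set
    lower    : ∃[ q ] L q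
    upper    : ∃[ q ] U q
    roundedˡ : ∀ q → L q ⇔ (∃[ r ] q ℚ.< r × L r)
    roundedʳ : ∀ q → U q ⇔ (∃[ r ] r ℚ.< q × U r)
    disjoint : ∀ q → ¬ (L q × U q)
    located  : ∀ {q r} → q ℚ.< r → L q ⊎ U r

infix 4 _<ʳ_ _ʳ<_ 1-_≤_ log₂[1/_]≤_

_<ʳ_ : ℚ → ℝ → Set
q <ʳ p = ℝ.L p q

_ʳ<_ : ℝ → ℚ → Set
p ʳ< q = ℝ.U p q

-- Non-strict inequalities are negations of strict ones.
1-_≤_ : ℝ → ℚ → Set
1- p ≤ q = ¬ (p ʳ< 1ℚ ℚ.- q)

-- For p > 0, log₂ (1/p) ≤ t amounts to 2⁻ᵗ ≤ p.
log₂[1/_]≤_ : ℝ → ℕ → Set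
log₂[1/ p ]≤ t = ¬ (p ʳ< 1 /2^ t)

{-# OPTIONS --safe #-}

-- Over the field with two elements let μ(V) be the generating polynomial, by
-- weight, of the matchings on the vertex set V.  Expanding along a vertex v of
-- V gives μ(V) = μ(V − v) + Σ z^w(vu) μ(V − v − u), and, because matching v to
-- u and then to u′ cancels against the opposite order, also
-- μ(V − v) = μ(V) + Σ z^w(vu) μ(V − u).  Edge weights being positive, the
-- second identity determines the coefficients of all μ(V − v), v ∈ V, from
-- those of μ(V), and the first one then gives μ(V + h): so μ of the whole
-- graph is computed in time polynomial in the weights, without determinants.
--
-- An edge e gets the weight r(e) + D (m + 1)^c(e), where r(e) is a random
-- number of O(log n) bits and D exceeds all possible sums of the r(e).  The
-- weight of a matching then determines how often it uses each colour, and by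
-- the isolation lemma, with probability at least 1/2, some solution M is the
-- only matching of its weight T.  In that case e ∈ M exactly if the
-- coefficient of z^T in μ(G − e) is 0.  A trial reads off a candidate for each
-- T below n^O(s) and tests whether it is a solution, so errors are one-sided
-- and t trials fail with probability at most 2^(−t).

module Submission where

open import Defs
open import Data.Bool using (Bool; true; false; not; if_then_else_; _∧_; _∨_; _xor_; T)
import Data.Bool.Properties as Bool
open import Data.Bool.Solver using (module xor-∧-Solver)
open import Data.Empty using (⊥)
open import Data.Fin as Fin using (Fin; toℕ; fromℕ<; #_)
import Data.Fin.Properties as Fin
open import Data.Fin.Subset using (Subset; _∩_; ∣_∣)
open import Data.Fin.Subset.Properties using (anySubset?)
import Data.Integer as ℤ
import Data.Integer.Properties as ℤ
open import Data.List as List using (List; []; _∷_; length; filter)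
open import Data.List.Membership.Propositional using (_∈_)
open import Data.List.Membership.Propositional.Properties using (∈-allFin)
import Data.List.Properties as List
open import Data.List.Relation.Unary.Any using (here; there)
open import Data.Maybe using (nothing; just)
import Data.Maybe.Relation.Unary.Any as Maybe
open import Data.Nat using (ℕ; zero; suc; _+_; _*_; _∸_; _^_; _⊔_; _≤_; _<_; z≤n; s≤s; _≡ᵇ_; _<ᵇ_; _≟_; _≤?_; _<?_; NonZero; >-nonZero; >-nonZero⁻¹)
open import Data.Nat.DivMod using (_%_; [m+kn]%n≡m%n; m<n⇒m%n≡m)
import Data.Nat.Properties as ℕ
open import Data.Nat.Solver using (module +-*-Solver)
open import Data.Product using (_×_; _,_; proj₁; proj₂; ∃; ∃-syntax; Σ-syntax)
open import Data.Rational as ℚ using (ℚ; 0ℚ; 1ℚ; fromℚᵘ)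
import Data.Rational.Properties as ℚ
import Data.Rational.Unnormalised as ℚᵘ
import Data.Rational.Unnormalised.Properties as ℚᵘ
open import Data.Sum using (_⊎_; inj₁; inj₂; [_,_]′)
open import Data.Unit using (tt)
open import Data.Vec as Vec using (Vec; []; _∷_; _++_)
import Data.Vec.Properties as Vec
open import Function using (_∘_; id; case_of_)
open import Function.Bundles using (Equivalence)
open import Relation.Binary.PropositionalEquality using (_≡_; _≢_; refl; sym; trans; cong; cong₂; subst; subst₂; module ≡-Reasoning)
open import Relation.Nullary using (¬_; Dec; yes; no; does; contradiction)
open import Relation.Nullary.Decidable using (dec-true; ¬?; _×-dec_; _⊎-dec_)

-- The bound concerns the random access machine itself, so the program, its exact running time and
-- its use of coins all have to be verified. The machine tosses a coin at every step, and a program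
-- branching on data could read coins at steps that depend on earlier outcomes. An algorithm without
-- conditional commands, whose loop bounds are fixed beforehand, reads its coins at the steps of a
-- constant mask. The coins read then form a uniform string, which is cut into equal blocks for the
-- weights and the trials, and failures are counted instead of estimated by conditional
-- probabilities.
--
-- The isolation lemma is applied to solutions only, whereas μ counts all matchings. The gap closes
-- because the colour counts of a solution add up to n/2 edges, so that every matching with these
-- counts is perfect.
--
-- The error p is a Dedekind real, and comparing it with a power of two is undecidable. The number
-- of trials is therefore found from locatedness only up to a factor of two, which the exponent of
-- the time bound absorbs.

bit : Bool → ℕ
bit b = if b then 1 else 0

≡ᵇ-refl : ∀ a → (a ≡ᵇ a) ≡ true
≡ᵇ-refl zero    = refl
≡ᵇ-refl (suc a) = ≡ᵇ-refl a

≡ᵇ-true : ∀ a b → (a ≡ᵇ b) ≡ true → a ≡ b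
≡ᵇ-true zero    zero    _ = refl
≡ᵇ-true (suc a) (suc b) p = cong suc (≡ᵇ-true a b p)

≢⇒≡ᵇ : ∀ {a b} → a ≢ b → (a ≡ᵇ b) ≡ false
≢⇒≡ᵇ {zero}  {zero}  ne = contradiction refl ne
≢⇒≡ᵇ {zero}  {suc b} ne = refl
≢⇒≡ᵇ {suc a} {zero}  ne = refl
≢⇒≡ᵇ {suc a} {suc b} ne = ≢⇒≡ᵇ (ne ∘ cong suc)

<ᵇ-true : ∀ a b → (a <ᵇ b) ≡ true → a < b
<ᵇ-true a b p = ℕ.<ᵇ⇒< a b (subst T (sym p) tt)

<⇒<ᵇ-true : ∀ {a b} → a < b → (a <ᵇ b) ≡ true
<⇒<ᵇ-true {zero}  {suc b} _       = refl
<⇒<ᵇ-true {suc a} {suc b} (s≤s p) = <⇒<ᵇ-true p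

≮⇒<ᵇ-false : ∀ {a b} → ¬ (a < b) → (a <ᵇ b) ≡ false
≮⇒<ᵇ-false {a} {b} q with a <ᵇ b in eq
... | true  = contradiction (<ᵇ-true a b eq) q
... | false = refl

-- Matching series over the field with two elements

VertexSet : Set
VertexSet = ℕ → Bool

infixl 7 _∖_

_∖_ : VertexSet → ℕ → VertexSet
(V ∖ v) u = V u ∧ not (u ≡ᵇ v)

infix 4 _≐_

_≐_ : VertexSet → VertexSet → Set
V ≐ U = ∀ u → V u ≡ U u

∖-cong : ∀ {V U} v → V ≐ U → V ∖ v ≐ U ∖ v
∖-cong v p u = cong (_∧ not (u ≡ᵇ v)) (p u)

∖-comm : ∀ V v w → V ∖ v ∖ w ≐ V ∖ w ∖ v
∖-comm V v w u with V u
... | false = refl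
... | true  = Bool.∧-comm (not (u ≡ᵇ v)) _

∖-removed : ∀ V v → (V ∖ v) v ≡ false
∖-removed V v rewrite ≡ᵇ-refl v = Bool.∧-zeroʳ (V v)

∖-other : ∀ V {u v} → u ≢ v → (V ∖ v) u ≡ V u
∖-other V {u} ne rewrite ≢⇒≡ᵇ ne = Bool.∧-identityʳ (V u)

-- Power series over the field with two elements, by their coefficients.
Series : Set
Series = ℕ → Bool

-- Multiplication by the a-th power of the variable.
shift : ℕ → Series → Series
shift zero    f W       = f W
shift (suc a) f zero    = false
shift (suc a) f (suc W) = shift a f W

shift-≤ : ∀ a f W → a ≤ W → shift a f W ≡ f (W ∸ a)
shift-≤ zero    f W       _       = refl
shift-≤ (suc a) f (suc W) (s≤s p) = shift-≤ a f W p

shift-> : ∀ a f W → W < a → shift a f W ≡ false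
shift-> (suc a) f zero    _       = refl
shift-> (suc a) f (suc W) (s≤s p) = shift-> a f W p

shift-cong : ∀ a {f g : Series} → (∀ W → f W ≡ g W) → ∀ W → shift a f W ≡ shift a g W
shift-cong zero    p W       = p W
shift-cong (suc a) p zero    = refl
shift-cong (suc a) p (suc W) = shift-cong a p W

shift-xor : ∀ a f g W → shift a (λ W → f W xor g W) W ≡ shift a f W xor shift a g W
shift-xor zero    f g W       = refl
shift-xor (suc a) f g zero    = refl
shift-xor (suc a) f g (suc W) = shift-xor a f g W

shift-∧ : ∀ a c f W → shift a (λ W → c ∧ f W) W ≡ c ∧ shift a f W
shift-∧ zero    c f W       = refl
shift-∧ (suc a) c f zero    = sym (Bool.∧-zeroʳ c)
shift-∧ (suc a) c f (suc W) = shift-∧ a c f W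

shift-false : ∀ a W → shift a (λ _ → false) W ≡ false
shift-false a W = shift-∧ a false (λ _ → false) W

shift-shift : ∀ a b f W → shift a (shift b f) W ≡ shift (a + b) f W
shift-shift zero    b f W       = refl
shift-shift (suc a) b f zero    = refl
shift-shift (suc a) b f (suc W) = shift-shift a b f W

shift-comm : ∀ a b f W → shift a (shift b f) W ≡ shift b (shift a f) W
shift-comm a b f W = trans (shift-shift a b f W)
  (trans (cong (λ c → shift c f W) (ℕ.+-comm a b)) (sym (shift-shift b a f W)))

-- The edges 0, …, m − 1 join src e to tgt e; only those satisfying act count.
module Matchings (src tgt wt : ℕ → ℕ) (act : ℕ → Bool) where

  usable : ℕ → VertexSet → Bool
  usable e V = act e ∧ (V (src e) ∧ V (tgt e))

  -- The coefficient at W is the parity of the number of matchings of weight W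
  -- on the vertex set V that use active edges below m.
  μ : ℕ → VertexSet → Series
  μ zero    V W = W ≡ᵇ 0
  μ (suc m) V W = μ m V W xor (usable m V ∧ shift (wt m) (μ m (V ∖ src m ∖ tgt m)) W)

  -- Σ z^(wt e) f(u) over the active edges e = {v, u} below m.
  nb : ℕ → ℕ → (ℕ → Series) → Series
  nb zero    v f W = false
  nb (suc m) v f W =
    (nb m v f W xor ((src m ≡ᵇ v) ∧ (act m ∧ shift (wt m) (f (tgt m)) W)))
    xor ((tgt m ≡ᵇ v) ∧ (act m ∧ shift (wt m) (f (src m)) W))

  usable-cong : ∀ e {V U} → V ≐ U → usable e V ≡ usable e U
  usable-cong e p = cong (act e ∧_) (cong₂ _∧_ (p (src e)) (p (tgt e)))

  μ-cong : ∀ m {V U} → V ≐ U → ∀ W → μ m V W ≡ μ m U W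
  μ-cong zero    p W = refl
  μ-cong (suc m) p W = cong₂ _xor_ (μ-cong m p W)
    (cong₂ _∧_ (usable-cong m p)
      (shift-cong (wt m) (μ-cong m (∖-cong (tgt m) (∖-cong (src m) p))) W))

  nb-xor : ∀ m v f g W → nb m v (λ u W → f u W xor g u W) W ≡ nb m v f W xor nb m v g W
  nb-xor zero    v f g W = refl
  nb-xor (suc m) v f g W
    rewrite nb-xor m v f g W
          | shift-xor (wt m) (f (tgt m)) (g (tgt m)) W
          | shift-xor (wt m) (f (src m)) (g (src m)) W
    = regroup (nb m v f W) (nb m v g W) (src m ≡ᵇ v) (tgt m ≡ᵇ v) (act m)
              (shift (wt m) (f (tgt m)) W) (shift (wt m) (g (tgt m)) W)
              (shift (wt m) (f (src m)) W) (shift (wt m) (g (src m)) W)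
    where
    open xor-∧-Solver
    regroup : ∀ x y p q c s t s′ t′ →
      ((x xor y) xor (p ∧ (c ∧ (s xor t)))) xor (q ∧ (c ∧ (s′ xor t′))) ≡
      ((x xor (p ∧ (c ∧ s))) xor (q ∧ (c ∧ s′))) xor ((y xor (p ∧ (c ∧ t))) xor (q ∧ (c ∧ t′)))
    regroup = solve 9 (λ x y p q c s t s′ t′ →
      ((x :+ y) :+ (p :* (c :* (s :+ t)))) :+ (q :* (c :* (s′ :+ t′))) :=
      ((x :+ (p :* (c :* s))) :+ (q :* (c :* s′))) :+ ((y :+ (p :* (c :* t))) :+ (q :* (c :* t′)))) refl

  module _ (loopless : ∀ e → src e ≢ tgt e) where

    -- Without loops the far end of an edge at v differs from v, so the value of f at v never enters
    -- the sum.
    nb-cong : ∀ m v {f g} W →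
              (∀ u → u ≢ v → ∀ e → shift (wt e) (f u) W ≡ shift (wt e) (g u) W) →
              nb m v f W ≡ nb m v g W
    nb-cong zero    v W p = refl
    nb-cong (suc m) v {f} {g} W p =
      cong₂ _xor_ (cong₂ _xor_ (nb-cong m v W p) at-src) at-tgt
      where
      at-src : (src m ≡ᵇ v) ∧ (act m ∧ shift (wt m) (f (tgt m)) W) ≡
               (src m ≡ᵇ v) ∧ (act m ∧ shift (wt m) (g (tgt m)) W)
      at-src with src m ≡ᵇ v in eq
      ... | false = refl
      ... | true  = cong (act m ∧_)
        (p (tgt m) (λ q → loopless m (trans (≡ᵇ-true (src m) v eq) (sym q))) m)
      at-tgt : (tgt m ≡ᵇ v) ∧ (act m ∧ shift (wt m) (f (src m)) W) ≡
               (tgt m ≡ᵇ v) ∧ (act m ∧ shift (wt m) (g (src m)) W)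
      at-tgt with tgt m ≡ᵇ v in eq
      ... | false = refl
      ... | true  = cong (act m ∧_)
        (p (src m) (λ q → loopless m (trans q (sym (≡ᵇ-true (tgt m) v eq)))) m)

    nb-cong-≗ : ∀ m v {f g} → (∀ u → u ≢ v → ∀ W → f u W ≡ g u W) →
                ∀ W → nb m v f W ≡ nb m v g W
    nb-cong-≗ m v p W = nb-cong m v W λ u u≢v e → shift-cong (wt e) (p u u≢v) W

    -- The neighbour sum is linear over power series. This lets the factor contributed by the last
    -- edge be moved inside the sum.
    nb-shift : ∀ m v c w g W →
      nb m v (λ u W → c ∧ shift w (g u) W) W ≡ c ∧ shift w (nb m v g) W
    nb-shift zero    v c w g W = sym (trans (cong (c ∧_) (shift-false w W)) (Bool.∧-zeroʳ c))
    nb-shift (suc m) v c w g W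
      rewrite nb-shift m v c w g W
            | shift-∧ (wt m) c (shift w (g (tgt m))) W
            | shift-∧ (wt m) c (shift w (g (src m))) W
            | shift-comm (wt m) w (g (tgt m)) W
            | shift-comm (wt m) w (g (src m)) W
            | shift-xor w (λ W → nb m v g W xor ((src m ≡ᵇ v) ∧ (act m ∧ shift (wt m) (g (tgt m)) W)))
                          (λ W → (tgt m ≡ᵇ v) ∧ (act m ∧ shift (wt m) (g (src m)) W)) W
            | shift-xor w (nb m v g) (λ W → (src m ≡ᵇ v) ∧ (act m ∧ shift (wt m) (g (tgt m)) W)) W
            | shift-∧ w (src m ≡ᵇ v) (λ W → act m ∧ shift (wt m) (g (tgt m)) W) W
            | shift-∧ w (tgt m ≡ᵇ v) (λ W → act m ∧ shift (wt m) (g (src m)) W) W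
            | shift-∧ w (act m) (shift (wt m) (g (tgt m))) W
            | shift-∧ w (act m) (shift (wt m) (g (src m))) W
      = regroup (shift w (nb m v g) W) (src m ≡ᵇ v) (tgt m ≡ᵇ v) (act m) c
                (shift w (shift (wt m) (g (tgt m))) W) (shift w (shift (wt m) (g (src m))) W)
      where
      open xor-∧-Solver
      regroup : ∀ x p q a c s t →
        ((c ∧ x) xor (p ∧ (a ∧ (c ∧ s)))) xor (q ∧ (a ∧ (c ∧ t))) ≡
        c ∧ ((x xor (p ∧ (a ∧ s))) xor (q ∧ (a ∧ t)))
      regroup = solve 7 (λ x p q a c s t →
        ((c :* x) :+ (p :* (a :* (c :* s)))) :+ (q :* (a :* (c :* t))) :=
        c :* ((x :+ (p :* (a :* s))) :+ (q :* (a :* t)))) refl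

    remove-if : Bool → VertexSet → ℕ → VertexSet
    remove-if c V v = if c then V ∖ v else V

    -- For c = true this is the expansion of the matching series along v; for
    -- c = false it is the special feature of characteristic two: matching v to
    -- u and then again to w cancels against matching it to w and then to u.
    Expansion : Bool → ℕ → ℕ → VertexSet → Set
    Expansion c m v V = ∀ W →
      μ m V W ≡ μ m (V ∖ v) W xor nb m v (λ u W → V u ∧ μ m (remove-if c V v ∖ u) W) W

    remove-if-other : ∀ c V {u v} → u ≢ v → remove-if c V v u ≡ V u
    remove-if-other false V u≢v = refl
    remove-if-other true  V u≢v = ∖-other V u≢v

    remove-if-comm : ∀ c V v a → remove-if c V v ∖ a ≐ remove-if c (V ∖ a) v
    remove-if-comm false V v a x = refl
    remove-if-comm true  V v a x = ∖-comm V v a x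

    -- When the last edge ab avoids v, the matchings that skip it and those that use it are expanded
    -- along v separately, on V and on V - a - b. The two neighbour sums then combine term by term.
    away : ∀ c m v V → src m ≢ v → tgt m ≢ v →
           Expansion c m v V → Expansion c m v (V ∖ src m ∖ tgt m) → Expansion c (suc m) v V
    away c m v V a≢v b≢v E₁ E₂ W = begin
      μ m V W xor (ok ∧ shift w (μ m U) W)
        ≡⟨ cong₂ _xor_ (E₁ W) (cong (ok ∧_) (trans (shift-cong w E₂ W) (shift-xor w _ _ W))) ⟩
      (μ m (V ∖ v) W xor nb m v f W) xor (ok ∧ (shift w (μ m (U ∖ v)) W xor shift w (nb m v g) W))
        ≡⟨ swap (μ m (V ∖ v) W) (nb m v f W) ok (shift w (μ m (U ∖ v)) W) (shift w (nb m v g) W) ⟩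
      (μ m (V ∖ v) W xor (ok ∧ shift w (μ m (U ∖ v)) W)) xor (nb m v f W xor (ok ∧ shift w (nb m v g) W))
        ≡⟨ cong₂ _xor_ first (cong (nb m v f W xor_) second) ⟩
      (μ m (V ∖ v) W xor (usable m (V ∖ v) ∧ shift w (μ m (V ∖ v ∖ a ∖ b)) W))
        xor (nb m v f W xor nb m v f′ W)
        ≡⟨ cong (μ (suc m) (V ∖ v) W xor_) (trans (sym (nb-xor m v f f′ W)) (nb-cong-≗ m v join W)) ⟩
      μ (suc m) (V ∖ v) W xor nb m v F W
        ≡⟨ cong (μ (suc m) (V ∖ v) W xor_) (sym drop-last) ⟩
      μ (suc m) (V ∖ v) W xor nb (suc m) v F W ∎
      where
      open ≡-Reasoning
      a b w : ℕ
      a = src m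
      b = tgt m
      w = wt m
      U R : VertexSet
      U = V ∖ a ∖ b
      R = remove-if c V v
      ok : Bool
      ok = usable m V
      F f f′ g : ℕ → Series
      F u W = V u ∧ μ (suc m) (R ∖ u) W
      f u W = V u ∧ μ m (R ∖ u) W
      f′ u W = V u ∧ (usable m (R ∖ u) ∧ shift w (μ m (R ∖ u ∖ a ∖ b)) W)
      g u W = U u ∧ μ m (remove-if c U v ∖ u) W
      μg : ℕ → Series
      μg u = μ m (remove-if c U v ∖ u)
      drop-last : nb (suc m) v F W ≡ nb m v F W
      drop-last = trans
        (cong₂ (λ p q → (nb m v F W xor (p ∧ (act m ∧ shift w (F b) W))) xor (q ∧ (act m ∧ shift w (F a) W)))
          (≢⇒≡ᵇ a≢v) (≢⇒≡ᵇ b≢v))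
        (trans (Bool.xor-identityʳ _) (Bool.xor-identityʳ _))
      swap : ∀ x y c s t → (x xor y) xor (c ∧ (s xor t)) ≡ (x xor (c ∧ s)) xor (y xor (c ∧ t))
      swap = solve 5 (λ x y c s t →
        (x :+ y) :+ (c :* (s :+ t)) := (x :+ (c :* s)) :+ (y :+ (c :* t))) refl
        where
        open xor-∧-Solver
      first : μ m (V ∖ v) W xor (ok ∧ shift w (μ m (U ∖ v)) W) ≡ μ (suc m) (V ∖ v) W
      first = cong (μ m (V ∖ v) W xor_) (cong₂ _∧_
        (cong (act m ∧_) (cong₂ _∧_ (sym (∖-other V a≢v)) (sym (∖-other V b≢v))))
        (shift-cong w (μ-cong m λ x →
          trans (∖-comm (V ∖ a) b v x) (∖-cong b (∖-comm V a v) x)) W))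
      join : ∀ u → u ≢ v → ∀ W → f u W xor f′ u W ≡ F u W
      join u _ W = sym (Bool.∧-distribˡ-xor (V u) _ _)
      -- For u equal to a or b both sides vanish: on the left u is missing from `U`, on the right
      -- the last edge is no longer usable once u is removed.
      pointwise : ∀ u → u ≢ v → ∀ W → ok ∧ shift w (g u) W ≡ f′ u W
      pointwise u u≢v W with a ≟ u
      ... | yes refl = trans (cong (ok ∧_) (trans (shift-∧ w (U a) (μg a) W) (cong (_∧ shift w (μg a) W) gone)))
                       (trans (Bool.∧-zeroʳ ok) (sym zero-right))
        where
        gone : U a ≡ false
        gone = cong (_∧ not (a ≡ᵇ b)) (∖-removed V a)
        zero-right : f′ a W ≡ false
        zero-right rewrite ∖-removed R a | Bool.∧-zeroʳ (act m) = Bool.∧-zeroʳ (V a)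
      ... | no a≢u with b ≟ u
      ...   | yes refl = trans (cong (ok ∧_) (trans (shift-∧ w (U b) (μg b) W) (cong (_∧ shift w (μg b) W) (∖-removed (V ∖ a) b))))
                         (trans (Bool.∧-zeroʳ ok) (sym zero-right))
        where
        zero-right : f′ b W ≡ false
        zero-right rewrite ∖-removed R b | Bool.∧-zeroʳ ((R ∖ b) a) | Bool.∧-zeroʳ (act m) =
          Bool.∧-zeroʳ (V b)
      ...   | no b≢u = begin
        ok ∧ shift w (g u) W
          ≡⟨ cong (ok ∧_) (shift-∧ w (U u) (μ m (remove-if c U v ∖ u)) W) ⟩
        ok ∧ (U u ∧ shift w (μ m (remove-if c U v ∖ u)) W)
          ≡⟨ cong (λ z → ok ∧ (z ∧ shift w (μ m (remove-if c U v ∖ u)) W))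
               (trans (∖-other (V ∖ a) (b≢u ∘ sym)) (∖-other V (a≢u ∘ sym))) ⟩
        ok ∧ (V u ∧ shift w (μ m (remove-if c U v ∖ u)) W)
          ≡⟨ swap∧ ok (V u) _ ⟩
        V u ∧ (ok ∧ shift w (μ m (remove-if c U v ∖ u)) W)
          ≡⟨ cong (V u ∧_) (cong₂ _∧_
               (cong (act m ∧_) (cong₂ _∧_
                 (sym (trans (∖-other R a≢u) (remove-if-other c V a≢v)))
                 (sym (trans (∖-other R b≢u) (remove-if-other c V b≢v)))))
               (shift-cong w (μ-cong m sets) W)) ⟩
        f′ u W ∎
        where
        swap∧ : ∀ x y z → x ∧ (y ∧ z) ≡ y ∧ (x ∧ z)
        swap∧ false y z = sym (Bool.∧-zeroʳ y)
        swap∧ true  y z = refl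
        sets : remove-if c U v ∖ u ≐ R ∖ u ∖ a ∖ b
        sets x = trans (∖-cong u (λ y → sym (remove-if-comm c (V ∖ a) v b y)) x)
          (trans (∖-cong u (∖-cong b (λ y → sym (remove-if-comm c V v a y))) x)
          (trans (∖-comm (R ∖ a) b u x) (∖-cong b (∖-comm R a u) x)))
      second : ok ∧ shift w (nb m v g) W ≡ nb m v f′ W
      second = trans (sym (nb-shift m v ok w g W)) (nb-cong-≗ m v pointwise W)

    -- The last edge joins v to o. Its recurrences are passed as hypotheses so that one proof serves
    -- both orientations. For c = true all sets in the neighbour sum lack v, so the last edge only
    -- adds the term of the new neighbour o.
    incident : ∀ c m v o V → o ≢ v → V v ≡ true →
               (∀ U W → μ (suc m) U W ≡
                  μ m U W xor ((act m ∧ (U v ∧ U o)) ∧ shift (wt m) (μ m (U ∖ v ∖ o)) W)) →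
               (∀ f W → nb (suc m) v f W ≡ nb m v f W xor (act m ∧ shift (wt m) (f o) W)) →
               (∀ V → V v ≡ true → Expansion true m v V) → Expansion c m v V →
               Expansion c (suc m) v V
    incident true m v o V o≢v Vv step-μ step-nb _ E W
      = begin
      μ (suc m) V W
        ≡⟨ step-μ V W ⟩
      μ m V W xor ((act m ∧ (V v ∧ V o)) ∧ shift w (μ m (V ∖ v ∖ o)) W)
        ≡⟨ cong₂ (λ x y → x xor ((act m ∧ (y ∧ V o)) ∧ shift w (μ m (V ∖ v ∖ o)) W)) (E W) Vv ⟩
      (μ m (V ∖ v) W xor nb m v f W) xor ((act m ∧ V o) ∧ shift w (μ m (V ∖ v ∖ o)) W)
        ≡⟨ Bool.xor-assoc (μ m (V ∖ v) W) _ _ ⟩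
      μ m (V ∖ v) W xor (nb m v f W xor ((act m ∧ V o) ∧ shift w (μ m (V ∖ v ∖ o)) W))
        ≡⟨ cong₂ (λ x y → x xor (nb m v f W xor y))
             (sym (without (V ∖ v) W (∖-removed V v)))
             (trans (Bool.∧-assoc (act m) (V o) _)
               (cong (act m ∧_) (trans (sym (shift-∧ w (V o) _ W))
                 (shift-cong w (λ W → cong (V o ∧_) (sym (off o W))) W)))) ⟩
      μ (suc m) (V ∖ v) W xor (nb m v f W xor (act m ∧ shift w (F o) W))
        ≡⟨ cong (λ x → μ (suc m) (V ∖ v) W xor (x xor (act m ∧ shift w (F o) W)))
             (nb-cong-≗ m v (λ u _ W → cong (V u ∧_) (sym (off u W))) W) ⟩
      μ (suc m) (V ∖ v) W xor (nb m v F W xor (act m ∧ shift w (F o) W))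
        ≡⟨ cong (μ (suc m) (V ∖ v) W xor_) (sym (step-nb F W)) ⟩
      μ (suc m) (V ∖ v) W xor nb (suc m) v F W ∎
      where
      open ≡-Reasoning
      w : ℕ
      w = wt m
      F f : ℕ → Series
      F u W = V u ∧ μ (suc m) (V ∖ v ∖ u) W
      f u W = V u ∧ μ m (V ∖ v ∖ u) W
      without : ∀ U W → U v ≡ false → μ (suc m) U W ≡ μ m U W
      without U W Uv = trans (step-μ U W)
        (trans (cong (λ z → μ m U W xor ((act m ∧ (z ∧ U o)) ∧ shift w (μ m (U ∖ v ∖ o)) W)) Uv)
        (trans (cong (λ z → μ m U W xor (z ∧ shift w (μ m (U ∖ v ∖ o)) W)) (Bool.∧-zeroʳ (act m)))
        (Bool.xor-identityʳ _)))
      off : ∀ u W → μ (suc m) (V ∖ v ∖ u) W ≡ μ m (V ∖ v ∖ u) W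
      off u W = without (V ∖ v ∖ u) W (cong (_∧ not (v ≡ᵇ u)) (∖-removed V v))
    -- Here the sets V - u still contain v, so each term gains the matchings that use the edge vo.
    -- Their sum is the neighbour sum in the ordinary expansion of V - o along v. The new term for o
    -- is the whole series of V - o, and adding the two modulo two leaves the series of V - o - v,
    -- which is what the left side gains.
    incident false m v o V o≢v Vv step-μ step-nb Ex E W = begin
      μ (suc m) V W
        ≡⟨ step-μ V W ⟩
      μ m V W xor ((act m ∧ (V v ∧ V o)) ∧ s₀)
        ≡⟨ cong₂ (λ x y → x xor ((act m ∧ (y ∧ V o)) ∧ s₀)) (E W) Vv ⟩
      (μ m (V ∖ v) W xor nb m v f W) xor ((act m ∧ V o) ∧ s₀)
        ≡⟨ rearrange (μ m (V ∖ v) W) (nb m v f W) (act m) (V o) s₀ (shift w (nb m v g) W) ⟩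
      μ m (V ∖ v) W xor ((nb m v f W xor ((act m ∧ V o) ∧ shift w (nb m v g) W))
        xor (act m ∧ (V o ∧ (s₀ xor shift w (nb m v g) W))))
        ≡⟨ cong₂ (λ x y → x xor ((nb m v f W xor ((act m ∧ V o) ∧ shift w (nb m v g) W))
             xor (act m ∧ y)))
             (sym (without (V ∖ v) W (trans (cong (_∧ (V ∖ v) o) (∖-removed V v)) refl))) last-term ⟩
      μ (suc m) (V ∖ v) W xor ((nb m v f W xor ((act m ∧ V o) ∧ shift w (nb m v g) W))
        xor (act m ∧ shift w (F o) W))
        ≡⟨ cong (λ x → μ (suc m) (V ∖ v) W xor (x xor (act m ∧ shift w (F o) W)))
             (trans (cong (nb m v f W xor_) (sym (nb-shift m v (act m ∧ V o) w g W)))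
             (trans (sym (nb-xor m v f _ W)) (nb-cong-≗ m v pointwise W))) ⟩
      μ (suc m) (V ∖ v) W xor (nb m v F W xor (act m ∧ shift w (F o) W))
        ≡⟨ cong (μ (suc m) (V ∖ v) W xor_) (sym (step-nb F W)) ⟩
      μ (suc m) (V ∖ v) W xor nb (suc m) v F W ∎
      where
      open ≡-Reasoning
      w : ℕ
      w = wt m
      F f g : ℕ → Series
      F u W = V u ∧ μ (suc m) (V ∖ u) W
      f u W = V u ∧ μ m (V ∖ u) W
      g u W = (V ∖ o) u ∧ μ m (V ∖ o ∖ v ∖ u) W
      s₀ : Bool
      s₀ = shift w (μ m (V ∖ v ∖ o)) W
      without : ∀ U W → (U v ∧ U o) ≡ false → μ (suc m) U W ≡ μ m U W
      without U W Uv = trans (step-μ U W)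
        (trans (cong (λ z → μ m U W xor ((act m ∧ z) ∧ shift w (μ m (U ∖ v ∖ o)) W)) Uv)
        (trans (cong (λ z → μ m U W xor (z ∧ shift w (μ m (U ∖ v ∖ o)) W)) (Bool.∧-zeroʳ (act m)))
        (Bool.xor-identityʳ _)))
      rearrange : ∀ x y a o s t → (x xor y) xor ((a ∧ o) ∧ s) ≡
                  x xor ((y xor ((a ∧ o) ∧ t)) xor (a ∧ (o ∧ (s xor t))))
      rearrange x y a o s t = trans (cong (λ z → (x xor y) xor ((a ∧ o) ∧ z)) (cancel s t))
        (solve 6 (λ x y a o s t → (x :+ y) :+ ((a :* o) :* ((s :+ t) :+ t)) :=
           x :+ ((y :+ ((a :* o) :* t)) :+ (a :* (o :* (s :+ t))))) refl x y a o s t)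
        where
        open xor-∧-Solver
        cancel : ∀ s t → s ≡ (s xor t) xor t
        cancel false false = refl
        cancel false true  = refl
        cancel true  false = refl
        cancel true  true  = refl
      last-term : V o ∧ (s₀ xor shift w (nb m v g) W) ≡ shift w (F o) W
      last-term = begin
        V o ∧ (s₀ xor shift w (nb m v g) W)
          ≡⟨ cong (λ z → V o ∧ (z xor shift w (nb m v g) W))
               (shift-cong w (μ-cong m (∖-comm V v o)) W) ⟩
        V o ∧ (shift w (μ m (V ∖ o ∖ v)) W xor shift w (nb m v g) W)
          ≡⟨ cong (V o ∧_) (sym (shift-xor w _ _ W)) ⟩
        V o ∧ shift w (λ W → μ m (V ∖ o ∖ v) W xor nb m v g W) W
          ≡⟨ cong (V o ∧_) (shift-cong w (λ W →
               sym (Ex (V ∖ o) (trans (∖-other V (o≢v ∘ sym)) Vv) W)) W) ⟩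
        V o ∧ shift w (μ m (V ∖ o)) W
          ≡⟨ sym (shift-∧ w (V o) _ W) ⟩
        shift w (λ W → V o ∧ μ m (V ∖ o) W) W
          ≡⟨ shift-cong w (λ W → cong (V o ∧_) (sym (without (V ∖ o) W
               (trans (cong ((V ∖ o) v ∧_) (∖-removed V o)) (Bool.∧-zeroʳ _))))) W ⟩
        shift w (F o) W ∎
      pointwise : ∀ u → u ≢ v → ∀ W →
                  f u W xor ((act m ∧ V o) ∧ shift w (g u) W) ≡ F u W
      pointwise u u≢v W = begin
        (V u ∧ μ m (V ∖ u) W) xor ((act m ∧ V o) ∧ shift w (g u) W)
          ≡⟨ cong ((V u ∧ μ m (V ∖ u) W) xor_) inner ⟩
        (V u ∧ μ m (V ∖ u) W) xor (V u ∧ ((act m ∧ ((V ∖ u) v ∧ (V ∖ u) o))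
          ∧ shift w (μ m (V ∖ u ∖ v ∖ o)) W))
          ≡⟨ sym (Bool.∧-distribˡ-xor (V u) _ _) ⟩
        V u ∧ (μ m (V ∖ u) W xor ((act m ∧ ((V ∖ u) v ∧ (V ∖ u) o))
          ∧ shift w (μ m (V ∖ u ∖ v ∖ o)) W))
          ≡⟨ cong (V u ∧_) (sym (step-μ (V ∖ u) W)) ⟩
        F u W ∎
        where
        inner : (act m ∧ V o) ∧ shift w (g u) W ≡
                V u ∧ ((act m ∧ ((V ∖ u) v ∧ (V ∖ u) o)) ∧ shift w (μ m (V ∖ u ∖ v ∖ o)) W)
        inner with u ≟ o
        ... | yes refl
          rewrite shift-∧ w ((V ∖ o) o) (μ m (V ∖ o ∖ v ∖ o)) W
                | ∖-removed V o | Bool.∧-zeroʳ ((V ∖ o) v) | Bool.∧-zeroʳ (act m)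
                | Bool.∧-zeroʳ (act m ∧ V o) = sym (Bool.∧-zeroʳ (V o))
        ... | no u≢o
          rewrite shift-∧ w ((V ∖ o) u) (μ m (V ∖ o ∖ v ∖ u)) W
                | ∖-other V u≢o | ∖-other V (u≢o ∘ sym) | ∖-other V (u≢v ∘ sym) | Vv
                | shift-cong w (μ-cong m (λ x →
                    trans (∖-comm (V ∖ o) v u x)
                    (trans (∖-cong v (∖-comm V o u) x) (∖-comm (V ∖ u) o v x)))) W
          = swap∧ (act m ∧ V o) (V u) _
          where
          swap∧ : ∀ x y z → x ∧ (y ∧ z) ≡ y ∧ (x ∧ z)
          swap∧ false y z = sym (Bool.∧-zeroʳ y)
          swap∧ true  y z = refl

    expansion-step : ∀ c m v V → V v ≡ true →
                     (∀ V → V v ≡ true → Expansion true m v V) →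
                     (∀ V → V v ≡ true → Expansion c m v V) → Expansion c (suc m) v V
    expansion-step c m v V Vv Ex E with src m ≟ v | tgt m ≟ v
    ... | yes refl | yes q    = contradiction (sym q) (loopless m)
    ... | no  a≢v  | no  b≢v  = away c m v V a≢v b≢v (E V Vv)
      (E (V ∖ src m ∖ tgt m) (trans (∖-other (V ∖ src m) (b≢v ∘ sym))
                             (trans (∖-other V (a≢v ∘ sym)) Vv)))
    ... | yes refl | no  b≢v  = incident c m v (tgt m) V b≢v Vv (λ _ _ → refl) at-src Ex (E V Vv)
      where
      at-src : ∀ f W → nb (suc m) v f W ≡ nb m v f W xor (act m ∧ shift (wt m) (f (tgt m)) W)
      at-src f W rewrite ≡ᵇ-refl v | ≢⇒≡ᵇ b≢v = Bool.xor-identityʳ _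
    ... | no  a≢v  | yes refl = incident c m v (src m) V a≢v Vv swapped at-tgt Ex (E V Vv)
      where
      at-tgt : ∀ f W → nb (suc m) v f W ≡ nb m v f W xor (act m ∧ shift (wt m) (f (src m)) W)
      at-tgt f W rewrite ≡ᵇ-refl v | ≢⇒≡ᵇ a≢v =
        cong (_xor (act m ∧ shift (wt m) (f (src m)) W)) (Bool.xor-identityʳ (nb m v f W))
      swapped : ∀ U W → μ (suc m) U W ≡ μ m U W xor
                  ((act m ∧ (U v ∧ U (src m))) ∧ shift (wt m) (μ m (U ∖ v ∖ src m)) W)
      swapped U W = cong (μ m U W xor_) (cong₂ _∧_
        (cong (act m ∧_) (Bool.∧-comm (U (src m)) (U v)))
        (shift-cong (wt m) (μ-cong m (∖-comm U (src m) v)) W))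

    expand : ∀ m v V → V v ≡ true → Expansion true m v V
    expand zero    v V Vv W = sym (Bool.xor-identityʳ _)
    expand (suc m) v V Vv   = expansion-step true m v V Vv (expand m v) (expand m v)

    expand-twice : ∀ m v V → V v ≡ true → Expansion false m v V
    expand-twice zero    v V Vv W = sym (Bool.xor-identityʳ _)
    expand-twice (suc m) v V Vv   = expansion-step false m v V Vv (expand m v) (expand-twice m v)

-- Finite sums of natural numbers

∑< : ℕ → (ℕ → ℕ) → ℕ
∑< zero    f = 0
∑< (suc m) f = ∑< m f + f m

∑<-cong : ∀ m {f g} → (∀ i → i < m → f i ≡ g i) → ∑< m f ≡ ∑< m g
∑<-cong zero    p = refl
∑<-cong (suc m) p = cong₂ _+_ (∑<-cong m (λ i i<m → p i (ℕ.m<n⇒m<1+n i<m))) (p m (ℕ.n<1+n m))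

∑<-mono : ∀ m {f g} → (∀ i → i < m → f i ≤ g i) → ∑< m f ≤ ∑< m g
∑<-mono zero    p = z≤n
∑<-mono (suc m) p = ℕ.+-mono-≤ (∑<-mono m (λ i i<m → p i (ℕ.m<n⇒m<1+n i<m))) (p m (ℕ.n<1+n m))

∑<-const : ∀ m c → ∑< m (λ _ → c) ≡ m * c
∑<-const zero    c = refl
∑<-const (suc m) c = trans (cong (_+ c) (∑<-const m c)) (ℕ.+-comm (m * c) c)

+-interchange : ∀ a b c d → (a + b) + (c + d) ≡ (a + c) + (b + d)
+-interchange = solve 4 (λ a b c d → (a :+ b) :+ (c :+ d) := (a :+ c) :+ (b :+ d)) refl
  where open +-*-Solver

∑<-+ : ∀ m f g → ∑< m (λ i → f i + g i) ≡ ∑< m f + ∑< m g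
∑<-+ zero    f g = refl
∑<-+ (suc m) f g = trans (cong (_+ (f m + g m)) (∑<-+ m f g))
                         (+-interchange (∑< m f) (∑< m g) (f m) (g m))

∑<-* : ∀ m c f → ∑< m (λ i → c * f i) ≡ c * ∑< m f
∑<-* zero    c f = sym (ℕ.*-zeroʳ c)
∑<-* (suc m) c f = trans (cong (_+ c * f m) (∑<-* m c f)) (sym (ℕ.*-distribˡ-+ c _ _))

∑<-swap : ∀ m n (f : ℕ → ℕ → ℕ) → ∑< m (λ i → ∑< n (f i)) ≡ ∑< n (λ j → ∑< m (λ i → f i j))
∑<-swap zero    n f = sym (trans (∑<-const n 0) (ℕ.*-zeroʳ n))
∑<-swap (suc m) n f = trans (cong (_+ ∑< n (f m)) (∑<-swap m n f))
                            (sym (∑<-+ n (λ j → ∑< m (λ i → f i j)) (f m)))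

∑<-zero : ∀ m f → ∑< m f ≡ 0 → ∀ i → i < m → f i ≡ 0
∑<-zero (suc m) f p i i<1+m with i ≟ m
... | yes refl = ℕ.m+n≡0⇒n≡0 (∑< m f) p
... | no  i≢m  = ∑<-zero m f (ℕ.m+n≡0⇒m≡0 (∑< m f) p) i (ℕ.≤∧≢⇒< (ℕ.≤-pred i<1+m) i≢m)

∑<-zeros : ∀ m f → (∀ i → i < m → f i ≡ 0) → ∑< m f ≡ 0
∑<-zeros m f p = trans (∑<-cong m p) (trans (∑<-const m 0) (ℕ.*-zeroʳ m))

∑<-delta : ∀ m a → a < m → (f : ℕ → ℕ) → ∑< m (λ i → bit (a ≡ᵇ i) * f i) ≡ f a
∑<-delta (suc m) a a<1+m f with a ≟ m
... | yes refl rewrite ≡ᵇ-refl m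
  = trans (cong (_+ (f m + 0)) (∑<-zeros m _ (λ i i<m → cong (λ b → bit b * f i)
      (≢⇒≡ᵇ (λ q → ℕ.<⇒≢ i<m (sym q)))))) (ℕ.+-identityʳ (f m))
... | no  a≢m  rewrite ≢⇒≡ᵇ a≢m
  = trans (ℕ.+-identityʳ _) (∑<-delta m a (ℕ.≤∧≢⇒< (ℕ.≤-pred a<1+m) a≢m) f)

-- A strict inequality in one term could not be made up for by the others. Applied to degrees, this
-- turns a matching with enough edges into a perfect one.
∑<-≤-eq : ∀ m f g → (∀ i → i < m → f i ≤ g i) → ∑< m f ≡ ∑< m g → ∀ i → i < m → f i ≡ g i
∑<-≤-eq (suc m) f g le eq i i<1+m with i ≟ m
... | yes refl = ℕ.≤-antisym (le m i<1+m)
      (ℕ.+-cancelˡ-≤ (∑< m f) _ _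
        (ℕ.≤-trans (ℕ.+-monoˡ-≤ (g m) (∑<-mono m (λ j j<m → le j (ℕ.m<n⇒m<1+n j<m))))
                   (ℕ.≤-reflexive (sym eq))))
... | no  i≢m  = ∑<-≤-eq m f g (λ j j<m → le j (ℕ.m<n⇒m<1+n j<m))
      (ℕ.≤-antisym (∑<-mono m (λ j j<m → le j (ℕ.m<n⇒m<1+n j<m)))
        (ℕ.+-cancelʳ-≤ (f m) _ _ (ℕ.≤-trans
          (ℕ.+-monoʳ-≤ (∑< m g) (le m (ℕ.n<1+n m))) (ℕ.≤-reflexive (sym eq)))))
      i (ℕ.≤∧≢⇒< (ℕ.≤-pred i<1+m) i≢m)

∑<-shift : ∀ m f → ∑< (suc m) f ≡ f 0 + ∑< m (f ∘ suc)
∑<-shift zero    f = sym (ℕ.+-identityʳ (f 0))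
∑<-shift (suc m) f = trans (cong (_+ f (suc m)) (∑<-shift m f)) (ℕ.+-assoc (f 0) _ _)

bit≤1 : ∀ b → bit b ≤ 1
bit≤1 false = z≤n
bit≤1 true  = s≤s z≤n

bit-true : ∀ b → 1 ≤ bit b → b ≡ true
bit-true true _ = refl

-- Adding the vertices one at a time

below : ℕ → VertexSet
below h u = u <ᵇ h

module Dynamic (src tgt wt : ℕ → ℕ) (act : ℕ → Bool) (loopless : ∀ e → src e ≢ tgt e) (m : ℕ) where
  open Matchings src tgt wt act

  -- One expression with two meanings. For v in V = `below h` it is the series of V - v, by the
  -- identity special to characteristic two. For v = h, just outside V, it is the series of V + h,
  -- by the ordinary expansion. All rows of the table can therefore be filled by the same rule.
  dp : ℕ → ℕ → Series
  dp h v W = μ m (below h) W xor nb m v (λ u W → below h u ∧ μ m (below h ∖ u) W) W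

  dp-inside : ∀ h v W → below h v ≡ true → dp h v W ≡ μ m (below h ∖ v) W
  dp-inside h v W p = trans (cong (_xor nb m v f W) (expand-twice loopless m v (below h) p W))
    (cancel (μ m (below h ∖ v) W) (nb m v f W))
    where
    f : ℕ → Series
    f u W = below h u ∧ μ m (below h ∖ u) W
    cancel : ∀ s t → (s xor t) xor t ≡ s
    cancel false false = refl
    cancel false true  = refl
    cancel true  false = refl
    cancel true  true  = refl

  -- Only vertices u inside `below h` are summed over, and there the series of V - u is again an
  -- entry of the table. As every term is shifted by an edge weight, positive weights make this a
  -- recursion on W.
  dp-recurrence : ∀ h v W →
    dp h v W ≡ μ m (below h) W xor nb m v (λ u W → below h u ∧ dp h u W) W
  dp-recurrence h v W = cong (μ m (below h) W xor_)
    (nb-cong-≗ loopless m v (λ u _ W → same u W) W)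
    where
    same : ∀ u W → below h u ∧ μ m (below h ∖ u) W ≡ below h u ∧ dp h u W
    same u W with below h u in eq
    ... | false = refl
    ... | true  = sym (dp-inside h u W eq)

  -- Deleting h from `below (suc h)` gives `below h`, so the expansion of the larger set along h has
  -- the shape of `dp` on the smaller one.
  dp-top : ∀ h W → dp h h W ≡ μ m (below (suc h)) W
  dp-top h W = sym (trans (expand loopless m h (below (suc h)) (<⇒<ᵇ-true (ℕ.n<1+n h)) W)
    (cong₂ _xor_ (μ-cong m removed W)
      (nb-cong-≗ loopless m h (λ u u≢h W → cong₂ _∧_ (other u u≢h) (μ-cong m (∖-cong u removed) W)) W)))
    where
    other : ∀ u → u ≢ h → below (suc h) u ≡ below h u
    other u u≢h with u <? h
    ... | yes u<h = trans (<⇒<ᵇ-true (ℕ.m<n⇒m<1+n u<h)) (sym (<⇒<ᵇ-true u<h))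
    ... | no  u≮h = trans (≮⇒<ᵇ-false (λ q → u≮h (ℕ.≤∧≢⇒< (ℕ.≤-pred q) u≢h))) (sym (≮⇒<ᵇ-false u≮h))
    removed : below (suc h) ∖ h ≐ below h
    removed u with u ≟ h
    ... | yes refl = trans (∖-removed (below (suc h)) h) (sym (≮⇒<ᵇ-false (ℕ.<-irrefl {h} refl)))
    ... | no  u≢h  = trans (∖-other (below (suc h)) u≢h) (other u u≢h)

  μ-empty : ∀ m W → μ m (below 0) W ≡ (W ≡ᵇ 0)
  μ-empty zero    W = refl
  μ-empty (suc m) W rewrite Bool.∧-zeroʳ (act m) = trans (Bool.xor-identityʳ _) (μ-empty m W)

-- From parities back to matchings

-- Edge sets are Boolean functions restricted to the edges below m.
module Weighted (src tgt wt : ℕ → ℕ) where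

  degree : (ℕ → Bool) → ℕ → ℕ → ℕ
  degree M m v = ∑< m λ e → bit (M e) * (bit (src e ≡ᵇ v) + bit (tgt e ≡ᵇ v))

  weight : (ℕ → Bool) → ℕ → ℕ
  weight M m = ∑< m λ e → bit (M e) * wt e

  -- The single bound on degrees says both that the chosen edges are disjoint and that they stay
  -- inside V.
  record MatchingIn (act : ℕ → Bool) (m : ℕ) (V : VertexSet) (W : ℕ) (M : ℕ → Bool) : Set where
    constructor matchingIn
    field
      degrees : ∀ v → degree M m v ≤ bit (V v)
      active  : ∀ e → e < m → M e ≡ true → act e ≡ true
      weighs  : weight M m ≡ W

  open MatchingIn

  _[_≔_] : (ℕ → Bool) → ℕ → Bool → ℕ → Bool
  (M [ e ≔ b ]) f = if f ≡ᵇ e then b else M f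

  set-same : ∀ M e b → (M [ e ≔ b ]) e ≡ b
  set-same M e b rewrite ≡ᵇ-refl e = refl

  set-below : ∀ M m b e → e < m → (M [ m ≔ b ]) e ≡ M e
  set-below M m b e e<m rewrite ≢⇒≡ᵇ (ℕ.<⇒≢ e<m) = refl

  degree-cong : ∀ m {M N} → (∀ e → e < m → M e ≡ N e) → ∀ v → degree M m v ≡ degree N m v
  degree-cong m p v = ∑<-cong m λ e e<m →
    cong (λ b → bit b * (bit (src e ≡ᵇ v) + bit (tgt e ≡ᵇ v))) (p e e<m)

  weight-cong : ∀ m {M N} → (∀ e → e < m → M e ≡ N e) → weight M m ≡ weight N m
  weight-cong m p = ∑<-cong m λ e e<m → cong (λ b → bit b * wt e) (p e e<m)

  module _ (act : ℕ → Bool) (loopless : ∀ e → src e ≢ tgt e) where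
    open Matchings src tgt wt act

    in-cong : ∀ m V W {M N} → (∀ e → e < m → M e ≡ N e) →
              MatchingIn act m V W M → MatchingIn act m V W N
    in-cong m V W p (matchingIn d a w) = matchingIn
      (λ v → subst (_≤ bit (V v)) (degree-cong m p v) (d v))
      (λ e e<m q → a e e<m (trans (p e e<m) q))
      (trans (sym (weight-cong m p)) w)

    omit-last : ∀ m V W M → M m ≡ false → MatchingIn act m V W M → MatchingIn act (suc m) V W M
    omit-last m V W M Mm (matchingIn d a w) = matchingIn d′ a′ w′
      where
      d′ : ∀ v → degree M (suc m) v ≤ bit (V v)
      d′ v rewrite Mm = subst (_≤ bit (V v)) (sym (ℕ.+-identityʳ _)) (d v)
      a′ : ∀ e → e < suc m → M e ≡ true → act e ≡ true
      a′ e e<1+m Me with e ≟ m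
      ... | yes refl = contradiction (trans (sym Me) Mm) λ ()
      ... | no  e≢m  = a e (ℕ.≤∧≢⇒< (ℕ.≤-pred e<1+m) e≢m) Me
      w′ : weight M (suc m) ≡ W
      w′ rewrite Mm = trans (ℕ.+-identityʳ _) w

    omit-last⁻¹ : ∀ m V W M → M m ≡ false → MatchingIn act (suc m) V W M → MatchingIn act m V W M
    omit-last⁻¹ m V W M Mm (matchingIn d a w) = matchingIn
      (λ v → ℕ.≤-trans (ℕ.m≤m+n _ _) (d v))
      (λ e e<m → a e (ℕ.m<n⇒m<1+n e<m))
      (trans (sym (trans (cong (λ b → weight M m + bit b * wt m) Mm) (ℕ.+-identityʳ _))) w)

    usable-ends : ∀ m V → usable m V ≡ true → V (src m) ≡ true × V (tgt m) ≡ true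
    usable-ends m V p with act m | V (src m) | V (tgt m)
    ... | true | true | true = refl , refl

    last-degree : ℕ → ℕ → ℕ
    last-degree m v = bit (src m ≡ᵇ v) + bit (tgt m ≡ᵇ v)

    take-last : ∀ m V W M → M m ≡ true → usable m V ≡ true →
                MatchingIn act m (V ∖ src m ∖ tgt m) W M → MatchingIn act (suc m) V (W + wt m) M
    take-last m V W M Mm ok (matchingIn d a w) = matchingIn d′ a′ w′
      where
      d′ : ∀ v → degree M (suc m) v ≤ bit (V v)
      d′ v rewrite Mm | ℕ.+-identityʳ (last-degree m v) with src m ≟ v | tgt m ≟ v | d v
      ... | yes refl | yes q | _ = contradiction (sym q) (loopless m)
      ... | yes refl | no b≢ | dv rewrite ≡ᵇ-refl (src m) | ≢⇒≡ᵇ b≢ | Bool.∧-zeroʳ (V (src m))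
            | ℕ.n≤0⇒n≡0 dv | proj₁ (usable-ends m V ok) = ℕ.≤-refl
      ... | no a≢ | yes refl | dv rewrite ≡ᵇ-refl (tgt m) | ≢⇒≡ᵇ a≢
            | Bool.∧-zeroʳ ((V ∖ src m) (tgt m)) | ℕ.n≤0⇒n≡0 dv | proj₂ (usable-ends m V ok) = ℕ.≤-refl
      ... | no a≢ | no b≢ | dv rewrite ≢⇒≡ᵇ a≢ | ≢⇒≡ᵇ b≢ | ≢⇒≡ᵇ (a≢ ∘ sym) | ≢⇒≡ᵇ (b≢ ∘ sym)
            | Bool.∧-identityʳ (V v ∧ true) | Bool.∧-identityʳ (V v) =
        subst (_≤ bit (V v)) (sym (ℕ.+-identityʳ _)) dv
      a′ : ∀ e → e < suc m → M e ≡ true → act e ≡ true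
      a′ e e<1+m Me with e ≟ m
      ... | yes refl = split ok
        where
        split : ∀ {x y} → x ∧ y ≡ true → x ≡ true
        split {true} _ = refl
      ... | no  e≢m  = a e (ℕ.≤∧≢⇒< (ℕ.≤-pred e<1+m) e≢m) Me
      w′ : weight M (suc m) ≡ W + wt m
      w′ rewrite Mm = cong₂ _+_ w (ℕ.+-identityʳ (wt m))

    take-last⁻¹ : ∀ m V W M → M m ≡ true → MatchingIn act (suc m) V W M →
      usable m V ≡ true × ∃[ W′ ] W ≡ W′ + wt m × MatchingIn act m (V ∖ src m ∖ tgt m) W′ M
    take-last⁻¹ m V W M Mm (matchingIn d a w) =
        cong₂ _∧_ (a m (ℕ.n<1+n m) Mm) (cong₂ _∧_ Va Vb)
      , weight M m
      , trans (sym w) (trans (cong (λ b → weight M m + bit b * wt m) Mm)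
                             (cong (weight M m +_) (ℕ.+-identityʳ (wt m))))
      , matchingIn d′ (λ e e<m → a e (ℕ.m<n⇒m<1+n e<m)) refl
      where
      bound : ∀ v → degree M m v + last-degree m v ≤ bit (V v)
      bound v = subst (_≤ bit (V v)) (trans
        (cong (λ b → degree M m v + bit b * last-degree m v) Mm)
        (cong (degree M m v +_) (ℕ.+-identityʳ _))) (d v)
      at-src : 1 ≤ last-degree m (src m)
      at-src rewrite ≡ᵇ-refl (src m) = s≤s z≤n
      at-tgt : 1 ≤ last-degree m (tgt m)
      at-tgt rewrite ≡ᵇ-refl (tgt m) = ℕ.m≤n+m 1 (bit (src m ≡ᵇ tgt m))
      Va : V (src m) ≡ true
      Va = bit-true _ (ℕ.≤-trans at-src (ℕ.≤-trans (ℕ.m≤n+m _ (degree M m (src m))) (bound (src m))))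
      Vb : V (tgt m) ≡ true
      Vb = bit-true _ (ℕ.≤-trans at-tgt (ℕ.≤-trans (ℕ.m≤n+m _ (degree M m (tgt m))) (bound (tgt m))))
      saturated : ∀ v → 1 ≤ last-degree m v → degree M m v ≤ 0
      saturated v p = ℕ.+-cancelʳ-≤ 1 _ _
        (ℕ.≤-trans (ℕ.+-monoʳ-≤ (degree M m v) p) (ℕ.≤-trans (bound v) (bit≤1 (V v))))
      d′ : ∀ v → degree M m v ≤ bit ((V ∖ src m ∖ tgt m) v)
      d′ v with src m ≟ v | tgt m ≟ v
      ... | yes refl | _        = ℕ.≤-trans (saturated (src m) at-src) z≤n
      ... | no  _    | yes refl = ℕ.≤-trans (saturated (tgt m) at-tgt) z≤n
      ... | no  a≢   | no  b≢   rewrite ∖-other (V ∖ src m) (b≢ ∘ sym) | ∖-other V (a≢ ∘ sym)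
        = ℕ.≤-trans (ℕ.m≤m+n _ _) (bound v)

    -- An odd number is not zero: the recursion follows a summand that is odd and decides the last
    -- edge accordingly.
    μ-witness : ∀ m V W → μ m V W ≡ true → ∃[ M ] MatchingIn act m V W M
    μ-witness zero    V zero p = (λ _ → false) , matchingIn (λ _ → z≤n) (λ _ ()) refl
    μ-witness (suc m) V W    p with μ m V W in eq
    ... | true = let M , q = μ-witness m V W eq in
      M [ m ≔ false ] , omit-last m V W _ (set-same M m false)
        (in-cong m V W (λ e e<m → sym (set-below M m false e e<m)) q)
    ... | false with usable m V in ok | wt m ≤? W
    ...   | true | yes wt≤W =
      let M , q = μ-witness m _ (W ∸ wt m) (trans (sym (shift-≤ (wt m) _ W wt≤W)) p) in
      M [ m ≔ true ] , subst (λ W → MatchingIn act (suc m) V W (M [ m ≔ true ])) (ℕ.m∸n+n≡m wt≤W)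
        (take-last m V (W ∸ wt m) _ (set-same M m true) ok
          (in-cong m _ (W ∸ wt m) (λ e e<m → sym (set-below M m true e e<m)) q))
    ...   | true | no wt≰W = contradiction (trans (sym p) (shift-> (wt m) _ W (ℕ.≰⇒> wt≰W))) λ ()

    -- The summand that treats the last edge as M does is 1 by induction. If the other summand were
    -- 1 as well, `μ-witness` would give a second matching, differing from M at the last edge.
    μ-unique : ∀ m V W M → MatchingIn act m V W M →
               (∀ N → MatchingIn act m V W N → ∀ e → e < m → N e ≡ M e) → μ m V W ≡ true
    μ-unique zero    V W M q unique rewrite sym (weighs q) = refl
    μ-unique (suc m) V W M q unique with M m in Mm
    ... | false rewrite μ-unique m V W M (omit-last⁻¹ m V W M Mm q)
          (λ N r e e<m → trans (sym (set-below N m false e e<m))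
            (unique (N [ m ≔ false ]) (omit-last m V W _ (set-same N m false)
              (in-cong m V W (λ e e<m → sym (set-below N m false e e<m)) r)) e (ℕ.m<n⇒m<1+n e<m)))
        = cong (true xor_) none
      where
      none : usable m V ∧ shift (wt m) (μ m (V ∖ src m ∖ tgt m)) W ≡ false
      none with usable m V in ok | shift (wt m) (μ m (V ∖ src m ∖ tgt m)) W in eq
      ... | false | _     = refl
      ... | true  | false = refl
      ... | true  | true  with wt m ≤? W
      ...   | no wt≰W  = contradiction (trans (sym eq) (shift-> (wt m) _ W (ℕ.≰⇒> wt≰W))) λ ()
      ...   | yes wt≤W =
        let N , r = μ-witness m _ (W ∸ wt m) (trans (sym (shift-≤ (wt m) _ W wt≤W)) eq)
            s = subst (λ W → MatchingIn act (suc m) V W (N [ m ≔ true ])) (ℕ.m∸n+n≡m wt≤W)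
                  (take-last m V (W ∸ wt m) _ (set-same N m true) ok
                    (in-cong m _ (W ∸ wt m) (λ e e<m → sym (set-below N m true e e<m)) r))
        in contradiction
             (trans (sym (set-same N m true)) (trans (unique _ s m (ℕ.n<1+n m)) Mm)) λ ()
    ... | true with take-last⁻¹ m V W M Mm q
    ...   | ok , W′ , refl , r
      rewrite ok
            | shift-≤ (wt m) (μ m (V ∖ src m ∖ tgt m)) (W′ + wt m) (ℕ.m≤n+m (wt m) W′)
            | ℕ.m+n∸n≡m W′ (wt m)
            | μ-unique m (V ∖ src m ∖ tgt m) W′ M r
                (λ N t e e<m → trans (sym (set-below N m true e e<m))
                  (unique (N [ m ≔ true ]) (take-last m V W′ _ (set-same N m true) ok
                    (in-cong m _ W′ (λ e e<m → sym (set-below N m true e e<m)) t))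
                    e (ℕ.m<n⇒m<1+n e<m)))
      = none
      where
      none : μ m V (W′ + wt m) xor true ≡ true
      none with μ m V (W′ + wt m) in eq
      ... | false = refl
      ... | true  =
        let N , t = μ-witness m V (W′ + wt m) eq
        in contradiction (trans (sym (set-same N m false)) (trans
             (unique (N [ m ≔ false ]) (omit-last m V _ _ (set-same N m false)
               (in-cong m V _ (λ e e<m → sym (set-below N m false e e<m)) t)) m (ℕ.n<1+n m)) Mm))
             λ ()

  others : ℕ → ℕ → Bool
  others d e = not (e ≡ᵇ d)

  -- A matching that is alone in its weight class is read off from the
  -- parities obtained by deleting one edge at a time.
  μ-others : (∀ e → src e ≢ tgt e) → ∀ m V W M → MatchingIn (λ _ → true) m V W M →
    (∀ N → MatchingIn (λ _ → true) m V W N → ∀ e → e < m → N e ≡ M e) →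
    ∀ d → d < m → Matchings.μ src tgt wt (others d) m V W ≡ not (M d)
  μ-others loopless m V W M q unique d d<m with M d in Md
  ... | false = μ-unique (others d) loopless m V W M
      (matchingIn (degrees q) avoid (weighs q))
      (λ N r → unique N (matchingIn (degrees r) (λ _ _ _ → refl) (weighs r)))
    where
    avoid : ∀ e → e < m → M e ≡ true → others d e ≡ true
    avoid e e<m Me = cong not (≢⇒≡ᵇ {e} {d} λ { refl → contradiction (trans (sym Me) Md) λ () })
  ... | true with Matchings.μ src tgt wt (others d) m V W in eq
  ...   | false = refl
  ...   | true  =
    let N , r = μ-witness (others d) loopless m V W eq
        Nd = trans (unique N (matchingIn (degrees r) (λ _ _ _ → refl) (weighs r)) d d<m) Md
    in contradiction (trans (sym (active r d d<m Nd)) (cong not (≡ᵇ-refl d))) λ ()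

-- A language of bounded loops

-- A power of two, so that interleaved addresses can be formed by four doublings on a machine
-- without multiplication.
Arr : Set
Arr = Fin 16

infixl 7 _⊞_ _⊟_
infix 6 _¿_∶_
infix 8 _⟨_⟩
infix 5 _↤_ _⟨_⟩↤_ inp⟨_⟩↤_
infixr 4 _︔_
infix 5 for_<_repeat_

data Expr : Set where
  lit var par : ℕ → Expr
  _⟨_⟩        : Arr → Expr → Expr
  inp         : Expr → Expr
  _⊞_ _⊟_     : Expr → Expr → Expr
  _¿_∶_       : Expr → Expr → Expr → Expr

-- There is no conditional command and loops are bounded by parameters, which
-- commands cannot change: the number of steps and the steps at which a coin
-- is used are then known in advance.
data Cmd : Set where
  noop        : Cmd
  _↤_         : ℕ → Expr → Cmd
  _⟨_⟩↤_      : Arr → Expr → Expr → Cmd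
  inp⟨_⟩↤_    : Expr → Expr → Cmd
  toss        : ℕ → Cmd
  _︔_         : Cmd → Cmd → Cmd
  for_<_repeat_   : ℕ → ℕ → Cmd → Cmd

record State : Set where
  constructor state
  field
    vars  : ℕ → ℕ
    arrs  : Arr → ℕ → ℕ
    cells : ℕ → ℕ
    coins : List Bool
open State

Params : Set
Params = ℕ → ℕ

choose : ℕ → ℕ → ℕ → ℕ
choose zero    a b = b
choose (suc _) a b = a

-- Parameter 0 is the last address of the input; accesses to the input are
-- cut off there, so that they cannot meet the arrays behind it.
clamp : Params → ℕ → ℕ
clamp ρ x = x ∸ (x ∸ ρ 0)

eval : Params → State → Expr → ℕ
eval ρ h (lit a)       = a
eval ρ h (var x)       = vars h x
eval ρ h (par y)       = ρ y
eval ρ h (k ⟨ e ⟩)     = arrs h k (eval ρ h e)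
eval ρ h (inp e)       = cells h (clamp ρ (eval ρ h e))
eval ρ h (a ⊞ b)       = eval ρ h a + eval ρ h b
eval ρ h (a ⊟ b)       = eval ρ h a ∸ eval ρ h b
eval ρ h (c ¿ a ∶ b)   = choose (eval ρ h c) (eval ρ h a) (eval ρ h b)

setVar : ℕ → ℕ → State → State
setVar x a h = record h { vars = vars h [ x ↦ a ] }

setArr : Arr → ℕ → ℕ → State → State
setArr k x a h = record h
  { arrs = λ j → if does (j Fin.≟ k) then arrs h j [ x ↦ a ] else arrs h j }

setCell : ℕ → ℕ → State → State
setCell x a h = record h { cells = cells h [ x ↦ a ] }

firstCoin : List Bool → Bool
firstCoin []      = false
firstCoin (b ∷ _) = b

exec : Params → Cmd → State → State
iterate : Params → ℕ → Cmd → ℕ → State → State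

exec ρ noop               h = h
exec ρ (x ↤ e)            h = setVar x (eval ρ h e) h
exec ρ (k ⟨ a ⟩↤ e)      h = setArr k (eval ρ h a) (eval ρ h e) h
exec ρ (inp⟨ a ⟩↤ e)     h = setCell (clamp ρ (eval ρ h a)) (eval ρ h e) h
exec ρ (toss x)           h = record (setVar x (bit (firstCoin (coins h))) h) { coins = List.drop 1 (coins h) }
exec ρ (A ︔ B)            h = exec ρ B (exec ρ A h)
exec ρ (for x < y repeat A)   h = iterate ρ x A (ρ y) h

iterate ρ x A zero    h = h
iterate ρ x A (suc N) h = exec ρ A (setVar x N (iterate ρ x A N h))

-- Compilation.  Temporaries, variables, parameters and loop counters occupy
-- the four residue classes of register numbers modulo 4.

quad : ℕ → ℕ
quad zero    = 0
quad (suc x) = suc (suc (suc (suc (quad x))))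

tmpR varR parR cntR : ℕ → ℕ
tmpR d = quad d
varR x = 1 + quad x
parR y = 2 + quad y
cntR i = 3 + quad i

address : Arr → ℕ → Program
address k d =
  tmpR d ≔ tmpR d ⊕ tmpR d ⨾
  tmpR d ≔ tmpR d ⊕ tmpR d ⨾
  tmpR d ≔ tmpR d ⊕ tmpR d ⨾
  tmpR d ≔ tmpR d ⊕ tmpR d ⨾
  tmpR d ≔ tmpR d ⊕ parR 0 ⨾
  tmpR (suc d) ≔const suc (toℕ k) ⨾
  tmpR d ≔ tmpR d ⊕ tmpR (suc d)

cut : ℕ → Program
cut d =
  tmpR (suc d) ≔ tmpR d ⊖ parR 0 ⨾
  tmpR d ≔ tmpR d ⊖ tmpR (suc d)

move : ℕ → ℕ → Program
move i j = i ≔const 0 ⨾ i ≔ i ⊕ j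

-- The second argument is a stack height d: the result is left in temporary d and only temporaries
-- from d on are overwritten, so operands evaluated earlier survive.
compileE : Expr → ℕ → Program
compileE (lit a)     d = tmpR d ≔const a
compileE (var x)     d = move (tmpR d) (varR x)
compileE (par y)     d = move (tmpR d) (parR y)
compileE (k ⟨ e ⟩)   d = compileE e d ⨾ address k d ⨾ tmpR d ≔mem[ tmpR d ]
compileE (inp e)     d = compileE e d ⨾ cut d ⨾ tmpR d ≔mem[ tmpR d ]
compileE (a ⊞ b)     d = compileE a d ⨾ compileE b (suc d) ⨾ tmpR d ≔ tmpR d ⊕ tmpR (suc d)
compileE (a ⊟ b)     d = compileE a d ⨾ compileE b (suc d) ⨾ tmpR d ≔ tmpR d ⊖ tmpR (suc d)
compileE (c ¿ a ∶ b) d =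
  compileE c d ⨾ compileE a (suc d) ⨾ compileE b (suc (suc d)) ⨾
  ifPos tmpR d then move (tmpR d) (tmpR (suc d)) else move (tmpR d) (tmpR (suc (suc d)))

-- A conditional evaluates both branches and then performs one of two moves of equal length, so the
-- cost does not depend on the state.
costE : Expr → ℕ
costE (lit a)     = 1
costE (var x)     = 3
costE (par y)     = 3
costE (k ⟨ e ⟩)   = suc (costE e + 15)
costE (inp e)     = suc (costE e + 5)
costE (a ⊞ b)     = suc (costE a + suc (costE b + 1))
costE (a ⊟ b)     = suc (costE a + suc (costE b + 1))
costE (c ¿ a ∶ b) = suc (costE c + suc (costE a + suc (costE b + 4)))

-- The second argument is the nesting depth, which selects the loop counter.
compile : Cmd → ℕ → Program
compile noop             i = skip
compile (x ↤ e)          i = compileE e 0 ⨾ move (varR x) (tmpR 0)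
compile (k ⟨ a ⟩↤ e)    i = compileE a 0 ⨾ address k 0 ⨾ compileE e 1 ⨾ mem[ tmpR 0 ]≔ tmpR 1
compile (inp⟨ a ⟩↤ e)   i = compileE a 0 ⨾ cut 0 ⨾ compileE e 1 ⨾ mem[ tmpR 0 ]≔ tmpR 1
compile (toss x)         i = varR x ≔coin
compile (A ︔ B)          i = compile A i ⨾ compile B i
compile (for x < y repeat A) i =
  move (cntR i) (parR y) ⨾
  whilePos cntR i loop
    -- The hidden counter runs down while x runs up. As x is recomputed in every round, the body
    -- cannot influence the number of rounds.
    (varR x ≔ parR y ⊖ cntR i ⨾ compile A (suc i) ⨾
     tmpR 0 ≔const 1 ⨾ cntR i ≔ cntR i ⊖ tmpR 0)

loopCost : ℕ → ℕ → ℕ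
loopCost a zero    = 1
loopCost a (suc c) = suc (suc (1 + suc (a + 3)) + loopCost a c)

cost : Cmd → Params → ℕ
cost noop             ρ = 1
cost (x ↤ e)          ρ = suc (costE e + 3)
cost (k ⟨ a ⟩↤ e)    ρ = suc (costE a + suc (13 + suc (costE e + 1)))
cost (inp⟨ a ⟩↤ e)   ρ = suc (costE a + suc (3 + suc (costE e + 1)))
cost (toss x)         ρ = 1
cost (A ︔ B)          ρ = suc (cost A ρ + cost B ρ)
cost (for x < y repeat A) ρ = suc (3 + loopCost (cost A ρ) (ρ y))

quiet : ∀ {n} → Vec Bool n
quiet = Vec.replicate _ false

loopMask : ∀ {a} → Vec Bool a → ∀ c → Vec Bool (loopCost a c)
loopMask m zero    = quiet
loopMask m (suc c) = false ∷ ((false ∷ false ∷ false ∷ (m ++ quiet {3})) ++ loopMask m c)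

-- The steps that look at the coin.
mask : ∀ A ρ → Vec Bool (cost A ρ)
mask noop             ρ = quiet
mask (x ↤ e)          ρ = quiet
mask (k ⟨ a ⟩↤ e)    ρ = quiet
mask (inp⟨ a ⟩↤ e)   ρ = quiet
mask (toss x)         ρ = true ∷ []
mask (A ︔ B)          ρ = false ∷ (mask A ρ ++ mask B ρ)
mask (for x < y repeat A) ρ = false ∷ (quiet {3} ++ loopMask (mask A ρ) (ρ y))

extract : ∀ {n} → Vec Bool n → Vec Bool n → List Bool
extract []          []      = []
extract (true  ∷ m) (b ∷ ω) = b ∷ extract m ω
extract (false ∷ m) (b ∷ ω) = extract m ω

extract-++ : ∀ {a b} (m : Vec Bool a) (m′ : Vec Bool b) ω ω′ →
             extract (m ++ m′) (ω ++ ω′) ≡ extract m ω List.++ extract m′ ω′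
extract-++ []          m′ []      ω′ = refl
extract-++ (true  ∷ m) m′ (b ∷ ω) ω′ = cong (b ∷_) (extract-++ m m′ ω ω′)
extract-++ (false ∷ m) m′ (b ∷ ω) ω′ = extract-++ m m′ ω ω′

extract-quiet : ∀ {n} (ω : Vec Bool n) → extract quiet ω ≡ []
extract-quiet []      = refl
extract-quiet (b ∷ ω) = extract-quiet ω

-- Correctness of the compilation

↦-same : ∀ f i a → (f [ i ↦ a ]) i ≡ a
↦-same f i a rewrite ≡ᵇ-refl i = refl

↦-other : ∀ f {i j} a → j ≢ i → (f [ i ↦ a ]) j ≡ f j
↦-other f a j≢i rewrite ≢⇒≡ᵇ j≢i = refl

quad-injective : ∀ x y → quad x ≡ quad y → x ≡ y
quad-injective zero    zero    p = refl
quad-injective (suc x) (suc y) p = cong suc (quad-injective x y (cong (_∸ 4) p))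

quad≢1 : ∀ x y → quad x ≢ 1 + quad y
quad≢1 (suc x) (suc y) p = quad≢1 x y (cong (_∸ 4) p)

quad≢2 : ∀ x y → quad x ≢ 2 + quad y
quad≢2 (suc x) (suc y) p = quad≢2 x y (cong (_∸ 4) p)

quad≢3 : ∀ x y → quad x ≢ 3 + quad y
quad≢3 (suc x) (suc y) p = quad≢3 x y (cong (_∸ 4) p)

double : ℕ → ℕ
double x = x + x

-- The arrays are interleaved modulo 16 behind the last input address, which gives each of them
-- unlimited length without any allocation.
location : Params → Arr → ℕ → ℕ
location ρ k x = double (double (double (double x))) + ρ 0 + suc (toℕ k)

location-injective : ∀ ρ k x k′ x′ → location ρ k x ≡ location ρ k′ x′ → k ≡ k′ × x ≡ x′
location-injective ρ k x k′ x′ p = Fin.toℕ-injective same-k , same-x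
  where
  arrange : ∀ x l k → (((x + x) + (x + x)) + ((x + x) + (x + x)) + (((x + x) + (x + x)) + ((x + x) + (x + x)))) + l + (1 + k)
            ≡ (k + x * 16) + (1 + l)
  arrange = solve 3 (λ x l k →
    (((x :+ x) :+ (x :+ x)) :+ ((x :+ x) :+ (x :+ x)) :+ (((x :+ x) :+ (x :+ x)) :+ ((x :+ x) :+ (x :+ x)))) :+ l :+ (con 1 :+ k)
    := (k :+ x :* con 16) :+ (con 1 :+ l)) refl
    where open +-*-Solver
  q : toℕ k + x * 16 ≡ toℕ k′ + x′ * 16
  q = ℕ.+-cancelʳ-≡ (suc (ρ 0)) _ _
    (trans (sym (arrange x (ρ 0) (toℕ k))) (trans p (arrange x′ (ρ 0) (toℕ k′))))
  rem : ∀ (k : Arr) x → (toℕ k + x * 16) % 16 ≡ toℕ k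
  rem k x = trans ([m+kn]%n≡m%n (toℕ k) x 16) (m<n⇒m%n≡m (Fin.toℕ<n k))
  same-k : toℕ k ≡ toℕ k′
  same-k = trans (sym (rem k x)) (trans (cong (_% 16) q) (rem k′ x′))
  same-x : x ≡ x′
  same-x = ℕ.*-cancelʳ-≡ x x′ 16 (ℕ.+-cancelˡ-≡ (toℕ k) _ _
    (trans q (cong (_+ x′ * 16) (sym same-k))))

location-> : ∀ ρ k x → ρ 0 < location ρ k x
location-> ρ k x = ℕ.<-≤-trans (ℕ.m<m+n (ρ 0) {suc (toℕ k)} (s≤s z≤n))
  (ℕ.+-monoˡ-≤ (suc (toℕ k)) (ℕ.m≤n+m (ρ 0) (double (double (double (double x))))))

clamp≤ : ∀ ρ x → clamp ρ x ≤ ρ 0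
clamp≤ ρ x with x ≤? ρ 0
... | yes p = ℕ.≤-trans (ℕ.m∸n≤m x (x ∸ ρ 0)) p
... | no  p = ℕ.≤-reflexive (ℕ.m∸[m∸n]≡n (ℕ.<⇒≤ (ℕ.≰⇒> p)))

clamp-≡ : ∀ ρ x → x ≤ ρ 0 → clamp ρ x ≡ x
clamp-≡ ρ x p = cong (x ∸_) (ℕ.m≤n⇒m∸n≡0 p)

run-++ : ∀ {a b} (ω : Vec Bool a) (ω′ : Vec Bool b) κ → run (ω ++ ω′) κ ≡ run ω′ (run ω κ)
run-++ []      ω′ κ = refl
run-++ (b ∷ ω) ω′ κ = run-++ ω ω′ (step b κ)

-- Quantifying over `ω` expresses that this piece of program takes exactly c steps and ignores the
-- coins; the arbitrary continuation `K` makes such pieces compose.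
Runs : Program → ℕ → Store → Store → Set
Runs A c σ σ′ = ∀ (ω : Vec Bool c) K → run ω (A ∷ K , σ) ≡ (K , σ′)

infixr 5 _then_

_then_ : ∀ {A B a b σ σ′ σ″} → Runs A a σ σ′ → Runs B b σ′ σ″ → Runs (A ⨾ B) (suc (a + b)) σ σ″
_then_ {a = a} r s (_ ∷ ω) K with Vec.splitAt a ω
... | ω₁ , ω₂ , refl = trans (run-++ ω₁ ω₂ _) (trans (cong (run ω₂) (r ω₁ _)) (s ω₂ K))

once : ∀ {A σ σ′} → (∀ b K → step b (A ∷ K , σ) ≡ (K , σ′)) → Runs A 1 σ σ′
once p (b ∷ []) K = p b K

module _ {i : ℕ} {σ : Store} {K : List Program} (b : Bool) where
  if-zero : ∀ {A B} → reg σ i ≡ 0 → step b ((ifPos i then A else B) ∷ K , σ) ≡ (B ∷ K , σ)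
  if-zero p rewrite p = refl
  if-suc : ∀ {A B a} → reg σ i ≡ suc a → step b ((ifPos i then A else B) ∷ K , σ) ≡ (A ∷ K , σ)
  if-suc p rewrite p = refl
  while-zero : ∀ {A} → reg σ i ≡ 0 → step b ((whilePos i loop A) ∷ K , σ) ≡ (K , σ)
  while-zero p rewrite p = refl
  while-suc : ∀ {A a} → reg σ i ≡ suc a →
              step b ((whilePos i loop A) ∷ K , σ) ≡ (A ∷ (whilePos i loop A) ∷ K , σ)
  while-suc p rewrite p = refl

_[_⇐_] : Store → ℕ → ℕ → Store
σ [ i ⇐ a ] = store (reg σ [ i ↦ a ]) (mem σ)

const-runs : ∀ i a σ → Runs (i ≔const a) 1 σ (σ [ i ⇐ a ])
const-runs i a σ = once λ _ _ → refl

add-runs : ∀ i j l σ → Runs (i ≔ j ⊕ l) 1 σ (σ [ i ⇐ reg σ j + reg σ l ])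
add-runs i j l σ = once λ _ _ → refl

sub-runs : ∀ i j l σ → Runs (i ≔ j ⊖ l) 1 σ (σ [ i ⇐ reg σ j ∸ reg σ l ])
sub-runs i j l σ = once λ _ _ → refl

load-runs : ∀ i j σ → Runs (i ≔mem[ j ]) 1 σ (σ [ i ⇐ mem σ (reg σ j) ])
load-runs i j σ = once λ _ _ → refl

save-runs : ∀ i j σ → Runs (mem[ i ]≔ j) 1 σ (store (reg σ) (mem σ [ reg σ i ↦ reg σ j ]))
save-runs i j σ = once λ _ _ → refl

record Frame (d : ℕ) (σ σ′ : Store) : Set where
  constructor frame
  field
    regs-kept : ∀ r → (∀ j → d ≤ j → r ≢ tmpR j) → reg σ′ r ≡ reg σ r
    mem-kept  : mem σ′ ≡ mem σ
open Frame

frame-trans : ∀ {d e σ σ′ σ″} → d ≤ e → Frame d σ σ′ → Frame e σ′ σ″ → Frame d σ σ″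
frame-trans d≤e (frame p q) (frame p′ q′) = frame
  (λ r away → trans (p′ r (λ j e≤j → away j (ℕ.≤-trans d≤e e≤j))) (p r away))
  (trans q′ q)

frame-write : ∀ {d σ} j a → d ≤ j → Frame d σ (σ [ tmpR j ⇐ a ])
frame-write {σ = σ} j a d≤j = frame (λ r away → ↦-other (reg σ) a (away j d≤j)) refl

tmp-kept : ∀ {d σ σ′} j → Frame d σ σ′ → j < d → reg σ′ (tmpR j) ≡ reg σ (tmpR j)
tmp-kept j F j<d = regs-kept F (tmpR j)
  (λ i d≤i eq → ℕ.<-irrefl (quad-injective j i eq) (ℕ.<-≤-trans j<d d≤i))

var-kept : ∀ {d σ σ′} x → Frame d σ σ′ → reg σ′ (varR x) ≡ reg σ (varR x)
var-kept x F = regs-kept F (varR x) λ j _ eq → quad≢1 j x (sym eq)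

par-kept : ∀ {d σ σ′} x → Frame d σ σ′ → reg σ′ (parR x) ≡ reg σ (parR x)
par-kept x F = regs-kept F (parR x) λ j _ eq → quad≢2 j x (sym eq)

cnt-kept : ∀ {d σ σ′} x → Frame d σ σ′ → reg σ′ (cntR x) ≡ reg σ (cntR x)
cnt-kept x F = regs-kept F (cntR x) λ j _ eq → quad≢3 j x (sym eq)

frame-weaken : ∀ {d e σ σ′} → d ≤ e → Frame e σ σ′ → Frame d σ σ′
frame-weaken d≤e F = frame (λ r away → regs-kept F r (λ j q → away j (ℕ.≤-trans d≤e q))) (mem-kept F)

-- Temporaries and loop counters are left unconstrained, so evaluating an expression preserves the
-- relation.
record Sim (ρ : Params) (h : State) (σ : Store) : Set where
  constructor sim
  field
    vars-sim  : ∀ x → reg σ (varR x) ≡ vars h x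
    pars-sim  : ∀ y → reg σ (parR y) ≡ ρ y
    cells-sim : ∀ x → x ≤ ρ 0 → mem σ x ≡ cells h x
    arrs-sim  : ∀ k x → mem σ (location ρ k x) ≡ arrs h k x
open Sim

sim-frame : ∀ {ρ h d σ σ′} → Sim ρ h σ → Frame d σ σ′ → Sim ρ h σ′
sim-frame {ρ} S F = sim
  (λ x → trans (var-kept x F) (vars-sim S x))
  (λ y → trans (par-kept y F) (pars-sim S y))
  (λ x p → trans (cong (λ f → f x) (mem-kept F)) (cells-sim S x p))
  (λ k x → trans (cong (λ f → f (location ρ k x)) (mem-kept F)) (arrs-sim S k x))

Computes : Program → ℕ → ℕ → ℕ → Store → Set
Computes A c d a σ = ∃[ σ′ ] Runs A c σ σ′ × reg σ′ (tmpR d) ≡ a × Frame d σ σ′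

frame-refl : ∀ {d σ} → Frame d σ σ
frame-refl = frame (λ _ _ → refl) refl

write-computes : ∀ {A c x σ} d σ₁ a → Runs A c σ (σ₁ [ tmpR d ⇐ a ]) → Frame d σ σ₁ → a ≡ x →
                 Computes A c d x σ
write-computes d σ₁ a r F p = σ₁ [ tmpR d ⇐ a ] , r , trans (↦-same (reg σ₁) (tmpR d) a) p ,
  frame-trans ℕ.≤-refl F (frame-write {d} {σ₁} d a ℕ.≤-refl)

move-runs : ∀ i j σ → j ≢ i → Runs (move i j) 3 σ (σ [ i ⇐ 0 ] [ i ⇐ reg σ j ])
move-runs i j σ j≢i = λ { (_ ∷ _ ∷ _ ∷ []) K →
  cong (λ a → K , σ [ i ⇐ 0 ] [ i ⇐ a ]) (cong₂ _+_ (↦-same (reg σ) i 0) (↦-other (reg σ) 0 j≢i)) }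

move-computes : ∀ j d σ {a} → j ≢ tmpR d → reg σ j ≡ a → Computes (move (tmpR d) j) 3 d a σ
move-computes j d σ j≢d p = write-computes d (σ [ tmpR d ⇐ 0 ]) (reg σ j) (move-runs (tmpR d) j σ j≢d)
  (frame-write {d} {σ} d 0 ℕ.≤-refl) p

suc-tmp : ∀ d → tmpR d ≢ tmpR (suc d)
suc-tmp d p = ℕ.1+n≢n (sym (quad-injective d (suc d) p))

double-computes : ∀ d {a} σ → reg σ (tmpR d) ≡ a →
                  Computes (tmpR d ≔ tmpR d ⊕ tmpR d) 1 d (double a) σ
double-computes d σ p =
  write-computes d σ (double (reg σ (tmpR d))) (add-runs (tmpR d) (tmpR d) (tmpR d) σ) frame-refl (cong double p)

andthen : ∀ {A B a b x y σ} d → Computes A a d x σ →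
          (∀ σ′ → reg σ′ (tmpR d) ≡ x → Frame d σ σ′ → Computes B b d y σ′) →
          Computes (A ⨾ B) (suc (a + b)) d y σ
andthen d (σ₁ , r₁ , v₁ , F₁) k with k σ₁ v₁ F₁
... | σ₂ , r₂ , v₂ , F₂ = σ₂ , r₁ then r₂ , v₂ , frame-trans ℕ.≤-refl F₁ F₂

address-computes : ∀ {ρ h} k d a σ → Sim ρ h σ → reg σ (tmpR d) ≡ a →
                   Computes (address k d) 13 d (location ρ k a) σ
address-computes {ρ} k d a σ S p =
  andthen d (double-computes d σ p) λ σ₁ p₁ F₁ →
  andthen d (double-computes d σ₁ p₁) λ σ₂ p₂ F₂ →
  andthen d (double-computes d σ₂ p₂) λ σ₃ p₃ F₃ →
  andthen d (double-computes d σ₃ p₃) λ σ₄ p₄ F₄ →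
  andthen d (write-computes d σ₄ (reg σ₄ (tmpR d) + reg σ₄ (parR 0)) (add-runs (tmpR d) (tmpR d) (parR 0) σ₄)
    frame-refl (cong₂ _+_ p₄
      (pars-sim (sim-frame (sim-frame (sim-frame (sim-frame S F₁) F₂) F₃) F₄) 0))) λ σ₅ p₅ _ →
  write-computes d (σ₅ [ tmpR (suc d) ⇐ suc (toℕ k) ])
    (reg (σ₅ [ tmpR (suc d) ⇐ suc (toℕ k) ]) (tmpR d) + reg (σ₅ [ tmpR (suc d) ⇐ suc (toℕ k) ]) (tmpR (suc d)))
    (const-runs (tmpR (suc d)) (suc (toℕ k)) σ₅ then
     add-runs (tmpR d) (tmpR d) (tmpR (suc d)) (σ₅ [ tmpR (suc d) ⇐ suc (toℕ k) ]))
    (frame-write {d} {σ₅} (suc d) (suc (toℕ k)) (ℕ.n≤1+n d))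
    (cong₂ _+_ (trans (↦-other (reg σ₅) (suc (toℕ k)) (suc-tmp d)) p₅) (↦-same (reg σ₅) (tmpR (suc d)) (suc (toℕ k))))

cut-computes : ∀ {ρ h} d a σ → Sim ρ h σ → reg σ (tmpR d) ≡ a → Computes (cut d) 3 d (clamp ρ a) σ
cut-computes d a σ S p =
  write-computes d σ₁ (reg σ₁ (tmpR d) ∸ reg σ₁ (tmpR (suc d)))
    (sub-runs (tmpR (suc d)) (tmpR d) (parR 0) σ then sub-runs (tmpR d) (tmpR d) (tmpR (suc d)) σ₁)
    (frame-write {d} {σ} (suc d) x (ℕ.n≤1+n d))
    (cong₂ _∸_ (trans (↦-other (reg σ) x (suc-tmp d)) p)
      (trans (↦-same (reg σ) (tmpR (suc d)) x) (cong₂ _∸_ p (pars-sim S 0))))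
  where
  x : ℕ
  x = reg σ (tmpR d) ∸ reg σ (parR 0)
  σ₁ : Store
  σ₁ = σ [ tmpR (suc d) ⇐ x ]

load-computes : ∀ {a} d σ → mem σ (reg σ (tmpR d)) ≡ a → Computes (tmpR d ≔mem[ tmpR d ]) 1 d a σ
load-computes d σ p = write-computes d σ (mem σ (reg σ (tmpR d))) (load-runs (tmpR d) (tmpR d) σ) frame-refl p

tmp≢var : ∀ d x → tmpR d ≢ varR x
tmp≢var d x = quad≢1 d x

compileE-correct : ∀ {ρ h} e d σ → Sim ρ h σ → Computes (compileE e d) (costE e) d (eval ρ h e) σ
compileE-correct (lit a) d σ S = write-computes d σ a (const-runs (tmpR d) a σ) frame-refl refl
compileE-correct (var x) d σ S = move-computes (varR x) d σ (λ eq → quad≢1 d x (sym eq)) (vars-sim S x)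
compileE-correct (par y) d σ S = move-computes (parR y) d σ (λ eq → quad≢2 d y (sym eq)) (pars-sim S y)
compileE-correct (k ⟨ e ⟩) d σ S =
  andthen d (compileE-correct e d σ S) λ σ₁ p₁ F₁ →
  andthen d (address-computes k d _ σ₁ (sim-frame S F₁) p₁) λ σ₂ p₂ F₂ →
  load-computes d σ₂ (trans (cong (mem σ₂) p₂) (arrs-sim (sim-frame (sim-frame S F₁) F₂) k _))
compileE-correct {ρ} {h} (inp e) d σ S =
  andthen d (compileE-correct e d σ S) λ σ₁ p₁ F₁ →
  andthen d (cut-computes d _ σ₁ (sim-frame S F₁) p₁) λ σ₂ p₂ F₂ →
  load-computes d σ₂ (trans (cong (mem σ₂) p₂)
    (cells-sim (sim-frame (sim-frame S F₁) F₂) _ (clamp≤ ρ (eval ρ h e))))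
compileE-correct (a ⊞ b) d σ S =
  andthen d (compileE-correct a d σ S) λ σ₁ p₁ F₁ →
  let σ₂ , r₂ , p₂ , F₂ = compileE-correct b (suc d) σ₁ (sim-frame S F₁) in
  write-computes d σ₂ (reg σ₂ (tmpR d) + reg σ₂ (tmpR (suc d)))
    (r₂ then add-runs (tmpR d) (tmpR d) (tmpR (suc d)) σ₂) (frame-weaken (ℕ.n≤1+n d) F₂)
    (cong₂ _+_ (trans (tmp-kept d F₂ ℕ.≤-refl) p₁) p₂)
compileE-correct (a ⊟ b) d σ S =
  andthen d (compileE-correct a d σ S) λ σ₁ p₁ F₁ →
  let σ₂ , r₂ , p₂ , F₂ = compileE-correct b (suc d) σ₁ (sim-frame S F₁) in
  write-computes d σ₂ (reg σ₂ (tmpR d) ∸ reg σ₂ (tmpR (suc d)))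
    (r₂ then sub-runs (tmpR d) (tmpR d) (tmpR (suc d)) σ₂) (frame-weaken (ℕ.n≤1+n d) F₂)
    (cong₂ _∸_ (trans (tmp-kept d F₂ ℕ.≤-refl) p₁) p₂)
compileE-correct {ρ} {h} (c ¿ a ∶ b) d σ S =
  andthen d (compileE-correct c d σ S) λ σ₁ p₁ F₁ →
  let σ₂ , r₂ , p₂ , F₂ = compileE-correct a (suc d) σ₁ (sim-frame S F₁)
      σ₃ , r₃ , p₃ , F₃ = compileE-correct b (suc (suc d)) σ₂ (sim-frame (sim-frame S F₁) F₂)
      σ₄ , r₄ , p₄ , F₄ = branch (eval ρ h c) σ₃
        (trans (tmp-kept d F₃ (ℕ.m<n⇒m<1+n ℕ.≤-refl)) (trans (tmp-kept d F₂ ℕ.≤-refl) p₁))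
        (trans (tmp-kept (suc d) F₃ ℕ.≤-refl) p₂) p₃
  in σ₄ , r₂ then (r₃ then r₄) , p₄ ,
     frame-trans ℕ.≤-refl (frame-weaken (ℕ.n≤1+n d) F₂)
       (frame-trans ℕ.≤-refl (frame-weaken (ℕ.m≤n+m d 2) F₃) F₄)
  where
  branch : ∀ x {y z} σ → reg σ (tmpR d) ≡ x → reg σ (tmpR (suc d)) ≡ y → reg σ (tmpR (suc (suc d))) ≡ z →
           Computes (ifPos tmpR d then move (tmpR d) (tmpR (suc d)) else move (tmpR d) (tmpR (suc (suc d))))
             4 d (choose x y z) σ
  branch zero    σ p q r =
    let σ′ , s , v , F = move-computes (tmpR (suc (suc d))) d σ
          (λ eq → ℕ.m≢1+n+m d (sym (quad-injective (suc (suc d)) d eq))) r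
    in σ′ , (λ { (b ∷ ω) K → trans (cong (run ω) (if-zero {tmpR d} {σ} b p)) (s ω K) }) , v , F
  branch (suc _) σ p q r =
    let σ′ , s , v , F = move-computes (tmpR (suc d)) d σ (λ eq → suc-tmp d (sym eq)) q
    in σ′ , (λ { (b ∷ ω) K → trans (cong (run ω) (if-suc {tmpR d} {σ} b p)) (s ω K) }) , v , F

sim-setVar : ∀ {ρ h σ} x a → Sim ρ h σ → Sim ρ (setVar x a h) (σ [ varR x ⇐ a ])
sim-setVar {h = h} {σ} x a S = sim at-var
  (λ y → trans (↦-other (reg σ) {varR x} {parR y} a (λ eq → quad≢1 x y (sym (cong (_∸ 1) eq)))) (pars-sim S y))
  (cells-sim S) (arrs-sim S)
  where
  at-var : ∀ y → (reg σ [ varR x ↦ a ]) (varR y) ≡ vars (setVar x a h) y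
  at-var y with y ≟ x
  ... | yes refl = trans (↦-same (reg σ) (varR x) a) (sym (↦-same (vars h) x a))
  ... | no  y≢x  = trans (↦-other (reg σ) {varR x} {varR y} a (λ eq → y≢x (quad-injective y x (cong (_∸ 1) eq))))
                   (trans (vars-sim S y) (sym (↦-other (vars h) a y≢x)))

sim-setArr : ∀ {ρ h σ} k x a → Sim ρ h σ →
             Sim ρ (setArr k x a h) (store (reg σ) (mem σ [ location ρ k x ↦ a ]))
sim-setArr {ρ} {h} {σ} k x a S = sim (vars-sim S) (pars-sim S)
  (λ y p → trans (↦-other (mem σ) a (ℕ.<⇒≢ (ℕ.≤-<-trans p (location-> ρ k x)))) (cells-sim S y p))
  at-arr
  where
  at-arr : ∀ j y → (mem σ [ location ρ k x ↦ a ]) (location ρ j y) ≡ arrs (setArr k x a h) j y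
  at-arr j y with j Fin.≟ k
  ... | no j≢k = trans (↦-other (mem σ) a (λ eq → j≢k (proj₁ (location-injective ρ j y k x eq))))
                       (arrs-sim S j y)
  ... | yes refl with y ≟ x
  ...   | yes refl = trans (↦-same (mem σ) (location ρ k x) a) (sym (↦-same (arrs h k) x a))
  ...   | no y≢x   = trans (↦-other (mem σ) a (λ eq → y≢x (proj₂ (location-injective ρ k y k x eq))))
                     (trans (arrs-sim S k y) (sym (↦-other (arrs h k) a y≢x)))

sim-setCell : ∀ {ρ h σ} x a → x ≤ ρ 0 → Sim ρ h σ →
              Sim ρ (setCell x a h) (store (reg σ) (mem σ [ x ↦ a ]))
sim-setCell {ρ} {h} {σ} x a x≤l S = sim (vars-sim S) (pars-sim S) at-cell
  (λ k y → trans (↦-other (mem σ) a (λ eq → ℕ.<⇒≢ (ℕ.≤-<-trans x≤l (location-> ρ k y)) (sym eq)))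
                 (arrs-sim S k y))
  where
  at-cell : ∀ y → y ≤ ρ 0 → (mem σ [ x ↦ a ]) y ≡ cells (setCell x a h) y
  at-cell y p with y ≟ x
  ... | yes refl = trans (↦-same (mem σ) x a) (sym (↦-same (cells h) x a))
  ... | no y≢x   = trans (↦-other (mem σ) a y≢x) (trans (cells-sim S y p) (sym (↦-other (cells h) a y≢x)))

sim-coins : ∀ {ρ h σ} cs → Sim ρ h σ → Sim ρ (record h { coins = cs }) σ
sim-coins cs S = sim (vars-sim S) (pars-sim S) (cells-sim S) (arrs-sim S)

sim-counter : ∀ {ρ h σ} i a → Sim ρ h σ → Sim ρ h (σ [ cntR i ⇐ a ])
sim-counter {σ = σ} i a S = sim
  (λ x → trans (↦-other (reg σ) {cntR i} {varR x} a (λ eq → quad≢2 x i (cong (_∸ 1) eq))) (vars-sim S x))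
  (λ y → trans (↦-other (reg σ) {cntR i} {parR y} a (λ eq → quad≢1 y i (cong (_∸ 2) eq))) (pars-sim S y))
  (cells-sim S) (arrs-sim S)

counter-var : ∀ σ x j a → reg (σ [ varR x ⇐ a ]) (cntR j) ≡ reg σ (cntR j)
counter-var σ x j a = ↦-other (reg σ) {varR x} {cntR j} a (λ eq → quad≢2 x j (sym (cong (_∸ 1) eq)))

counter-other : ∀ σ {i j} a → j < i → reg (σ [ cntR i ⇐ a ]) (cntR j) ≡ reg σ (cntR j)
counter-other σ {i} {j} a j<i =
  ↦-other (reg σ) {cntR i} {cntR j} a (λ eq → ℕ.<-irrefl (quad-injective j i (cong (_∸ 3) eq)) j<i)

-- Counters below i belong to enclosing loops, and `Sim` says nothing about counters; hence the last
-- clause.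
Reaches : Params → State → ℕ → Program → ∀ {c} → Vec Bool c → Store → Set
Reaches ρ h′ i A ω σ = ∃[ σ′ ] (∀ K → run ω (A ∷ K , σ) ≡ (K , σ′)) × Sim ρ h′ σ′ ×
  (∀ j → j < i → reg σ′ (cntR j) ≡ reg σ (cntR j))

-- The coin list of the abstract state is a prophecy: it has to begin with the coins that the
-- machine will meet at the masked steps, and what remains is handed to the rest of the program.
compile-correct : ∀ A i {ρ h σ} → Sim ρ h σ → (ω : Vec Bool (cost A ρ)) (rest : List Bool) →
  coins h ≡ extract (mask A ρ) ω List.++ rest →
  Reaches ρ (exec ρ A h) i (compile A i) ω σ × coins (exec ρ A h) ≡ rest
compile-correct noop i {σ = σ} S (_ ∷ []) rest p = (σ , (λ _ → refl) , S , λ _ _ → refl) , p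
compile-correct (x ↤ e) i {ρ} {h} {σ} S ω rest p =
  let σ₁ , r₁ , p₁ , F₁ = compileE-correct e 0 σ S
      S₁ = sim-frame S F₁
      k = λ j → trans (counter-var (σ₁ [ varR x ⇐ 0 ]) x j (reg σ₁ (tmpR 0)))
            (trans (counter-var σ₁ x j 0) (cnt-kept j F₁))
  in (_ , (λ K → (r₁ then move-runs (varR x) (tmpR 0) σ₁ (tmp≢var 0 x)) ω K) ,
      assigned (reg σ₁ (tmpR 0)) p₁ σ₁ S₁ , λ j _ → k j) ,
     trans p (cong (List._++ rest) (extract-quiet ω))
  where
  assigned : ∀ a {b} → a ≡ b → ∀ σ₁ → Sim ρ h σ₁ →
             Sim ρ (setVar x b h) (σ₁ [ varR x ⇐ 0 ] [ varR x ⇐ a ])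
  assigned a refl σ₁ S₁ = sim at-var
    (pars-sim (sim-setVar x a (sim-setVar x 0 S₁))) (cells-sim S₁) (arrs-sim S₁)
    where
    at-var : ∀ y → ((reg σ₁ [ varR x ↦ 0 ]) [ varR x ↦ a ]) (varR y) ≡ (vars h [ x ↦ a ]) y
    at-var y with y ≟ x
    ... | yes refl = trans (↦-same (reg σ₁ [ varR x ↦ 0 ]) (varR x) a) (sym (↦-same (vars h) x a))
    ... | no  y≢x  = trans (vars-sim (sim-setVar x a (sim-setVar x 0 S₁)) y)
                     (trans (↦-other (vars h [ x ↦ 0 ]) a y≢x)
                     (trans (↦-other (vars h) 0 y≢x) (sym (↦-other (vars h) a y≢x))))
compile-correct (k ⟨ a ⟩↤ e) i {ρ} {h} {σ} S ω rest p =
  let σ₁ , r₁ , p₁ , F₁ = compileE-correct a 0 σ S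
      S₁ = sim-frame S F₁
      σ₂ , r₂ , p₂ , F₂ = address-computes k 0 _ σ₁ S₁ p₁
      S₂ = sim-frame S₁ F₂
      σ₃ , r₃ , p₃ , F₃ = compileE-correct e 1 σ₂ S₂
      S₃ = sim-frame S₂ F₃
      q = trans (tmp-kept 0 F₃ (s≤s z≤n)) p₂
  in (_ , (λ K → (r₁ then (r₂ then (r₃ then save-runs (tmpR 0) (tmpR 1) σ₃))) ω K) ,
      subst₂ (λ l b → Sim ρ (exec ρ (k ⟨ a ⟩↤ e) h) (store (reg σ₃) (mem σ₃ [ l ↦ b ])))
        (sym q) (sym p₃) (sim-setArr k (eval ρ h a) (eval ρ h e) S₃) ,
      λ j _ → trans (cnt-kept j F₃) (trans (cnt-kept j F₂) (cnt-kept j F₁))) ,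
     trans p (cong (List._++ rest) (extract-quiet ω))
compile-correct (inp⟨ a ⟩↤ e) i {ρ} {h} {σ} S ω rest p =
  let σ₁ , r₁ , p₁ , F₁ = compileE-correct a 0 σ S
      S₁ = sim-frame S F₁
      σ₂ , r₂ , p₂ , F₂ = cut-computes 0 _ σ₁ S₁ p₁
      S₂ = sim-frame S₁ F₂
      σ₃ , r₃ , p₃ , F₃ = compileE-correct e 1 σ₂ S₂
      S₃ = sim-frame S₂ F₃
      q = trans (tmp-kept 0 F₃ (s≤s z≤n)) p₂
  in (_ , (λ K → (r₁ then (r₂ then (r₃ then save-runs (tmpR 0) (tmpR 1) σ₃))) ω K) ,
      subst₂ (λ l b → Sim ρ (exec ρ (inp⟨ a ⟩↤ e) h) (store (reg σ₃) (mem σ₃ [ l ↦ b ])))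
        (sym q) (sym p₃) (sim-setCell _ (eval ρ h e) (clamp≤ ρ (eval ρ h a)) S₃) ,
      λ j _ → trans (cnt-kept j F₃) (trans (cnt-kept j F₂) (cnt-kept j F₁))) ,
     trans p (cong (List._++ rest) (extract-quiet ω))
compile-correct (toss x) i {ρ} {h} {σ} S (b ∷ []) rest p =
  (_ , (λ K → refl) ,
   subst (λ cs → Sim ρ (record (setVar x (bit (firstCoin cs)) h) { coins = List.drop 1 cs }) (σ [ varR x ⇐ bit b ]))
     (sym p) (sim-coins rest (sim-setVar x (bit b) S)) ,
   λ j _ → counter-var σ x j (bit b)) , cong (List.drop 1) p
compile-correct (A ︔ B) i {ρ} {h} {σ} S (b ∷ ω) rest p with Vec.splitAt (cost A ρ) ω
... | ω₁ , ω₂ , refl =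
  let (σ₁ , r₁ , S₁ , k₁) , c₁ = compile-correct A i S ω₁ (extract (mask B ρ) ω₂ List.++ rest)
        (trans p (trans (cong (List._++ rest) (extract-++ (mask A ρ) (mask B ρ) ω₁ ω₂))
                        (List.++-assoc (extract (mask A ρ) ω₁) _ rest)))
      (σ₂ , r₂ , S₂ , k₂) , c₂ = compile-correct B i S₁ ω₂ rest c₁
  in (σ₂ , (λ K → trans (run-++ ω₁ ω₂ _) (trans (cong (run ω₂) (r₁ _)) (r₂ K))) , S₂ ,
      λ j j<i → trans (k₂ j j<i) (k₁ j j<i)) , c₂
compile-correct (for x < y repeat A) i {ρ} {h} {σ} S (b ∷ ω) rest p with Vec.splitAt 3 ω
... | ω₁ , ω₂ , refl =
  let σ₁ = σ [ cntR i ⇐ 0 ] [ cntR i ⇐ reg σ (parR y) ]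
      r₁ = move-runs (cntR i) (parR y) σ (λ eq → quad≢1 y i (cong (_∸ 2) eq))
      (σ₂ , r₂ , S₂ , k₂) , c₂ = go (ρ y) 0 σ₁ (sim-counter i _ (sim-counter i 0 S)) refl
        (trans (↦-same (reg σ [ cntR i ↦ 0 ]) (cntR i) (reg σ (parR y))) (pars-sim S y)) ω₂
        (trans p (cong (List._++ rest) (trans (extract-++ (quiet {3}) (loopMask (mask A ρ) (ρ y)) ω₁ ω₂)
          (cong (List._++ extract (loopMask (mask A ρ) (ρ y)) ω₂) (extract-quiet ω₁)))))
  in (σ₂ , (λ K → trans (run-++ ω₁ ω₂ _) (trans (cong (run ω₂) (r₁ ω₁ _)) (r₂ K))) , S₂ ,
      λ j j<i → trans (k₂ j j<i) (trans (counter-other (σ [ cntR i ⇐ 0 ]) (reg σ (parR y)) j<i)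
        (counter-other σ 0 j<i))) , c₂
  where
  body : Program
  body = varR x ≔ parR y ⊖ cntR i ⨾ compile A (suc i) ⨾ tmpR 0 ≔const 1 ⨾ cntR i ≔ cntR i ⊖ tmpR 0
  -- N rounds are done and the counter holds the c that remain; recursion is on c, as in `loopCost`
  -- and `loopMask`.
  go : ∀ c N σ → Sim ρ (iterate ρ x A N h) σ → N + c ≡ ρ y → reg σ (cntR i) ≡ c →
       (ω : Vec Bool (loopCost (cost A ρ) c)) →
       coins (iterate ρ x A N h) ≡ extract (loopMask (mask A ρ) c) ω List.++ rest →
       Reaches ρ (iterate ρ x A (ρ y) h) i (whilePos cntR i loop body) ω σ ×
       coins (iterate ρ x A (ρ y) h) ≡ rest
  go zero N σ S N≡ q (b ∷ []) p rewrite trans (sym (ℕ.+-identityʳ N)) N≡ =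
    (σ , (λ K → while-zero {cntR i} {σ} {K} b {body} q) , S , λ _ _ → refl) , p
  go (suc c) N σ S N≡ q (b ∷ ω) p with Vec.splitAt (suc (1 + suc (cost A ρ + 3))) ω
  ... | b₁ ∷ b₂ ∷ b₃ ∷ ω₁ , ω₂ , refl with Vec.splitAt (cost A ρ) ω₁
  ...   | ω₃ , ω₄ , refl =
    let σ₁ = σ [ varR x ⇐ reg σ (parR y) ∸ reg σ (cntR i) ]
        S₁ = subst (λ a → Sim ρ (setVar x a (iterate ρ x A N h)) σ₁)
               (trans (cong₂ _∸_ (pars-sim S y) q) (trans (cong (_∸ suc c) (sym N≡)) (ℕ.m+n∸n≡m N (suc c))))
               (sim-setVar x _ S)
        (σ₂ , r₂ , S₂ , k₂) , c₂ = compile-correct A (suc i) S₁ ω₃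
          (extract (loopMask (mask A ρ) c) ω₂ List.++ rest)
          (trans p (trans (cong (List._++ rest) (trans
              (extract-++ (mask A ρ ++ quiet {3}) (loopMask (mask A ρ) c) (ω₃ ++ ω₄) ω₂)
              (cong (List._++ extract (loopMask (mask A ρ) c) ω₂)
                (trans (extract-++ (mask A ρ) (quiet {3}) ω₃ ω₄)
                (trans (cong (extract (mask A ρ) ω₃ List.++_) (extract-quiet ω₄)) (List.++-identityʳ _))))))
            (List.++-assoc (extract (mask A ρ) ω₃) _ rest)))
        a₃ = reg (σ₂ [ tmpR 0 ⇐ 1 ]) (cntR i) ∸ 1
        σ₃ = σ₂ [ tmpR 0 ⇐ 1 ] [ cntR i ⇐ a₃ ]
        r₃ = _then_ {a = 1} {b = 1} (const-runs (tmpR 0) 1 σ₂)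
               (sub-runs (cntR i) (cntR i) (tmpR 0) (σ₂ [ tmpR 0 ⇐ 1 ]))
        at-x = λ j → counter-var σ x j (reg σ (parR y) ∸ reg σ (cntR i))
        (σ₄ , r₄ , S₄ , k₄) , c₄ = go c (suc N) σ₃
          (sim-counter i a₃ (sim-frame S₂ (frame-write {0} 0 1 z≤n)))
          (trans (sym (ℕ.+-suc N c)) N≡)
          (trans (↦-same (reg (σ₂ [ tmpR 0 ⇐ 1 ])) (cntR i) a₃)
            (cong (_∸ 1) (trans (cnt-kept i (frame-write {0} {σ₂} 0 1 z≤n)) (trans (k₂ i ℕ.≤-refl) (trans (at-x i) q))))) ω₂ c₂
    in (σ₄ , (λ K → begin
          run ((b₁ ∷ b₂ ∷ b₃ ∷ (ω₃ ++ ω₄)) ++ ω₂) (step b ((whilePos cntR i loop body) ∷ K , σ))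
            ≡⟨ cong (run ((b₁ ∷ b₂ ∷ b₃ ∷ (ω₃ ++ ω₄)) ++ ω₂)) (while-suc {cntR i} {σ} {K} b {body} q) ⟩
          run ((ω₃ ++ ω₄) ++ ω₂) (compile A (suc i) ∷ _ ∷ (whilePos cntR i loop body) ∷ K , σ₁)
            ≡⟨ run-++ (ω₃ ++ ω₄) ω₂ _ ⟩
          run ω₂ (run (ω₃ ++ ω₄) (compile A (suc i) ∷ _ ∷ (whilePos cntR i loop body) ∷ K , σ₁))
            ≡⟨ cong (run ω₂) (trans (run-++ ω₃ ω₄ _) (trans (cong (run ω₄) (r₂ _)) (r₃ ω₄ _))) ⟩
          run ω₂ ((whilePos cntR i loop body) ∷ K , σ₃)
            ≡⟨ r₄ K ⟩
          (K , σ₄) ∎) , S₄ ,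
        λ j j<i → trans (k₄ j j<i)
          (trans (counter-other (σ₂ [ tmpR 0 ⇐ 1 ]) a₃ j<i)
          (trans (cnt-kept j (frame-write {0} {σ₂} 0 1 z≤n))
          (trans (k₂ j (ℕ.m<n⇒m<1+n j<i)) (at-x j))))) , c₄
    where open ≡-Reasoning

-- Frames and costs of commands

∨-false : ∀ a {b} → (a ∨ b) ≡ false → a ≡ false × b ≡ false
∨-false false p = refl , p

-- A syntactic footprint with Boolean values: for a concrete command the side condition of a frame
-- lemma evaluates, and `refl` proves it.
setsVar : ℕ → Cmd → Bool
setsVar x noop               = false
setsVar x (y ↤ e)            = x ≡ᵇ y
setsVar x (k ⟨ a ⟩↤ e)       = false
setsVar x (inp⟨ a ⟩↤ e)      = false
setsVar x (toss y)           = x ≡ᵇ y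
setsVar x (A ︔ B)            = setsVar x A ∨ setsVar x B
setsVar x (for y < z repeat A) = (x ≡ᵇ y) ∨ setsVar x A

setsArr : Arr → Cmd → Bool
setsArr j noop               = false
setsArr j (y ↤ e)            = false
setsArr j (k ⟨ a ⟩↤ e)       = does (j Fin.≟ k)
setsArr j (inp⟨ a ⟩↤ e)      = false
setsArr j (toss y)           = false
setsArr j (A ︔ B)            = setsArr j A ∨ setsArr j B
setsArr j (for y < z repeat A) = setsArr j A

setsCell : Cmd → Bool
setsCell noop               = false
setsCell (y ↤ e)            = false
setsCell (k ⟨ a ⟩↤ e)       = false
setsCell (inp⟨ a ⟩↤ e)      = true
setsCell (toss y)           = false
setsCell (A ︔ B)            = setsCell A ∨ setsCell B
setsCell (for y < z repeat A) = setsCell A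

tosses : Cmd → Bool
tosses noop               = false
tosses (y ↤ e)            = false
tosses (k ⟨ a ⟩↤ e)       = false
tosses (inp⟨ a ⟩↤ e)      = false
tosses (toss y)           = true
tosses (A ︔ B)            = tosses A ∨ tosses B
tosses (for y < z repeat A) = tosses A

var-frame : ∀ x A ρ h → setsVar x A ≡ false → vars (exec ρ A h) x ≡ vars h x
var-frame-iterate : ∀ x y z A ρ N h → setsVar x (for y < z repeat A) ≡ false →
                    vars (iterate ρ y A N h) x ≡ vars h x

var-frame x noop          ρ h p = refl
var-frame x (y ↤ e)       ρ h p rewrite p = refl
var-frame x (k ⟨ a ⟩↤ e)  ρ h p = refl
var-frame x (inp⟨ a ⟩↤ e) ρ h p = refl
var-frame x (toss y)      ρ h p rewrite p = refl
var-frame x (A ︔ B)       ρ h p =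
  trans (var-frame x B ρ (exec ρ A h) (proj₂ (∨-false (setsVar x A) p)))
        (var-frame x A ρ h (proj₁ (∨-false (setsVar x A) p)))
var-frame x (for y < z repeat A) ρ h p = var-frame-iterate x y z A ρ (ρ z) h p

var-frame-iterate x y z A ρ zero    h p = refl
var-frame-iterate x y z A ρ (suc N) h p = trans (var-frame x A ρ _ (proj₂ (∨-false (x ≡ᵇ y) p)))
  (trans (cong (λ b → if b then N else vars (iterate ρ y A N h) x) (proj₁ (∨-false (x ≡ᵇ y) p)))
         (var-frame-iterate x y z A ρ N h p))

arr-frame : ∀ j A ρ h → setsArr j A ≡ false → arrs (exec ρ A h) j ≡ arrs h j
arr-frame-iterate : ∀ j y A ρ N h → setsArr j A ≡ false → arrs (iterate ρ y A N h) j ≡ arrs h j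

arr-frame j noop          ρ h p = refl
arr-frame j (y ↤ e)       ρ h p = refl
arr-frame j (k ⟨ a ⟩↤ e)  ρ h p rewrite p = refl
arr-frame j (inp⟨ a ⟩↤ e) ρ h p = refl
arr-frame j (toss y)      ρ h p = refl
arr-frame j (A ︔ B)       ρ h p =
  trans (arr-frame j B ρ (exec ρ A h) (proj₂ (∨-false (setsArr j A) p)))
        (arr-frame j A ρ h (proj₁ (∨-false (setsArr j A) p)))
arr-frame j (for y < z repeat A) ρ h p = arr-frame-iterate j y A ρ (ρ z) h p

arr-frame-iterate j y A ρ zero    h p = refl
arr-frame-iterate j y A ρ (suc N) h p = trans (arr-frame j A ρ _ p) (arr-frame-iterate j y A ρ N h p)

cell-frame : ∀ A ρ h → setsCell A ≡ false → cells (exec ρ A h) ≡ cells h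
cell-frame-iterate : ∀ y A ρ N h → setsCell A ≡ false → cells (iterate ρ y A N h) ≡ cells h

cell-frame noop          ρ h p = refl
cell-frame (y ↤ e)       ρ h p = refl
cell-frame (k ⟨ a ⟩↤ e)  ρ h p = refl
cell-frame (toss y)      ρ h p = refl
cell-frame (A ︔ B)       ρ h p =
  trans (cell-frame B ρ (exec ρ A h) (proj₂ (∨-false (setsCell A) p)))
        (cell-frame A ρ h (proj₁ (∨-false (setsCell A) p)))
cell-frame (for y < z repeat A) ρ h p = cell-frame-iterate y A ρ (ρ z) h p

cell-frame-iterate y A ρ zero    h p = refl
cell-frame-iterate y A ρ (suc N) h p = trans (cell-frame A ρ _ p) (cell-frame-iterate y A ρ N h p)

coin-frame : ∀ A ρ h → tosses A ≡ false → coins (exec ρ A h) ≡ coins h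
coin-frame-iterate : ∀ y A ρ N h → tosses A ≡ false → coins (iterate ρ y A N h) ≡ coins h

coin-frame noop          ρ h p = refl
coin-frame (y ↤ e)       ρ h p = refl
coin-frame (k ⟨ a ⟩↤ e)  ρ h p = refl
coin-frame (inp⟨ a ⟩↤ e) ρ h p = refl
coin-frame (A ︔ B)       ρ h p =
  trans (coin-frame B ρ (exec ρ A h) (proj₂ (∨-false (tosses A) p)))
        (coin-frame A ρ h (proj₁ (∨-false (tosses A) p)))
coin-frame (for y < z repeat A) ρ h p = coin-frame-iterate y A ρ (ρ z) h p

coin-frame-iterate y A ρ zero    h p = refl
coin-frame-iterate y A ρ (suc N) h p = trans (coin-frame A ρ _ p) (coin-frame-iterate y A ρ N h p)

-- The 12 charged to a loop consists of 5 steps around it and 7 steps of overhead per round.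
size : Cmd → ℕ
size noop               = 1
size (x ↤ e)            = suc (costE e + 3)
size (k ⟨ a ⟩↤ e)       = suc (costE a + suc (13 + suc (costE e + 1)))
size (inp⟨ a ⟩↤ e)      = suc (costE a + suc (3 + suc (costE e + 1)))
size (toss x)           = 1
size (A ︔ B)            = suc (size A + size B)
size (for x < y repeat A) = 12 + size A

depth : Cmd → ℕ
depth noop               = 0
depth (x ↤ e)            = 0
depth (k ⟨ a ⟩↤ e)       = 0
depth (inp⟨ a ⟩↤ e)      = 0
depth (toss x)           = 0
depth (A ︔ B)            = depth A ⊔ depth B
depth (for x < y repeat A) = suc (depth A)

loopCost-≡ : ∀ a c → loopCost a c ≡ c * (a + 7) + 1
loopCost-≡ a zero    = refl
loopCost-≡ a (suc c) = trans (cong (suc (suc (1 + suc (a + 3))) +_) (loopCost-≡ a c))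
  (solve 2 (λ a x → (con 4 :+ (a :+ con 3)) :+ (x :+ con 1) := (a :+ con 7) :+ x :+ con 1) refl a (c * (a + 7)))
  where open +-*-Solver

module _ (ρ : Params) (Q : ℕ) (1≤Q : 1 ≤ Q) (ρ≤Q : ∀ y → ρ y ≤ Q) where

  1≤Q^ : ∀ d → 1 ≤ Q ^ d
  1≤Q^ zero    = ℕ.≤-refl
  1≤Q^ (suc d) = ℕ.*-mono-≤ 1≤Q (1≤Q^ d)

  Q^-mono : ∀ {d e} → d ≤ e → Q ^ d ≤ Q ^ e
  Q^-mono = ℕ.^-monoʳ-≤ Q {{>-nonZero 1≤Q}}

  -- Each loop multiplies the cost by at most Q, which makes the nesting depth the exponent and the
  -- program text the coefficient. Terms of lower degree are absorbed because Q is at least 1.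
  cost-bound : ∀ A → cost A ρ ≤ size A * Q ^ depth A
  cost-bound noop          = s≤s z≤n
  cost-bound (x ↤ e)       = ℕ.≤-reflexive (sym (ℕ.*-identityʳ _))
  cost-bound (k ⟨ a ⟩↤ e)  = ℕ.≤-reflexive (sym (ℕ.*-identityʳ _))
  cost-bound (inp⟨ a ⟩↤ e) = ℕ.≤-reflexive (sym (ℕ.*-identityʳ _))
  cost-bound (toss x)      = s≤s z≤n
  cost-bound (A ︔ B) = begin
    1 + (cost A ρ + cost B ρ)
      ≤⟨ ℕ.+-mono-≤ (1≤Q^ D) (ℕ.+-mono-≤
           (ℕ.≤-trans (cost-bound A) (ℕ.*-monoʳ-≤ (size A) (Q^-mono (ℕ.m≤m⊔n (depth A) (depth B)))))
           (ℕ.≤-trans (cost-bound B) (ℕ.*-monoʳ-≤ (size B) (Q^-mono (ℕ.m≤n⊔m (depth A) (depth B)))))) ⟩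
    Q ^ D + (size A * Q ^ D + size B * Q ^ D)
      ≡⟨ cong (Q ^ D +_) (sym (ℕ.*-distribʳ-+ (Q ^ D) (size A) (size B))) ⟩
    suc (size A + size B) * Q ^ D ∎
    where
    open ℕ.≤-Reasoning
    D : ℕ
    D = depth A ⊔ depth B
  cost-bound (for x < y repeat A) = begin
    4 + loopCost (cost A ρ) (ρ y)
      ≡⟨ cong (4 +_) (loopCost-≡ (cost A ρ) (ρ y)) ⟩
    4 + (ρ y * (cost A ρ + 7) + 1)
      ≤⟨ ℕ.+-monoʳ-≤ 4 (ℕ.+-monoˡ-≤ 1 (ℕ.*-mono-≤ (ρ≤Q y)
           (ℕ.+-mono-≤ (cost-bound A) (ℕ.*-monoʳ-≤ 7 (1≤Q^ (depth A)))))) ⟩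
    4 + (Q * (size A * Q ^ depth A + 7 * Q ^ depth A) + 1)
      ≡⟨ solve 3 (λ q s d → con 4 :+ (q :* (s :* d :+ con 7 :* d) :+ con 1) :=
           con 5 :+ (con 7 :+ s) :* (q :* d)) refl Q (size A) (Q ^ depth A) ⟩
    5 + (7 + size A) * Q ^ suc (depth A)
      ≤⟨ ℕ.+-monoˡ-≤ ((7 + size A) * Q ^ suc (depth A)) (ℕ.*-monoʳ-≤ 5 (1≤Q^ (suc (depth A)))) ⟩
    5 * Q ^ suc (depth A) + (7 + size A) * Q ^ suc (depth A)
      ≡⟨ sym (ℕ.*-distribʳ-+ (Q ^ suc (depth A)) 5 (7 + size A)) ⟩
    (12 + size A) * Q ^ suc (depth A) ∎
    where
    open ℕ.≤-Reasoning
    open +-*-Solver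

trues falses : ∀ {n} → Vec Bool n → ℕ
trues []          = 0
trues (true  ∷ m) = suc (trues m)
trues (false ∷ m) = trues m
falses []          = 0
falses (true  ∷ m) = falses m
falses (false ∷ m) = suc (falses m)

trues+falses : ∀ {n} (m : Vec Bool n) → trues m + falses m ≡ n
trues+falses []          = refl
trues+falses (true  ∷ m) = cong suc (trues+falses m)
trues+falses (false ∷ m) = trans (ℕ.+-suc (trues m) _) (cong suc (trues+falses m))

trues-++ : ∀ {a b} (m : Vec Bool a) (m′ : Vec Bool b) → trues (m ++ m′) ≡ trues m + trues m′
trues-++ []          m′ = refl
trues-++ (true  ∷ m) m′ = cong suc (trues-++ m m′)
trues-++ (false ∷ m) m′ = trues-++ m m′

trues-quiet : ∀ n → trues (quiet {n}) ≡ 0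
trues-quiet zero    = refl
trues-quiet (suc n) = trues-quiet n

uses : Cmd → Params → ℕ
uses noop          ρ = 0
uses (x ↤ e)       ρ = 0
uses (k ⟨ a ⟩↤ e)  ρ = 0
uses (inp⟨ a ⟩↤ e) ρ = 0
uses (toss x)      ρ = 1
uses (A ︔ B)       ρ = uses A ρ + uses B ρ
uses (for x < y repeat A) ρ = ρ y * uses A ρ

trues-mask : ∀ A ρ → trues (mask A ρ) ≡ uses A ρ
trues-mask noop          ρ = refl
trues-mask (x ↤ e)       ρ = trues-quiet (suc (costE e + 3))
trues-mask (k ⟨ a ⟩↤ e)  ρ = trues-quiet (suc (costE a + suc (13 + suc (costE e + 1))))
trues-mask (inp⟨ a ⟩↤ e) ρ = trues-quiet (suc (costE a + suc (3 + suc (costE e + 1))))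
trues-mask (toss x)      ρ = refl
trues-mask (A ︔ B)       ρ = trans (trues-++ (mask A ρ) (mask B ρ)) (cong₂ _+_ (trues-mask A ρ) (trues-mask B ρ))
trues-mask (for x < y repeat A) ρ = go (ρ y)
  where
  go : ∀ c → trues (loopMask (mask A ρ) c) ≡ c * uses A ρ
  go zero    = refl
  go (suc c) = trans (trues-++ (mask A ρ ++ quiet {3}) (loopMask (mask A ρ) c))
    (cong₂ _+_ (trans (trues-++ (mask A ρ) (quiet {3})) (trans (ℕ.+-identityʳ _) (trues-mask A ρ))) (go c))

uses-none : ∀ A ρ → tosses A ≡ false → uses A ρ ≡ 0
uses-none noop          ρ p = refl
uses-none (x ↤ e)       ρ p = refl
uses-none (k ⟨ a ⟩↤ e)  ρ p = refl
uses-none (inp⟨ a ⟩↤ e) ρ p = refl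
uses-none (A ︔ B)       ρ p = cong₂ _+_ (uses-none A ρ (proj₁ (∨-false (tosses A) p)))
                                      (uses-none B ρ (proj₂ (∨-false (tosses A) p)))
uses-none (for x < y repeat A) ρ p = trans (cong (ρ y *_) (uses-none A ρ p)) (ℕ.*-zeroʳ (ρ y))

-- Counting and the isolation lemma

private variable
  A B : Set

total : List A → (A → ℕ) → ℕ
total []       f = 0
total (x ∷ xs) f = f x + total xs f

total-cong : ∀ (xs : List A) {f g} → (∀ x → f x ≡ g x) → total xs f ≡ total xs g
total-cong []       p = refl
total-cong (x ∷ xs) p = cong₂ _+_ (p x) (total-cong xs p)

total-mono : ∀ (xs : List A) {f g} → (∀ x → f x ≤ g x) → total xs f ≤ total xs g
total-mono []       p = z≤n
total-mono (x ∷ xs) p = ℕ.+-mono-≤ (p x) (total-mono xs p)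

total-++ : ∀ (xs ys : List A) f → total (xs List.++ ys) f ≡ total xs f + total ys f
total-++ []       ys f = refl
total-++ (x ∷ xs) ys f = trans (cong (f x +_) (total-++ xs ys f)) (sym (ℕ.+-assoc (f x) _ _))

total-map : ∀ (h : A → B) xs f → total (List.map h xs) f ≡ total xs (f ∘ h)
total-map h []       f = refl
total-map h (x ∷ xs) f = cong (f (h x) +_) (total-map h xs f)

total-const : ∀ (xs : List A) c → total xs (λ _ → c) ≡ length xs * c
total-const []       c = refl
total-const (x ∷ xs) c = cong (c +_) (total-const xs c)

total-+ : ∀ (xs : List A) f g → total xs (λ x → f x + g x) ≡ total xs f + total xs g
total-+ []       f g = refl
total-+ (x ∷ xs) f g = trans (cong (f x + g x +_) (total-+ xs f g)) (+-interchange (f x) (g x) _ _)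

total-* : ∀ (xs : List A) c f → total xs (λ x → c * f x) ≡ c * total xs f
total-* []       c f = sym (ℕ.*-zeroʳ c)
total-* (x ∷ xs) c f = trans (cong (c * f x +_) (total-* xs c f)) (sym (ℕ.*-distribˡ-+ c (f x) _))

total-swap : ∀ (xs : List A) (ys : List B) (f : A → B → ℕ) →
             total xs (λ x → total ys (f x)) ≡ total ys (λ y → total xs (λ x → f x y))
total-swap []       ys f = sym (trans (total-const ys 0) (ℕ.*-zeroʳ (length ys)))
total-swap (x ∷ xs) ys f = trans (cong (total ys (f x) +_) (total-swap xs ys f))
                                 (sym (total-+ ys (f x) (λ y → total xs (λ x → f x y))))

total-∈ : ∀ {xs : List A} f {x} → x ∈ xs → f x ≤ total xs f
total-∈ f (here refl) = ℕ.m≤m+n _ _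
total-∈ {xs = y ∷ xs} f (there p) = ℕ.≤-trans (total-∈ f p) (ℕ.m≤n+m _ (f y))

total-pos : ∀ (xs : List A) f → 1 ≤ total xs f → ∃[ x ] 1 ≤ f x
total-pos (x ∷ xs) f p with f x in eq
... | zero  = total-pos xs f p
... | suc a = x , subst (1 ≤_) (sym eq) (s≤s z≤n)

total-zero : ∀ (xs : List A) f → (∀ x → f x ≡ 0) → total xs f ≡ 0
total-zero xs f p = trans (total-cong xs p) (trans (total-const xs 0) (ℕ.*-zeroʳ (length xs)))

vectors : List A → ∀ m → List (Vec A m)
vectors xs zero    = [] ∷ []
vectors xs (suc m) = List.concatMap (λ x → List.map (x ∷_) (vectors xs m)) xs

total-concatMap : ∀ (h : A → List B) xs f → total (List.concatMap h xs) f ≡ total xs (λ x → total (h x) f)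
total-concatMap h []       f = refl
total-concatMap h (x ∷ xs) f = trans (total-++ (h x) (List.concatMap h xs) f)
                                     (cong (total (h x) f +_) (total-concatMap h xs f))

total-vectors : ∀ (xs : List A) m f →
  total (vectors xs (suc m)) f ≡ total xs (λ x → total (vectors xs m) (λ v → f (x ∷ v)))
total-vectors xs m f = trans (total-concatMap (λ x → List.map (x ∷_) (vectors xs m)) xs f)
  (total-cong xs (λ x → total-map (x ∷_) (vectors xs m) f))

total-vectors-1 : ∀ (xs : List A) m → total (vectors xs m) (λ _ → 1) ≡ length xs ^ m
total-vectors-1 xs zero    = refl
total-vectors-1 xs (suc m) = trans (total-vectors xs m (λ _ → 1))
  (trans (total-cong xs (λ _ → total-vectors-1 xs m)) (total-const xs (length xs ^ m)))

-- Fix all coordinates but e: at most one value at e is counted, so f counts at most a fraction 1 /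
-- `length xs` of all vectors.
coordinate : ∀ (xs : List A) (default : A) m (e : Fin m) f →
  (∀ v → total xs (λ x → f (v Vec.[ e ]≔ x)) ≤ 1) →
  length xs * total (vectors xs m) f ≤ length xs ^ m
coordinate xs default (suc m) Fin.zero f p = ℕ.*-monoʳ-≤ (length xs) (begin
  total (vectors xs (suc m)) f
    ≡⟨ total-vectors xs m f ⟩
  total xs (λ x → total (vectors xs m) (λ v → f (x ∷ v)))
    ≡⟨ total-swap xs (vectors xs m) (λ x v → f (x ∷ v)) ⟩
  total (vectors xs m) (λ v → total xs (λ x → f (x ∷ v)))
    -- The hypothesis overwrites the first coordinate, so any element can stand there.
    ≤⟨ total-mono (vectors xs m) (λ v → p (default ∷ v)) ⟩
  total (vectors xs m) (λ _ → 1)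
    ≡⟨ total-vectors-1 xs m ⟩
  length xs ^ m ∎)
  where open ℕ.≤-Reasoning
coordinate xs default (suc m) (Fin.suc e) f p = begin
  length xs * total (vectors xs (suc m)) f
    ≡⟨ cong (length xs *_) (total-vectors xs m f) ⟩
  length xs * total xs (λ x → total (vectors xs m) (λ v → f (x ∷ v)))
    ≡⟨ sym (total-* xs (length xs) _) ⟩
  total xs (λ x → length xs * total (vectors xs m) (λ v → f (x ∷ v)))
    ≤⟨ total-mono xs (λ x → coordinate xs default m e (λ v → f (x ∷ v)) (λ v → p (x ∷ v))) ⟩
  total xs (λ _ → length xs ^ m)
    ≡⟨ total-const xs (length xs ^ m) ⟩
  length xs * length xs ^ m ∎
  where open ℕ.≤-Reasoning

total-coinStrings : ∀ n f → total (coinStrings (suc n)) f ≡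
  total (coinStrings n) (f ∘ (false ∷_)) + total (coinStrings n) (f ∘ (true ∷_))
total-coinStrings n f = trans (total-++ (List.map (false ∷_) (coinStrings n)) _ f)
  (cong₂ _+_ (total-map (false ∷_) (coinStrings n) f) (total-map (true ∷_) (coinStrings n) f))

length-coinStrings : ∀ n → length (coinStrings n) ≡ 2 ^ n
length-coinStrings zero    = refl
length-coinStrings (suc n) = trans (List.length-++ (List.map (false ∷_) (coinStrings n)))
  (cong₂ _+_ (trans (List.length-map (false ∷_) (coinStrings n)) (length-coinStrings n))
    (trans (trans (List.length-map (true ∷_) (coinStrings n)) (length-coinStrings n)) (sym (ℕ.+-identityʳ _))))

at-most-one : ∀ n (f : Vec Bool n → ℕ) → (∀ x → f x ≤ 1) →
              (∀ x y → 1 ≤ f x → 1 ≤ f y → x ≡ y) → total (coinStrings n) f ≤ 1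
at-most-one zero    f f≤1 unique = subst (_≤ 1) (sym (ℕ.+-identityʳ (f []))) (f≤1 [])
at-most-one (suc n) f f≤1 unique rewrite total-coinStrings n f
  with total (coinStrings n) (f ∘ (false ∷_)) in eq
... | zero  = at-most-one n (f ∘ (true ∷_)) (f≤1 ∘ (true ∷_))
                (λ x y p q → Vec.∷-injectiveʳ (unique (true ∷ x) (true ∷ y) p q))
... | suc a = subst (λ z → suc a + z ≤ 1) (sym (total-zero (coinStrings n) (f ∘ (true ∷_)) none))
                (subst (_≤ 1) (trans eq (sym (ℕ.+-identityʳ (suc a))))
                  (at-most-one n (f ∘ (false ∷_)) (f≤1 ∘ (false ∷_))
                    (λ x y p q → Vec.∷-injectiveʳ (unique (false ∷ x) (false ∷ y) p q))))
  where
  none : ∀ y → f (true ∷ y) ≡ 0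
  none y with f (true ∷ y) in eq′ | total-pos (coinStrings n) (f ∘ (false ∷_)) (subst (1 ≤_) (sym eq) (s≤s z≤n))
  ... | zero  | _      = refl
  ... | suc _ | x , p = contradiction (unique (false ∷ x) (true ∷ y) p (subst (1 ≤_) (sym eq′) (s≤s z≤n))) λ ()

-- Horner's scheme with an accumulator, leading bit first, because this is the order in which the
-- sampling loop consumes its coins.
valueFrom : ∀ {n} → ℕ → Vec Bool n → ℕ
valueFrom w []      = w
valueFrom w (c ∷ v) = valueFrom (w + w + bit c) v

value : ∀ {n} → Vec Bool n → ℕ
value = valueFrom 0

double-injective : ∀ a b c d → a + a + bit c ≡ b + b + bit d → a ≡ b × c ≡ d
double-injective zero    zero    false false p = refl , refl
double-injective zero    zero    true  true  p = refl , refl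
double-injective zero    (suc b) false d p = contradiction p λ ()
double-injective zero    (suc b) true  d p rewrite ℕ.+-suc b b = contradiction p λ ()
double-injective (suc a) zero    c false p = contradiction p λ ()
double-injective (suc a) zero    c true  p rewrite ℕ.+-suc a a = contradiction p λ ()
double-injective (suc a) (suc b) c d p rewrite ℕ.+-suc a a | ℕ.+-suc b b =
  let q , r = double-injective a b c d (ℕ.suc-injective (ℕ.suc-injective p)) in cong suc q , r

valueFrom-injective : ∀ {n} w w′ (u v : Vec Bool n) → valueFrom w u ≡ valueFrom w′ v → w ≡ w′ × u ≡ v
valueFrom-injective w w′ []      []      p = p , refl
valueFrom-injective w w′ (c ∷ u) (d ∷ v) p =
  let q , r = valueFrom-injective (w + w + bit c) (w′ + w′ + bit d) u v p
      s , t = double-injective w w′ c d q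
  in s , cong₂ _∷_ t r

value-injective : ∀ {n} (u v : Vec Bool n) → value u ≡ value v → u ≡ v
value-injective u v p = proj₂ (valueFrom-injective 0 0 u v p)

value-< : ∀ {n} w (v : Vec Bool n) → valueFrom w v < suc w * 2 ^ n
value-< w []      = ℕ.≤-reflexive (sym (ℕ.*-identityʳ (suc w)))
value-< {suc n} w (c ∷ v) = ℕ.≤-trans (value-< (w + w + bit c) v) (begin
  suc (w + w + bit c) * 2 ^ n
    ≤⟨ ℕ.*-monoˡ-≤ (2 ^ n) (s≤s (ℕ.+-monoʳ-≤ (w + w) (bit≤1 c))) ⟩
  suc (w + w + 1) * 2 ^ n
    ≡⟨ solve 2 (λ w x → (con 1 :+ (w :+ w :+ con 1)) :* x := (con 1 :+ w) :* (con 2 :* x)) refl w (2 ^ n) ⟩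
  suc w * 2 ^ suc n ∎)
  where
  open ℕ.≤-Reasoning
  open +-*-Solver

weigh : ∀ {m} → (A → ℕ) → Vec A m → Subset m → ℕ
weigh val []      []      = 0
weigh val (x ∷ c) (b ∷ M) = bit b * val x + weigh val c M

weighRest : ∀ {m} → (A → ℕ) → Vec A m → Subset m → Fin m → ℕ
weighRest val (x ∷ c) (b ∷ M) Fin.zero    = weigh val c M
weighRest val (x ∷ c) (b ∷ M) (Fin.suc e) = bit b * val x + weighRest val c M e

weigh-update : ∀ {m} (val : A → ℕ) (c : Vec A m) M e x →
  weigh val (c Vec.[ e ]≔ x) M ≡ bit (Vec.lookup M e) * val x + weighRest val c M e
weigh-update val (y ∷ c) (b ∷ M) Fin.zero    x = refl
weigh-update val (y ∷ c) (b ∷ M) (Fin.suc e) x =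
  trans (cong (bit b * val y +_) (weigh-update val c M e x))
        (swap (bit b * val y) (bit (Vec.lookup M e) * val x) (weighRest val c M e))
  where
  swap : ∀ p q r → p + (q + r) ≡ q + (p + r)
  swap = solve 3 (λ p q r → p :+ (q :+ r) := q :+ (p :+ r)) refl
    where open +-*-Solver

differ : ∀ {m} (M N : Subset m) → M ≢ N → ∃[ e ] Vec.lookup M e ≢ Vec.lookup N e
differ []      []      ne = contradiction refl ne
differ (b ∷ M) (c ∷ N) ne with b Bool.≟ c
... | no  b≢c  = Fin.zero , b≢c
... | yes refl = let e , p = differ M N (λ q → ne (cong (b ∷_) q)) in Fin.suc e , p

module Isolation {A : Set} (val : A → ℕ) (val-injective : ∀ x y → val x ≡ val y → x ≡ y)
                 {m : ℕ} {F : Subset m → Set} (F? : ∀ M → Dec (F M)) where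

  Isolated : Vec A m → Set
  Isolated c = ∃[ M ] F M × (∀ N → F N → weigh val c N ≡ weigh val c M → N ≡ M)

  Minimal : Vec A m → Subset m → Set
  Minimal c M = F M × ¬ (∃[ N ] F N × weigh val c N < weigh val c M)

  minimal-≤ : ∀ c M → Minimal c M → ∀ {N} → F N → weigh val c M ≤ weigh val c N
  minimal-≤ c M (_ , least) FN = ℕ.≮⇒≥ (λ lt → least (_ , FN , lt))

  -- The bad event in the argument of Mulmuley, Vazirani and Vazirani: one set of least weight
  -- contains e and another one avoids it.
  Ambiguous : Fin m → Vec A m → Set
  Ambiguous e c = ∃[ M ] Minimal c M × Vec.lookup M e ≡ true ×
    ∃[ N ] F N × Vec.lookup N e ≡ false × weigh val c N ≡ weigh val c M

  ambiguous? : ∀ e c → Dec (Ambiguous e c)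
  ambiguous? e c = anySubset? λ M →
    (F? M ×-dec ¬? (anySubset? λ N → F? N ×-dec (weigh val c N <? weigh val c M))) ×-dec
    (Vec.lookup M e Bool.≟ true) ×-dec
    anySubset? λ N → F? N ×-dec (Vec.lookup N e Bool.≟ false) ×-dec (weigh val c N ≟ weigh val c M)

  minimum : ∀ c k M → F M → weigh val c M ≤ k → ∃[ N ] Minimal c N
  minimum c k M FM M≤k with anySubset? (λ N → F? N ×-dec (weigh val c N <? weigh val c M))
  ... | no  none = M , FM , none
  minimum c zero    M FM M≤k | yes (N , FN , lt) = contradiction (ℕ.<-≤-trans lt M≤k) λ ()
  minimum c (suc k) M FM M≤k | yes (N , FN , lt) = minimum c k N FN (ℕ.≤-pred (ℕ.<-≤-trans lt M≤k))

  -- If the set of least weight is not alone in its class, two sets of least weight differ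
  -- somewhere, and any coordinate where they differ is ambiguous.
  dichotomy : ∃ F → ∀ c → Isolated c ⊎ ∃[ e ] Ambiguous e c
  dichotomy (M₀ , FM₀) c with minimum c (weigh val c M₀) M₀ FM₀ ℕ.≤-refl
  ... | M , min@(FM , least) with anySubset? (λ N →
          F? N ×-dec (weigh val c N ≟ weigh val c M) ×-dec ¬? (Vec.≡-dec Bool._≟_ N M))
  ...   | no none = inj₁ (M , FM , λ N FN eq → decide N FN eq (Vec.≡-dec Bool._≟_ N M))
    where
    decide : ∀ N → F N → weigh val c N ≡ weigh val c M → Dec (N ≡ M) → N ≡ M
    decide N FN eq (yes p) = p
    decide N FN eq (no ¬p) = contradiction (N , FN , eq , ¬p) none
  ...   | yes (N , FN , eq , N≢M) with differ N M N≢M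
  ...     | e , ne with Vec.lookup N e in Ne | Vec.lookup M e in Me
  ...       | true  | true  = contradiction refl ne
  ...       | false | false = contradiction refl ne
  ...       | false | true  = inj₂ (e , M , min , Me , N , FN , Ne , eq)
  ...       | true  | false = inj₂ (e , N ,
    (FN , λ { (P , FP , lt) → least (P , FP , subst (weigh val c P <_) eq lt) }) , Ne , M , FM , Me , sym eq)

  -- The value of the coordinate e at which e is ambiguous is the difference of
  -- the least weights outside e of the sets avoiding and containing e.
  ambiguous-unique : ∀ e c x y → Ambiguous e (c Vec.[ e ]≔ x) → Ambiguous e (c Vec.[ e ]≔ y) → x ≡ y
  ambiguous-unique e c x y (M , minM , M∋e , N , FN , N∌e , eqN) (P , minP , P∋e , Q , FQ , Q∌e , eqQ) =
    val-injective x y (ℕ.+-cancelʳ-≡ (r M) _ _ (begin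
      val x + r M    ≡⟨ sym (with-e x M M∋e) ⟩
      w x M          ≡⟨ sym eqN ⟩
      w x N          ≡⟨ without-e x N N∌e ⟩
      r N            ≡⟨ ℕ.≤-antisym rN≤rQ rQ≤rN ⟩
      r Q            ≡⟨ sym (without-e y Q Q∌e) ⟩
      w y Q          ≡⟨ eqQ ⟩
      w y P          ≡⟨ with-e y P P∋e ⟩
      val y + r P    ≡⟨ cong (val y +_) (ℕ.≤-antisym rP≤rM rM≤rP) ⟩
      val y + r M    ∎))
    where
    open ≡-Reasoning
    w : A → Subset m → ℕ
    w x M = weigh val (c Vec.[ e ]≔ x) M
    cx cy : Vec A m
    cx = c Vec.[ e ]≔ x
    cy = c Vec.[ e ]≔ y
    r : Subset m → ℕ
    r M = weighRest val c M e
    with-e : ∀ x M → Vec.lookup M e ≡ true → w x M ≡ val x + r M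
    with-e x M p = trans (weigh-update val c M e x)
      (cong (_+ r M) (trans (cong (λ b → bit b * val x) p) (ℕ.*-identityˡ (val x))))
    without-e : ∀ x M → Vec.lookup M e ≡ false → w x M ≡ r M
    without-e x M p = trans (weigh-update val c M e x) (cong (λ b → bit b * val x + r M) p)
    rM≤rP : r M ≤ r P
    rM≤rP = ℕ.+-cancelˡ-≤ (val x) _ _ (subst₂ _≤_ (with-e x M M∋e) (with-e x P P∋e) (minimal-≤ cx M minM (proj₁ minP)))
    rP≤rM : r P ≤ r M
    rP≤rM = ℕ.+-cancelˡ-≤ (val y) _ _ (subst₂ _≤_ (with-e y P P∋e) (with-e y M M∋e) (minimal-≤ cy P minP (proj₁ minM)))
    rN≤rQ : r N ≤ r Q
    rN≤rQ = subst₂ _≤_ (trans (sym eqN) (without-e x N N∌e)) (without-e x Q Q∌e) (minimal-≤ cx M minM FQ)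
    rQ≤rN : r Q ≤ r N
    rQ≤rN = subst₂ _≤_ (trans (sym eqQ) (without-e y Q Q∌e)) (without-e y N N∌e) (minimal-≤ cy P minP FN)

  module _ (nonempty : ∃ F) where

    fails : Vec A m → ℕ
    fails c = [ (λ _ → 0) , (λ _ → 1) ]′ (dichotomy nonempty c)

    -- The union bound: a failure is charged to an ambiguous coordinate.
    fails-≤ : ∀ c → fails c ≤ total (List.allFin m) (λ e → bit (does (ambiguous? e c)))
    fails-≤ c with dichotomy nonempty c
    ... | inj₁ _         = z≤n
    ... | inj₂ (e , amb) = ℕ.≤-trans
      (ℕ.≤-reflexive (sym (cong bit (dec-true (ambiguous? e c) amb))))
      (total-∈ (λ e → bit (does (ambiguous? e c))) (∈-allFin e))

    fails-or-isolated : ∀ c → Isolated c ⊎ fails c ≡ 1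
    fails-or-isolated c with dichotomy nonempty c
    ... | inj₁ iso = inj₁ iso
    ... | inj₂ _   = inj₂ refl

    -- The failure probability is at most m / `length xs`, written without division. The hypothesis
    -- on xs is a summation form of having no repeated entries; it makes each coordinate ambiguous
    -- for at most one of its values.
    isolation : ∀ (xs : List A) (default : A) →
      (∀ f → (∀ x → f x ≤ 1) → (∀ x y → 1 ≤ f x → 1 ≤ f y → x ≡ y) → total xs f ≤ 1) →
      length xs * total (vectors xs m) fails ≤ m * length xs ^ m
    isolation xs default unique = begin
      L * total (vectors xs m) fails
        ≤⟨ ℕ.*-monoʳ-≤ L (total-mono (vectors xs m) fails-≤) ⟩
      L * total (vectors xs m) (λ c → total (List.allFin m) (λ e → amb e c))
        ≡⟨ cong (L *_) (total-swap (vectors xs m) (List.allFin m) (λ c e → amb e c)) ⟩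
      L * total (List.allFin m) (λ e → total (vectors xs m) (amb e))
        ≡⟨ sym (total-* (List.allFin m) L _) ⟩
      total (List.allFin m) (λ e → L * total (vectors xs m) (amb e))
        ≤⟨ total-mono (List.allFin m) (λ e → coordinate xs default m e (amb e) (λ c →
             unique (λ x → amb e (c Vec.[ e ]≔ x)) (λ x → bit≤1 (does (ambiguous? e (c Vec.[ e ]≔ x)))) (λ x y p q →
               ambiguous-unique e c x y (holds e (c Vec.[ e ]≔ x) p) (holds e (c Vec.[ e ]≔ y) q)))) ⟩
      total (List.allFin m) (λ _ → L ^ m)
        ≡⟨ total-const (List.allFin m) (L ^ m) ⟩
      length (List.allFin m) * L ^ m
        ≡⟨ cong (_* L ^ m) (List.length-tabulate {n = m} id) ⟩
      m * L ^ m ∎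
      where
      open ℕ.≤-Reasoning
      L : ℕ
      L = length xs
      amb : Fin m → Vec A m → ℕ
      amb e c = bit (does (ambiguous? e c))
      holds : ∀ e c → 1 ≤ amb e c → Ambiguous e c
      holds e c p with ambiguous? e c
      ... | yes q = q

-- Independent repetitions and blocks of coins

allOf : (A → ℕ) → ∀ {t} → Vec A t → ℕ
allOf f []      = 1
allOf f (x ∷ v) = f x * allOf f v

-- Independence of the trials: summing a product over all vectors factorises.
total-allOf : ∀ (xs : List A) f t → total (vectors xs t) (allOf f) ≡ total xs f ^ t
total-allOf xs f zero    = refl
total-allOf xs f (suc t) = begin
  total (vectors xs (suc t)) (allOf f)
    ≡⟨ total-vectors xs t (allOf f) ⟩
  total xs (λ x → total (vectors xs t) (λ v → f x * allOf f v))
    ≡⟨ total-cong xs (λ x → trans (total-* (vectors xs t) (f x) (allOf f))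
         (trans (cong (f x *_) (total-allOf xs f t)) (ℕ.*-comm (f x) _))) ⟩
  total xs (λ x → total xs f ^ t * f x)
    ≡⟨ total-* xs (total xs f ^ t) f ⟩
  total xs f ^ t * total xs f
    ≡⟨ ℕ.*-comm (total xs f ^ t) _ ⟩
  total xs f ^ suc t ∎
  where open ≡-Reasoning

-- Every string of read coins extends to exactly 2 ^ `falses m` full coin strings, as the unread
-- positions are free. This is where the constancy of the mask is used.
total-extract : ∀ {T} (m : Vec Bool T) (f : List Bool → ℕ) →
  total (coinStrings T) (f ∘ extract m) ≡ 2 ^ falses m * total (coinStrings (trues m)) (f ∘ Vec.toList)
total-extract [] f = sym (ℕ.*-identityˡ _)
total-extract {suc T} (true ∷ m) f = trans (total-coinStrings T (f ∘ extract (true ∷ m)))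
  (trans (cong₂ _+_ (total-extract m (f ∘ (false ∷_))) (total-extract m (f ∘ (true ∷_))))
  (trans (sym (ℕ.*-distribˡ-+ (2 ^ falses m) _ _))
    (cong (2 ^ falses m *_) (sym (total-coinStrings (trues m) (f ∘ Vec.toList))))))
total-extract {suc T} (false ∷ m) f = trans (total-coinStrings T (f ∘ extract (false ∷ m)))
  (trans (cong (λ x → x + x) (total-extract m f))
    (solve 2 (λ p x → p :* x :+ p :* x := (con 2 :* p) :* x) refl (2 ^ falses m) _))
  where open +-*-Solver

total-split : ∀ a b (f : List Bool → ℕ) → total (coinStrings (a + b)) (f ∘ Vec.toList) ≡
  total (coinStrings a) (λ x → total (coinStrings b) (λ y → f (Vec.toList x List.++ Vec.toList y)))
total-split zero    b f = sym (ℕ.+-identityʳ _)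
total-split (suc a) b f = trans (total-coinStrings (a + b) (f ∘ Vec.toList))
  (trans (cong₂ _+_ (total-split a b (f ∘ (false ∷_))) (total-split a b (f ∘ (true ∷_))))
    (sym (total-coinStrings a _)))

flatten : (A → List Bool) → ∀ {m} → Vec A m → List Bool
flatten h []      = []
flatten h (x ∷ v) = h x List.++ flatten h v

-- xs enumerates the blocks of n coins, read through h.
Blocks : ℕ → List A → (A → List Bool) → Set
Blocks n xs h = ∀ (f : List Bool → ℕ) → total (coinStrings n) (f ∘ Vec.toList) ≡ total xs (f ∘ h)

blocks-vectors : ∀ {n} (xs : List A) h → Blocks n xs h → ∀ m → Blocks (m * n) (vectors xs m) (flatten h)
blocks-vectors xs h blocks zero    f = refl
blocks-vectors {n = n} xs h blocks (suc m) f = begin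
  total (coinStrings (n + m * n)) (f ∘ Vec.toList)
    ≡⟨ total-split n (m * n) f ⟩
  total (coinStrings n) (λ x → total (coinStrings (m * n)) (λ y → f (Vec.toList x List.++ Vec.toList y)))
    ≡⟨ blocks (λ l → total (coinStrings (m * n)) (λ y → f (l List.++ Vec.toList y))) ⟩
  total xs (λ x → total (coinStrings (m * n)) (λ y → f (h x List.++ Vec.toList y)))
    ≡⟨ total-cong xs (λ x → blocks-vectors xs h blocks m (λ l → f (h x List.++ l))) ⟩
  total xs (λ x → total (vectors xs m) (λ v → f (h x List.++ flatten h v)))
    ≡⟨ sym (total-vectors xs m (f ∘ flatten h)) ⟩
  total (vectors xs (suc m)) (f ∘ flatten h) ∎
  where open ≡-Reasoning

-- The algorithm

SRC TGT COL NEED POW OFF WT SER EXT CAND DEG CNT : Arr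
SRC  = # 0
TGT  = # 1
COL  = # 2
NEED = # 3
POW  = # 4
OFF  = # 5
WT   = # 6
SER  = # 7
EXT  = # 8
CAND = # 9
DEG  = # 10
CNT  = # 11

vE vJ vW vH vV vD vT vI vw vc vBad vp vq vg vR vb vS : ℕ
vE   = 0
vJ   = 1
vW   = 2
vH   = 3
vV   = 4
vD   = 5
vT   = 6
vI   = 7
vw   = 8
vc   = 9
vBad = 10
vp   = 11
vq   = 12
vg   = 13
vR   = 14
vb   = 15
vS   = 16

-- The parameters are the last address l of the input, n, s, m, the number of
-- random bits per weight, and a bound for the weight of a solution.
pN pS pM pB pBound : ℕ
pN     = 1
pS     = 2
pM     = 3
pB     = 4
pBound = 5

infixl 9 _!_

_!_ : Arr → ℕ → Expr
k ! x = k ⟨ var x ⟩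

weighEdges : Cmd
weighEdges = for vE < pM repeat
  ( vw ↤ lit 0
  ︔ for vJ < pB repeat
      ( toss vc
      ︔ vw ↤ var vw ⊞ var vw ⊞ var vc )
  ︔ WT ⟨ var vE ⟩↤ var vw ⊞ POW ⟨ COL ! vE ⟩ )

extAt : Expr → Expr → Expr
extAt v W = EXT ⟨ OFF ⟨ v ⟩ ⊞ W ⟩

-- The nested tests ask that the edge is not the deleted edge `vD`, that its weight is at most `vW`,
-- and that its far end is among the first `vH` vertices. Each test is the positivity of a truncated
-- difference.
contribution : Arr → Expr
contribution k =
  (var vE ⊟ var vD ⊞ (var vD ⊟ var vE)) ¿
    (lit 1 ⊞ var vW ⊟ WT ! vE) ¿
      (var vH ⊟ k ! vE) ¿ extAt (k ! vE) (var vW ⊟ WT ! vE) ∶ lit 0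
    ∶ lit 0
  ∶ lit 0

-- Entries are 0 or 1, and the conditional in the second command is their addition modulo two.
addNeighbour : Arr → Arr → Cmd
addNeighbour k k′ =
    vg ↤ contribution k′
  ︔ EXT ⟨ OFF ⟨ k ! vE ⟩ ⊞ var vW ⟩↤ extAt (k ! vE) (var vW) ¿ lit 1 ⊟ var vg ∶ var vg

-- `SER` holds the series of the first `vH` vertices and `EXT` the table `dp`, in rows of length
-- `pBound`. Columns are filled by increasing weight. The old coefficient at `vW` only initialises
-- column `vW`, so `SER` can be overwritten in place.
startSeries startExt scanEdges nextWeight nextVertex count : Cmd
startSeries = for vW < pBound repeat (SER ⟨ var vW ⟩↤ lit 0)
startExt    = for vV < pN repeat (EXT ⟨ OFF ! vV ⊞ var vW ⟩↤ SER ! vW)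
scanEdges   = for vE < pM repeat (addNeighbour SRC TGT ︔ addNeighbour TGT SRC)
nextWeight  = startExt ︔ scanEdges ︔ SER ⟨ var vW ⟩↤ extAt (var vH) (var vW)
nextVertex  = for vW < pBound repeat nextWeight
count       = startSeries ︔ SER ⟨ lit 0 ⟩↤ lit 1 ︔ for vH < pN repeat nextVertex

candidate : Cmd
candidate = for vD < pM repeat (count ︔ CAND ⟨ var vD ⟩↤ lit 1 ⊟ SER ! vT)

distance : Expr → Expr → Expr
distance a b = a ⊟ b ⊞ (b ⊟ a)

tally inspect publish check : Cmd
tally =
    for vV < pN repeat (DEG ⟨ var vV ⟩↤ lit 0)
  ︔ for vI < pS repeat (CNT ⟨ var vI ⟩↤ lit 0)
  ︔ for vE < pM repeat
      ( DEG ⟨ SRC ! vE ⟩↤ DEG ⟨ SRC ! vE ⟩ ⊞ CAND ! vE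
      ︔ DEG ⟨ TGT ! vE ⟩↤ DEG ⟨ TGT ! vE ⟩ ⊞ CAND ! vE
      ︔ CNT ⟨ COL ! vE ⟩↤ CNT ⟨ COL ! vE ⟩ ⊞ CAND ! vE )
inspect =
    vBad ↤ lit 0
  ︔ for vV < pN repeat (vBad ↤ var vBad ⊞ distance (DEG ! vV) (lit 1))
  ︔ for vI < pS repeat (vBad ↤ var vBad ⊞ distance (CNT ! vI) (NEED ! vI))
publish =
    -- In the absence of conditional commands a rejected candidate is handled by writing the old
    -- contents back.
    for vE < pM repeat
      (inp⟨ lit 1 ⊞ var vE ⟩↤ var vBad ¿ inp (lit 1 ⊞ var vE) ∶ CAND ! vE)
  ︔ inp⟨ lit 0 ⟩↤ var vBad ¿ inp (lit 0) ∶ lit 1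
check = tally ︔ inspect ︔ publish

trial : Cmd
trial = weighEdges ︔ for vT < pBound repeat (candidate ︔ check)

-- The number of trials is determined by p and not by the input, so it can be unrolled into the
-- program text.
trials : ℕ → Cmd
trials zero    = noop
trials (suc t) = trial ︔ trials t

-- Correctness of the algorithm

record Kept (A : Cmd) (h h′ : State) : Set where
  constructor kept
  field
    var-unset : ∀ x → setsVar x A ≡ false → vars h′ x ≡ vars h x
    arr-kept  : ∀ k → setsArr k A ≡ false → arrs h′ k ≡ arrs h k
    cell-kept : setsCell A ≡ false → cells h′ ≡ cells h
    coin-kept : tosses A ≡ false → coins h′ ≡ coins h
open Kept

exec-kept : ∀ A ρ h → Kept A h (exec ρ A h)
exec-kept A ρ h = kept (λ x → var-frame x A ρ h) (λ k → arr-frame k A ρ h) (cell-frame A ρ h) (coin-frame A ρ h)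

iterate-kept : ∀ x y A ρ N h → Kept (for x < y repeat A) h (iterate ρ x A N h)
iterate-kept x y A ρ N h = kept (λ z → var-frame-iterate z x y A ρ N h) (λ k → arr-frame-iterate k x A ρ N h)
  (cell-frame-iterate x A ρ N h) (coin-frame-iterate x A ρ N h)

-- The step also receives a frame relative to the state before the loop, so an invariant need only
-- mention what the loop changes.
for-inv : ∀ ρ x y A h (P : ℕ → State → Set) → P 0 h →
  (∀ N h′ → N < ρ y → Kept (for x < y repeat A) h h′ → P N h′ → P (suc N) (exec ρ A (setVar x N h′))) →
  P (ρ y) (exec ρ (for x < y repeat A) h)
for-inv ρ x y A h P start next = go (ρ y) ℕ.≤-refl
  where
  go : ∀ N → N ≤ ρ y → P N (iterate ρ x A N h)
  go zero    _ = start
  go (suc N) p = next N _ p (iterate-kept x y A ρ N h) (go N (ℕ.<⇒≤ p))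

choose-< : ∀ x y a b → choose (y ∸ x) a b ≡ (if x <ᵇ y then a else b)
choose-< zero    zero    a b = refl
choose-< zero    (suc y) a b = refl
choose-< (suc x) zero    a b = refl
choose-< (suc x) (suc y) a b = choose-< x y a b

choose-≢ : ∀ x y a b → choose (x ∸ y + (y ∸ x)) a b ≡ (if not (x ≡ᵇ y) then a else b)
choose-≢ zero    zero    a b = refl
choose-≢ zero    (suc y) a b = refl
choose-≢ (suc x) zero    a b = refl
choose-≢ (suc x) (suc y) a b = choose-≢ x y a b

choose-xor : ∀ x y → choose (bit x) (1 ∸ bit y) (bit y) ≡ bit (x xor y)
choose-xor false false = refl
choose-xor false true  = refl
choose-xor true  false = refl
choose-xor true  true  = refl

1∸bit : ∀ b → 1 ∸ bit b ≡ bit (not b)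
1∸bit false = refl
1∸bit true  = refl

-- Uniqueness of quotient and remainder. It separates the entries of the table and later decodes
-- weights.
row-injective : ∀ S u v {x y} → x < S → y < S → u * S + x ≡ v * S + y → u ≡ v × x ≡ y
row-injective S zero    zero    _ _ p = refl , p
row-injective S zero    (suc v) {x} {y} x<S _ p = contradiction x<S (ℕ.≤⇒≯
  (subst (S ≤_) (sym p) (ℕ.≤-trans (ℕ.m≤m+n S (v * S)) (ℕ.m≤m+n _ y))))
row-injective S (suc u) zero    {x} {y} _ y<S p = contradiction y<S (ℕ.≤⇒≯
  (subst (S ≤_) p (ℕ.≤-trans (ℕ.m≤m+n S (u * S)) (ℕ.m≤m+n _ x))))
row-injective S (suc u) (suc v) {x} {y} x<S y<S p =
  let q , r = row-injective S u v x<S y<S (ℕ.+-cancelˡ-≡ S _ _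
        (trans (sym (ℕ.+-assoc S (u * S) x)) (trans p (ℕ.+-assoc S (v * S) y))))
  in cong suc q , r

module Search (ρ : Params) (src tgt col need pow : ℕ → ℕ)
  (src<n : ∀ e → e < ρ 3 → src e < ρ 1) (tgt<n : ∀ e → e < ρ 3 → tgt e < ρ 1)
  (col<s : ∀ e → e < ρ 3 → col e < ρ 2)
  (loopless : ∀ e → src e ≢ tgt e) (pow>0 : ∀ i → 0 < pow i) where

  n s m b S : ℕ
  n = ρ 1
  s = ρ 2
  m = ρ 3
  b = ρ 4
  S = ρ 5

  record Ready (h : State) : Set where
    constructor ready
    field
      src-ok  : ∀ e → e < m → arrs h SRC e ≡ src e
      tgt-ok  : ∀ e → e < m → arrs h TGT e ≡ tgt e
      col-ok  : ∀ e → e < m → arrs h COL e ≡ col e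
      need-ok : ∀ i → i < s → arrs h NEED i ≡ need i
      pow-ok  : ∀ i → i < s → arrs h POW i ≡ pow i
      off-ok  : ∀ v → v < n → arrs h OFF v ≡ v * S
  open Ready

  leaves-ready : Cmd → Bool
  leaves-ready A = not (setsArr SRC A) ∧ (not (setsArr TGT A) ∧ (not (setsArr COL A)
    ∧ (not (setsArr NEED A) ∧ (not (setsArr POW A) ∧ not (setsArr OFF A)))))

  ready-kept : ∀ {A h h′} → Kept A h h′ → leaves-ready A ≡ true → Ready h → Ready h′
  ready-kept {A} {h} {h′} K p R
    with setsArr SRC A in p₀ | setsArr TGT A in p₁ | setsArr COL A in p₂
       | setsArr NEED A in p₃ | setsArr POW A in p₄ | setsArr OFF A in p₅
  ... | false | false | false | false | false | false = ready
    (λ e q → trans (cong (λ f → f e) (arr-kept K SRC p₀)) (src-ok R e q))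
    (λ e q → trans (cong (λ f → f e) (arr-kept K TGT p₁)) (tgt-ok R e q))
    (λ e q → trans (cong (λ f → f e) (arr-kept K COL p₂)) (col-ok R e q))
    (λ e q → trans (cong (λ f → f e) (arr-kept K NEED p₃)) (need-ok R e q))
    (λ e q → trans (cong (λ f → f e) (arr-kept K POW p₄)) (pow-ok R e q))
    (λ e q → trans (cong (λ f → f e) (arr-kept K OFF p₅)) (off-ok R e q))

  ready-setVar : ∀ {h} x a → Ready h → Ready (setVar x a h)
  ready-setVar x a R = ready (src-ok R) (tgt-ok R) (col-ok R) (need-ok R) (pow-ok R) (off-ok R)

  Weights : (ℕ → ℕ) → State → Set
  Weights wt h = ∀ e → e < m → arrs h WT e ≡ wt e

  weights-kept : ∀ {A h h′ wt} → Kept A h h′ → setsArr WT A ≡ false → Weights wt h → Weights wt h′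
  weights-kept K p w e q = trans (cong (λ f → f e) (arr-kept K WT p)) (w e q)

  module Counting (wt : ℕ → ℕ) (wt>0 : ∀ e → 0 < wt e) (d : ℕ) where
    open Weighted src tgt wt using (others)
    open Matchings src tgt wt (others d)
    open Dynamic src tgt wt (others d) loopless m

    -- The first W columns of the table of extended series, and column W.
    record Table (h W : ℕ) (F : ℕ → Bool) (X : ℕ → ℕ) : Set where
      constructor table
      field
        columns : ∀ u W′ → u < n → W′ < W → X (u * S + W′) ≡ bit (dp h u W′)
        current : ∀ v → v < n → X (v * S + W) ≡ bit (F v)
    open Table

    addNeighbour-correct : ∀ k k′ h W N F σ → does (k Fin.≟ EXT) ≡ false →
      arrs σ k N < n → arrs σ k′ N < n →
      (∀ v → v < n → arrs σ OFF v ≡ v * S) → arrs σ WT N ≡ wt N → W < S →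
      vars σ vE ≡ N → vars σ vW ≡ W → vars σ vH ≡ h → vars σ vD ≡ d →
      Table h W F (arrs σ EXT) →
      Table h W (λ v → F v xor ((arrs σ k N ≡ᵇ v) ∧
          (others d N ∧ shift (wt N) (λ W → below h (arrs σ k′ N) ∧ dp h (arrs σ k′ N) W) W)))
        (arrs (exec ρ (addNeighbour k k′) σ) EXT)
    addNeighbour-correct k k′ h W N F σ k≢ a<n c<n off wtN W<S refl refl refl refl X = table columns′ current′
      where
      a c : ℕ
      a = arrs σ k N
      c = arrs σ k′ N
      t : Bool
      t = others d N ∧ shift (wt N) (λ W → below h c ∧ dp h c W) W
      inner : choose (suc W ∸ wt N) (choose (h ∸ c) (arrs σ EXT (arrs σ OFF c + (W ∸ wt N))) 0) 0
              ≡ bit (shift (wt N) (λ W → below h c ∧ dp h c W) W)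
      inner with wt N ≤? W
      ... | no wt≰W = trans (choose-< (wt N) (suc W) _ 0)
          (trans (cong (λ b → if b then choose (h ∸ c) (arrs σ EXT (arrs σ OFF c + (W ∸ wt N))) 0 else 0)
                   (≮⇒<ᵇ-false (λ q → wt≰W (ℕ.≤-pred q))))
                 (cong bit (sym (shift-> (wt N) (λ W → below h c ∧ dp h c W) W (ℕ.≰⇒> wt≰W)))))
      ... | yes wt≤W = trans (choose-< (wt N) (suc W) _ 0)
          (trans (cong (λ b → if b then choose (h ∸ c) (arrs σ EXT (arrs σ OFF c + (W ∸ wt N))) 0 else 0)
                   (<⇒<ᵇ-true (s≤s wt≤W)))
          (trans (choose-< c h _ 0)
          (trans (cases (below h c)) (cong bit (sym (shift-≤ (wt N) (λ W → below h c ∧ dp h c W) W wt≤W))))))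
        where
        cases : ∀ q → (if q then arrs σ EXT (arrs σ OFF c + (W ∸ wt N)) else 0) ≡ bit (q ∧ dp h c (W ∸ wt N))
        cases false = refl
        cases true  = trans (cong (λ z → arrs σ EXT (z + (W ∸ wt N))) (off c c<n))
                            -- Here positivity of the weights enters: column `W ∸ wt N` lies
                            -- strictly before W and is already complete.
                            (columns X c (W ∸ wt N) c<n (ℕ.∸-monoʳ-< (wt>0 N) wt≤W))
      g : ℕ
      g = eval ρ σ (contribution k′)
      g≡ : g ≡ bit t
      g≡ = trans (choose-≢ N d _ 0) (trans
        (cong (λ w → if others d N then choose (suc W ∸ w) (choose (h ∸ c) (arrs σ EXT (arrs σ OFF c + (W ∸ w))) 0) 0 else 0) wtN)
        (trans (cong (λ z → if others d N then z else 0) inner) (both (others d N) _)))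
        where
        both : ∀ p q → (if p then bit q else 0) ≡ bit (p ∧ q)
        both false q = refl
        both true  q = refl
      X′ : ℕ → ℕ
      X′ = arrs (exec ρ (addNeighbour k k′) σ) EXT
      address≡ : arrs σ OFF a + W ≡ a * S + W
      address≡ = cong (_+ W) (off a a<n)
      new : ℕ
      new = choose (arrs σ EXT (arrs σ OFF a + W)) (1 ∸ g) g
      at : ∀ i → X′ i ≡ (arrs σ EXT [ a * S + W ↦ new ]) i
      at i = cong (λ z → (arrs σ EXT [ z ↦ new ]) i) address≡
      new≡ : new ≡ bit (F a xor t)
      new≡ = trans (cong₂ (λ x y → choose x (1 ∸ y) y)
               (trans (cong (arrs σ EXT) address≡) (current X a a<n)) g≡) (choose-xor (F a) t)
      columns′ : ∀ u W′ → u < n → W′ < W → X′ (u * S + W′) ≡ bit (dp h u W′)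
      columns′ u W′ u<n W′<W = trans (at (u * S + W′)) (trans
        (↦-other (arrs σ EXT) new (λ eq → ℕ.<⇒≢ W′<W (proj₂ (row-injective S u a (ℕ.<-trans W′<W W<S) W<S eq))))
        (columns X u W′ u<n W′<W))
      current′ : ∀ v → v < n → X′ (v * S + W) ≡ bit (F v xor ((a ≡ᵇ v) ∧ t))
      current′ v v<n with a ≟ v
      ... | yes refl = trans (at (a * S + W)) (trans (↦-same (arrs σ EXT) (a * S + W) new)
            (trans new≡ (cong (λ z → bit (F a xor (z ∧ t))) (sym (≡ᵇ-refl a)))))
      ... | no  a≢v  = trans (at (v * S + W)) (trans
            (↦-other (arrs σ EXT) new (λ eq → a≢v (sym (proj₁ (row-injective S v a W<S W<S eq)))))
            (trans (current X v v<n) (cong bit (sym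
              (trans (cong (λ z → F v xor (z ∧ t)) (≢⇒≡ᵇ a≢v)) (Bool.xor-identityʳ (F v)))))))

    record Context (σ : State) : Set where
      constructor context
      field
        isReady   : Ready σ
        isWeights : Weights wt σ
        isD       : vars σ vD ≡ d
    open Context

    context-kept : ∀ {A σ σ′} → Kept A σ σ′ → leaves-ready A ≡ true → setsArr WT A ≡ false →
                   setsVar vD A ≡ false → Context σ → Context σ′
    context-kept K p q r C = context (ready-kept K p (isReady C)) (weights-kept K q (isWeights C))
      (trans (var-unset K vD r) (isD C))

    context-setVar : ∀ {σ} x a → (vD ≡ᵇ x) ≡ false → Context σ → Context (setVar x a σ)
    context-setVar {σ} x a p C = context (ready-setVar x a (isReady C)) (isWeights C)
      (trans (cong (λ b → if b then a else vars σ vD) p) (isD C))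

    startExt-correct : ∀ h W σ → Context σ → W < S → vars σ vW ≡ W → vars σ vH ≡ h →
      (∀ u W′ → u < n → W′ < W → arrs σ EXT (u * S + W′) ≡ bit (dp h u W′)) →
      ∀ c → arrs σ SER W ≡ bit c → Table h W (λ _ → c) (arrs (exec ρ startExt σ) EXT)
    startExt-correct h W σ C W<S Weq Heq old c serW =
      let f , g = for-inv ρ vV pN _ σ P (old , λ _ ()) next in table f g
      where
      P : ℕ → State → Set
      P N σ′ = (∀ u W′ → u < n → W′ < W → arrs σ′ EXT (u * S + W′) ≡ bit (dp h u W′)) ×
               (∀ v → v < N → arrs σ′ EXT (v * S + W) ≡ bit c)
      next : ∀ N σ′ → N < n → Kept startExt σ σ′ → P N σ′ →
             P (suc N) (exec ρ (EXT ⟨ OFF ! vV ⊞ var vW ⟩↤ SER ! vW) (setVar vV N σ′))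
      next N σ′ N<n K (old′ , now) = old″ , now′
        where
        W′≡ : vars σ′ vW ≡ W
        W′≡ = trans (var-unset K vW refl) Weq
        addr : arrs σ′ OFF N + vars σ′ vW ≡ N * S + W
        addr = cong₂ _+_ (trans (cong (λ f → f N) (arr-kept K OFF refl)) (off-ok (isReady C) N N<n)) W′≡
        val : arrs σ′ SER (vars σ′ vW) ≡ bit c
        val = trans (cong (arrs σ′ SER) W′≡) (trans (cong (λ f → f W) (arr-kept K SER refl)) serW)
        old″ : ∀ u W′ → u < n → W′ < W →
               (arrs σ′ EXT [ arrs σ′ OFF N + vars σ′ vW ↦ arrs σ′ SER (vars σ′ vW) ]) (u * S + W′) ≡ bit (dp h u W′)
        old″ u W′ u<n W′<W = trans
          (↦-other (arrs σ′ EXT) _ (λ eq → ℕ.<⇒≢ W′<W (proj₂ (row-injective S u N (ℕ.<-trans W′<W W<S) W<S (trans eq addr)))))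
          (old′ u W′ u<n W′<W)
        now′ : ∀ v → v < suc N →
               (arrs σ′ EXT [ arrs σ′ OFF N + vars σ′ vW ↦ arrs σ′ SER (vars σ′ vW) ]) (v * S + W) ≡ bit c
        now′ v v<1+N with v ≟ N
        ... | yes refl = trans (cong₂ (λ x y → (arrs σ′ EXT [ x ↦ y ]) (v * S + W)) addr val)
                               (↦-same (arrs σ′ EXT) (v * S + W) (bit c))
        ... | no  v≢N  = trans
          (↦-other (arrs σ′ EXT) _ (λ eq → v≢N (proj₁ (row-injective S v N W<S W<S (trans eq addr)))))
          (now v (ℕ.≤∧≢⇒< (ℕ.≤-pred v<1+N) v≢N))

    -- After N edges the current column contains the neighbour sum over these edges; after all of
    -- them it contains the right side of `dp-recurrence`.
    scanEdges-correct : ∀ h W σ → Context σ → W < S → vars σ vW ≡ W → vars σ vH ≡ h →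
      Table h W (λ _ → μ m (below h) W) (arrs σ EXT) →
      Table h W (λ v → dp h v W) (arrs (exec ρ scanEdges σ) EXT)
    scanEdges-correct h W σ C W<S Weq Heq X =
      let Y = for-inv ρ vE pM _ σ P X₀ next in
      table (columns Y) (λ v v<n → trans (current Y v v<n) (cong bit (sym (dp-recurrence h v W))))
      where
      f : ℕ → Series
      f u W = below h u ∧ dp h u W
      P : ℕ → State → Set
      P N σ′ = Table h W (λ v → μ m (below h) W xor nb N v f W) (arrs σ′ EXT)
      X₀ : P 0 σ
      X₀ = table (columns X) (λ v v<n → trans (current X v v<n) (cong bit (sym (Bool.xor-identityʳ _))))
      next : ∀ N σ′ → N < m → Kept scanEdges σ σ′ → P N σ′ →
             P (suc N) (exec ρ (addNeighbour SRC TGT ︔ addNeighbour TGT SRC) (setVar vE N σ′))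
      next N σ′ N<m K Y = table (columns Z) λ v v<n → trans (current Z v v<n) (cong bit (trans
          (cong₂ (λ a c → ((μ m (below h) W xor nb N v f W) xor ((a ≡ᵇ v) ∧ (others d N ∧ shift (wt N) (f c) W)))
              xor ((c ≡ᵇ v) ∧ (others d N ∧ shift (wt N) (f a) W))) src≡ tgt≡)
          (trans (cong (_xor ((tgt N ≡ᵇ v) ∧ (others d N ∧ shift (wt N) (f (src N)) W)))
                   (Bool.xor-assoc (μ m (below h) W) (nb N v f W) _))
                 (Bool.xor-assoc (μ m (below h) W) _ _))))
        where
        σ₀ σ₁ : State
        σ₀ = setVar vE N σ′
        σ₁ = exec ρ (addNeighbour SRC TGT) σ₀
        C′ : Context σ′
        C′ = context-kept K refl refl refl C
        src≡ : arrs σ₀ SRC N ≡ src N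
        src≡ = src-ok (isReady C′) N N<m
        tgt≡ : arrs σ₀ TGT N ≡ tgt N
        tgt≡ = tgt-ok (isReady C′) N N<m
        src< : arrs σ₀ SRC N < n
        src< = subst (_< n) (sym src≡) (src<n N N<m)
        tgt< : arrs σ₀ TGT N < n
        tgt< = subst (_< n) (sym tgt≡) (tgt<n N N<m)
        W≡ : vars σ′ vW ≡ W
        W≡ = trans (var-unset K vW refl) Weq
        H≡ : vars σ′ vH ≡ h
        H≡ = trans (var-unset K vH refl) Heq
        Z = addNeighbour-correct TGT SRC h W N _ σ₁ refl tgt< src< (off-ok (isReady C′))
              (isWeights C′ N N<m) W<S refl W≡ H≡ (isD C′)
              (addNeighbour-correct SRC TGT h W N _ σ₀ refl src< tgt< (off-ok (isReady C′))
                (isWeights C′ N N<m) W<S refl W≡ H≡ (isD C′) Y)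

    nextVertex-correct : ∀ h σ → h < n → Context σ → vars σ vH ≡ h →
      (∀ W → W < S → arrs σ SER W ≡ bit (μ m (below h) W)) →
      ∀ W → W < S → arrs (exec ρ nextVertex σ) SER W ≡ bit (μ m (below (suc h)) W)
    nextVertex-correct h σ h<n C Heq ser W W<S =
      proj₁ (for-inv ρ vW pBound nextWeight σ P ((λ _ ()) , (λ W _ → ser W) , λ _ _ _ ()) next) W W<S
      where
      P : ℕ → State → Set
      -- Below N the series already belongs to h + 1 vertices, from N on still to h.
      P N σ′ = (∀ W → W < N → arrs σ′ SER W ≡ bit (μ m (below (suc h)) W)) ×
               (∀ W → N ≤ W → W < S → arrs σ′ SER W ≡ bit (μ m (below h) W)) ×
               (∀ u W → u < n → W < N → arrs σ′ EXT (u * S + W) ≡ bit (dp h u W))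
      next : ∀ N σ′ → N < S → Kept nextVertex σ σ′ → P N σ′ → P (suc N) (exec ρ nextWeight (setVar vW N σ′))
      next N σ′ N<S K (new , old , ext) = new′ , old′ , ext′
        where
        σ₀ σ₁ σ₂ : State
        σ₀ = setVar vW N σ′
        σ₁ = exec ρ startExt σ₀
        σ₂ = exec ρ scanEdges σ₁
        K₁ : Kept startExt σ₀ σ₁
        K₁ = exec-kept startExt ρ σ₀
        K₂ : Kept scanEdges σ₁ σ₂
        K₂ = exec-kept scanEdges ρ σ₁
        C₀ : Context σ₀
        C₀ = context-setVar vW N refl (context-kept K refl refl refl C)
        C₁ : Context σ₁
        C₁ = context-kept K₁ refl refl refl C₀
        H₀ : vars σ₀ vH ≡ h
        H₀ = trans (var-unset K vH refl) Heq
        W₁ : vars σ₁ vW ≡ N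
        W₁ = var-unset K₁ vW refl
        H₁ : vars σ₁ vH ≡ h
        H₁ = trans (var-unset K₁ vH refl) H₀
        X : Table h N (λ v → dp h v N) (arrs σ₂ EXT)
        X = scanEdges-correct h N σ₁ C₁ N<S W₁ H₁
              (startExt-correct h N σ₀ C₀ N<S refl H₀ ext _ (old N ℕ.≤-refl N<S))
        W₂ : vars σ₂ vW ≡ N
        W₂ = trans (var-unset K₂ vW refl) W₁
        H₂ : vars σ₂ vH ≡ h
        H₂ = trans (var-unset K₂ vH refl) H₁
        ser₂ : ∀ W → arrs σ₂ SER W ≡ arrs σ′ SER W
        ser₂ W = cong (λ f → f W) (trans (arr-kept K₂ SER refl) (arr-kept K₁ SER refl))
        off₂ : arrs σ₂ OFF h ≡ h * S
        off₂ = off-ok (isReady (context-kept K₂ refl refl refl C₁)) h h<n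
        val : arrs σ₂ EXT (arrs σ₂ OFF (vars σ₂ vH) + vars σ₂ vW) ≡ bit (μ m (below (suc h)) N)
        val = trans (cong₂ (λ x y → arrs σ₂ EXT (x + y)) (trans (cong (arrs σ₂ OFF) H₂) off₂) W₂)
                (trans (current X h h<n) (cong bit (dp-top h N)))
        ser′ : ∀ W → (arrs σ₂ SER [ vars σ₂ vW ↦ arrs σ₂ EXT (arrs σ₂ OFF (vars σ₂ vH) + vars σ₂ vW) ]) W
               ≡ (arrs σ₂ SER [ N ↦ bit (μ m (below (suc h)) N) ]) W
        ser′ W = cong₂ (λ x y → (arrs σ₂ SER [ x ↦ y ]) W) W₂ val
        new′ : ∀ W → W < suc N → arrs (exec ρ nextWeight σ₀) SER W ≡ bit (μ m (below (suc h)) W)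
        new′ W W<1+N with W ≟ N
        ... | yes refl = trans (ser′ W) (↦-same (arrs σ₂ SER) W _)
        ... | no  W≢N  = trans (ser′ W) (trans (↦-other (arrs σ₂ SER) _ W≢N)
                           (trans (ser₂ W) (new W (ℕ.≤∧≢⇒< (ℕ.≤-pred W<1+N) W≢N))))
        old′ : ∀ W → suc N ≤ W → W < S → arrs (exec ρ nextWeight σ₀) SER W ≡ bit (μ m (below h) W)
        old′ W N<W W<S = trans (ser′ W) (trans (↦-other (arrs σ₂ SER) _ (λ eq → ℕ.<⇒≢ N<W (sym eq)))
                           (trans (ser₂ W) (old W (ℕ.<⇒≤ N<W) W<S)))
        ext′ : ∀ u W → u < n → W < suc N → arrs (exec ρ nextWeight σ₀) EXT (u * S + W) ≡ bit (dp h u W)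
        ext′ u W u<n W<1+N with W ≟ N
        ... | yes refl = current X u u<n
        ... | no  W≢N  = columns X u W u<n (ℕ.≤∧≢⇒< (ℕ.≤-pred W<1+N) W≢N)

    count-correct : ∀ σ → Context σ → ∀ W → W < S → arrs (exec ρ count σ) SER W ≡ bit (μ m (below n) W)
    count-correct σ C = proj₁ (for-inv ρ vH pN nextVertex σ₂ P (start , C₂) next)
      where
      σ₁ σ₂ : State
      σ₁ = exec ρ startSeries σ
      σ₂ = exec ρ (SER ⟨ lit 0 ⟩↤ lit 1) σ₁
      C₂ : Context σ₂
      C₂ = context-kept (exec-kept (startSeries ︔ SER ⟨ lit 0 ⟩↤ lit 1) ρ σ) refl refl refl C
      zeros : ∀ W → W < S → arrs σ₁ SER W ≡ 0
      zeros = for-inv ρ vW pBound _ σ (λ N σ′ → ∀ W → W < N → arrs σ′ SER W ≡ 0) (λ _ ()) next₀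
        where
        next₀ : ∀ N σ′ → N < S → Kept startSeries σ σ′ → (∀ W → W < N → arrs σ′ SER W ≡ 0) →
                ∀ W → W < suc N → (arrs σ′ SER [ N ↦ 0 ]) W ≡ 0
        next₀ N σ′ _ _ p W W<1+N with W ≟ N
        ... | yes refl = ↦-same (arrs σ′ SER) W 0
        ... | no  W≢N  = trans (↦-other (arrs σ′ SER) 0 W≢N) (p W (ℕ.≤∧≢⇒< (ℕ.≤-pred W<1+N) W≢N))
      start : ∀ W → W < S → arrs σ₂ SER W ≡ bit (μ m (below 0) W)
      start zero    _   = cong bit (sym (μ-empty m 0))
      start (suc W) W<S = trans (zeros (suc W) W<S) (cong bit (sym (μ-empty m (suc W))))
      P : ℕ → State → Set
      P N σ′ = (∀ W → W < S → arrs σ′ SER W ≡ bit (μ m (below N) W)) × Context σ′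
      next : ∀ N σ′ → N < n → Kept (for vH < pN repeat nextVertex) σ₂ σ′ → P N σ′ →
             P (suc N) (exec ρ nextVertex (setVar vH N σ′))
      next N σ′ N<n K (ser , C′) =
        nextVertex-correct N (setVar vH N σ′) N<n (context-setVar vH N refl C′) refl ser ,
        context-kept (exec-kept nextVertex ρ (setVar vH N σ′)) refl refl refl (context-setVar vH N refl C′)

  weightOf : ∀ {b m} → Vec (Vec Bool b) m → ℕ → ℕ
  weightOf []      e       = 0
  weightOf (x ∷ c) zero    = value x
  weightOf (x ∷ c) (suc e) = weightOf c e

  weightOf-≤ : ∀ {b m} (c : Vec (Vec Bool b) m) e → weightOf c e < 2 ^ b
  weightOf-≤ {b} []      e       = ℕ.m^n>0 2 b
  weightOf-≤ {b} (x ∷ c) zero    = subst (value x <_) (ℕ.*-identityˡ (2 ^ b)) (value-< 0 x)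
  weightOf-≤     (x ∷ c) (suc e) = weightOf-≤ c e

  fullWeight : Vec (Vec Bool b) m → ℕ → ℕ
  fullWeight c e = weightOf c e + pow (col e)

  -- The invariant keeps the bits y not yet tossed and says that continuing Horner's scheme with y
  -- from the present value of `vw` yields `value x`.
  sample-correct : ∀ σ (x : Vec Bool b) rest → coins σ ≡ Vec.toList x List.++ rest → vars σ vw ≡ 0 →
    vars (exec ρ (for vJ < pB repeat (toss vc ︔ vw ↤ var vw ⊞ var vw ⊞ var vc)) σ) vw ≡ value x ×
    coins (exec ρ (for vJ < pB repeat (toss vc ︔ vw ↤ var vw ⊞ var vw ⊞ var vc)) σ) ≡ rest
  sample-correct σ x rest cs w≡0 = finish (exec ρ (for vJ < pB repeat (toss vc ︔ vw ↤ var vw ⊞ var vw ⊞ var vc)) σ)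
    (for-inv ρ vJ pB _ σ P (b , x , refl , cs , cong (λ w → valueFrom w x) w≡0) next)
    where
    P : ℕ → State → Set
    P N σ′ = ∃[ k ] Σ[ y ∈ Vec Bool k ] N + k ≡ b × coins σ′ ≡ Vec.toList y List.++ rest ×
             valueFrom (vars σ′ vw) y ≡ value x
    next : ∀ N σ′ → N < b → Kept (for vJ < pB repeat (toss vc ︔ vw ↤ var vw ⊞ var vw ⊞ var vc)) σ σ′ → P N σ′ →
           P (suc N) (exec ρ (toss vc ︔ vw ↤ var vw ⊞ var vw ⊞ var vc) (setVar vJ N σ′))
    next N σ′ N<b _ (zero , [] , p , _) = contradiction (trans (sym (ℕ.+-identityʳ N)) p) (ℕ.<⇒≢ N<b)
    next N σ′ N<b _ (suc k , t ∷ y , p , q , r) = k , y , trans (sym (ℕ.+-suc N k)) p , cong (List.drop 1) q ,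
      trans (cong (λ z → valueFrom (vars σ′ vw + vars σ′ vw + bit (firstCoin z)) y) q) r
    finish : ∀ σ′ → P b σ′ → vars σ′ vw ≡ value x × coins σ′ ≡ rest
    finish σ′ (zero , [] , _ , q , r) = r , q
    finish σ′ (suc k , _ , p , _) = contradiction (sym p) (ℕ.m≢1+m+n b ∘ (λ eq → trans eq (ℕ.+-suc b k)))

  weighEdges-correct : ∀ σ → Ready σ → (c : Vec (Vec Bool b) m) (rest : List Bool) →
    coins σ ≡ flatten Vec.toList c List.++ rest →
    Weights (fullWeight c) (exec ρ weighEdges σ) × coins (exec ρ weighEdges σ) ≡ rest
  weighEdges-correct σ R c rest cs = finish (exec ρ weighEdges σ) (for-inv ρ vE pM _ σ P (m , c , refl , cs , (λ _ ()) , λ _ → refl) next)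
    where
    P : ℕ → State → Set
    P N σ′ = ∃[ k ] Σ[ y ∈ Vec (Vec Bool b) k ] N + k ≡ m × coins σ′ ≡ flatten Vec.toList y List.++ rest ×
             (∀ e → e < N → arrs σ′ WT e ≡ fullWeight c e) × (∀ j → weightOf y j ≡ weightOf c (N + j))
    finish : ∀ σ′ → P m σ′ → Weights (fullWeight c) σ′ × coins σ′ ≡ rest
    finish σ′ (zero , [] , _ , q , w , _) = w , q
    finish σ′ (suc k , _ , p , _) = contradiction (sym p) (ℕ.m≢1+m+n m ∘ (λ eq → trans eq (ℕ.+-suc m k)))
    next : ∀ N σ′ → N < m → Kept weighEdges σ σ′ → P N σ′ → P (suc N) (exec ρ
      ( vw ↤ lit 0 ︔ for vJ < pB repeat (toss vc ︔ vw ↤ var vw ⊞ var vw ⊞ var vc)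
      ︔ WT ⟨ var vE ⟩↤ var vw ⊞ POW ⟨ COL ! vE ⟩ ) (setVar vE N σ′))
    next N σ′ N<m _ (zero , [] , p , _) = contradiction (trans (sym (ℕ.+-identityʳ N)) p) (ℕ.<⇒≢ N<m)
    next N σ′ N<m K (suc k , x ∷ y , p , q , w , v) =
      k , y , trans (sym (ℕ.+-suc N k)) p , proj₂ S₂ , w′ , λ j → trans (v (suc j)) (cong (weightOf c) (ℕ.+-suc N j))
      where
      sampling : Cmd
      sampling = for vJ < pB repeat (toss vc ︔ vw ↤ var vw ⊞ var vw ⊞ var vc)
      σ₁ σ₂ : State
      σ₁ = setVar vw 0 (setVar vE N σ′)
      σ₂ = exec ρ sampling σ₁
      S₂ = sample-correct σ₁ x (flatten Vec.toList y List.++ rest)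
             (trans q (List.++-assoc (Vec.toList x) (flatten Vec.toList y) rest)) refl
      K₂ : Kept sampling σ₁ σ₂
      K₂ = exec-kept sampling ρ σ₁
      R₂ : Ready σ₂
      R₂ = ready-kept K₂ refl (ready-setVar vw 0 (ready-setVar vE N (ready-kept K refl R)))
      e≡ : vars σ₂ vE ≡ N
      e≡ = var-unset K₂ vE refl
      val : vars σ₂ vw + arrs σ₂ POW (arrs σ₂ COL (vars σ₂ vE)) ≡ fullWeight c N
      val = cong₂ _+_ (trans (proj₁ S₂) (trans (v 0) (cong (weightOf c) (ℕ.+-identityʳ N))))
        (trans (cong (arrs σ₂ POW) (trans (cong (arrs σ₂ COL) e≡) (col-ok R₂ N N<m)))
               (pow-ok R₂ (col N) (col<s N N<m)))
      w′ : ∀ e → e < suc N →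
           (arrs σ₂ WT [ vars σ₂ vE ↦ vars σ₂ vw + arrs σ₂ POW (arrs σ₂ COL (vars σ₂ vE)) ]) e ≡ fullWeight c e
      w′ e e<1+N with e ≟ N
      ... | yes refl = trans (cong₂ (λ a b → (arrs σ₂ WT [ a ↦ b ]) e) e≡ val) (↦-same (arrs σ₂ WT) e _)
      ... | no  e≢N  = trans (↦-other (arrs σ₂ WT) _ (λ eq → e≢N (trans eq e≡)))
          (trans (cong (λ f → f e) (arr-kept K₂ WT refl)) (w e (ℕ.≤∧≢⇒< (ℕ.≤-pred e<1+N) e≢N)))

  selected : (ℕ → ℕ) → ℕ → ℕ → Bool
  selected wt T d = not (Matchings.μ src tgt wt (Weighted.others src tgt wt d) m (below n) T)

  candidate-correct : ∀ σ wt T → (∀ e → 0 < wt e) → T < S → Ready σ → Weights wt σ → vars σ vT ≡ T →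
    ∀ d → d < m → arrs (exec ρ candidate σ) CAND d ≡ bit (selected wt T d)
  candidate-correct σ wt T wt>0 T<S R w T≡ = for-inv ρ vD pM _ σ P (λ _ ()) next
    where
    P : ℕ → State → Set
    P N σ′ = ∀ d → d < N → arrs σ′ CAND d ≡ bit (selected wt T d)
    next : ∀ N σ′ → N < m → Kept candidate σ σ′ → P N σ′ →
           P (suc N) (exec ρ (count ︔ CAND ⟨ var vD ⟩↤ lit 1 ⊟ SER ! vT) (setVar vD N σ′))
    next N σ′ N<m K p d d<1+N = updated (d ≟ N)
      where
      open Counting wt wt>0 N
      σ₁ σ₂ : State
      σ₁ = setVar vD N σ′
      σ₂ = exec ρ count σ₁
      K₂ : Kept count σ₁ σ₂
      K₂ = exec-kept count ρ σ₁
      C : Context σ₁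
      C = context (ready-setVar vD N (ready-kept K refl R)) (weights-kept K refl w) refl
      T₂ : vars σ₂ vT ≡ T
      T₂ = trans (var-unset K₂ vT refl) (trans (var-unset K vT refl) T≡)
      D₂ : vars σ₂ vD ≡ N
      D₂ = var-unset K₂ vD refl
      val : 1 ∸ arrs σ₂ SER (vars σ₂ vT) ≡ bit (selected wt T N)
      val = trans (cong (1 ∸_) (trans (cong (arrs σ₂ SER) T₂) (count-correct σ₁ C T T<S))) (1∸bit _)
      updated : Dec (d ≡ N) → (arrs σ₂ CAND [ vars σ₂ vD ↦ 1 ∸ arrs σ₂ SER (vars σ₂ vT) ]) d ≡ bit (selected wt T d)
      updated (yes refl) = trans (cong₂ (λ a b → (arrs σ₂ CAND [ a ↦ b ]) d) D₂ val) (↦-same (arrs σ₂ CAND) d _)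
      updated (no  d≢N)  = trans (↦-other (arrs σ₂ CAND) _ (λ eq → d≢N (trans eq D₂)))
        (trans (cong (λ f → f d) (arr-kept K₂ CAND refl)) (p d (ℕ.≤∧≢⇒< (ℕ.≤-pred d<1+N) d≢N)))

  degree : (ℕ → Bool) → ℕ → ℕ → ℕ
  degree M N v = ∑< N λ e → bit (M e) * (bit (src e ≡ᵇ v) + bit (tgt e ≡ᵇ v))

  colours : (ℕ → Bool) → ℕ → ℕ → ℕ
  colours M N i = ∑< N λ e → bit (M e) * bit (col e ≡ᵇ i)

  Solves : (ℕ → Bool) → Set
  Solves M = (∀ v → v < n → degree M m v ≡ 1) × (∀ i → i < s → colours M m i ≡ need i)

  add-at : ∀ f a x v → (f [ a ↦ f a + x ]) v ≡ f v + bit (a ≡ᵇ v) * x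
  add-at f a x v with a ≟ v
  ... | yes refl = trans (↦-same f a (f a + x)) (cong (f a +_)
        (sym (trans (cong (λ z → bit z * x) (≡ᵇ-refl a)) (ℕ.*-identityˡ x))))
  ... | no  a≢v  = trans (↦-other f (f a + x) (a≢v ∘ sym)) (sym
        (trans (cong (λ z → f v + bit z * x) (≢⇒≡ᵇ a≢v)) (ℕ.+-identityʳ (f v))))

  module Checking (M : ℕ → Bool) where

    Candidate : State → Set
    Candidate σ = ∀ e → e < m → arrs σ CAND e ≡ bit (M e)

    candidate-kept : ∀ {A σ σ′} → Kept A σ σ′ → setsArr CAND A ≡ false → Candidate σ → Candidate σ′
    candidate-kept K p C e e<m = trans (cong (λ f → f e) (arr-kept K CAND p)) (C e e<m)

    Tallied : State → Set
    Tallied σ = (∀ v → v < n → arrs σ DEG v ≡ degree M m v) × (∀ i → i < s → arrs σ CNT i ≡ colours M m i)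

    clear-correct : ∀ x y k σ → ∀ i → i < ρ y → arrs (exec ρ (for x < y repeat (k ⟨ var x ⟩↤ lit 0)) σ) k i ≡ 0
    clear-correct x y k σ = for-inv ρ x y _ σ (λ N σ′ → ∀ i → i < N → arrs σ′ k i ≡ 0) (λ _ ()) next
      where
      next : ∀ N σ′ → N < ρ y → Kept (for x < y repeat (k ⟨ var x ⟩↤ lit 0)) σ σ′ →
             (∀ i → i < N → arrs σ′ k i ≡ 0) →
             ∀ i → i < suc N → arrs (exec ρ (k ⟨ var x ⟩↤ lit 0) (setVar x N σ′)) k i ≡ 0
      next N σ′ _ _ p i i<1+N
        rewrite ↦-same (vars σ′) x N | dec-true (k Fin.≟ k) refl with i ≟ N
      ... | yes refl = ↦-same (arrs σ′ k) i 0
      ... | no  i≢N  = trans (↦-other (arrs σ′ k) 0 i≢N) (p i (ℕ.≤∧≢⇒< (ℕ.≤-pred i<1+N) i≢N))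

    tally-correct : ∀ σ → Ready σ → Candidate σ → Tallied (exec ρ tally σ)
    tally-correct σ R C = for-inv ρ vE pM _ σ₂ P (start-deg , clear-correct vI pS CNT σ₁) next
      where
      clear₁ clear₂ : Cmd
      clear₁ = for vV < pN repeat (DEG ⟨ var vV ⟩↤ lit 0)
      clear₂ = for vI < pS repeat (CNT ⟨ var vI ⟩↤ lit 0)
      σ₁ σ₂ : State
      σ₁ = exec ρ clear₁ σ
      σ₂ = exec ρ clear₂ σ₁
      start-deg : ∀ v → v < n → arrs σ₂ DEG v ≡ 0
      start-deg v v<n = trans (cong (λ f → f v) (arr-kept (exec-kept clear₂ ρ σ₁) DEG refl))
                              (clear-correct vV pN DEG σ v v<n)
      P : ℕ → State → Set
      P N σ′ = (∀ v → v < n → arrs σ′ DEG v ≡ degree M N v) × (∀ i → i < s → arrs σ′ CNT i ≡ colours M N i)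
      body : Cmd
      body = DEG ⟨ SRC ! vE ⟩↤ DEG ⟨ SRC ! vE ⟩ ⊞ CAND ! vE
           ︔ DEG ⟨ TGT ! vE ⟩↤ DEG ⟨ TGT ! vE ⟩ ⊞ CAND ! vE
           ︔ CNT ⟨ COL ! vE ⟩↤ CNT ⟨ COL ! vE ⟩ ⊞ CAND ! vE
      next : ∀ N σ′ → N < m → Kept (for vE < pM repeat body) σ₂ σ′ → P N σ′ →
             P (suc N) (exec ρ body (setVar vE N σ′))
      next N σ′ N<m K (p , q) = deg′ , cnt′
        where
        K₀ : Kept (clear₁ ︔ clear₂) σ σ₂
        K₀ = exec-kept (clear₁ ︔ clear₂) ρ σ
        R′ : Ready σ′
        R′ = ready-kept K refl (ready-kept K₀ refl R)
        x≡ : arrs σ′ CAND N ≡ bit (M N)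
        x≡ = candidate-kept K refl (candidate-kept K₀ refl C) N N<m
        x : ℕ
        x = arrs σ′ CAND N
        D₁ : ℕ → ℕ
        D₁ = arrs σ′ DEG [ arrs σ′ SRC N ↦ arrs σ′ DEG (arrs σ′ SRC N) + x ]
        deg′ : ∀ v → v < n → (D₁ [ arrs σ′ TGT N ↦ D₁ (arrs σ′ TGT N) + x ]) v ≡ degree M (suc N) v
        deg′ v v<n = begin
          (D₁ [ arrs σ′ TGT N ↦ D₁ (arrs σ′ TGT N) + x ]) v
            ≡⟨ add-at D₁ (arrs σ′ TGT N) x v ⟩
          D₁ v + bit (arrs σ′ TGT N ≡ᵇ v) * x
            ≡⟨ cong (_+ bit (arrs σ′ TGT N ≡ᵇ v) * x) (add-at (arrs σ′ DEG) (arrs σ′ SRC N) x v) ⟩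
          arrs σ′ DEG v + bit (arrs σ′ SRC N ≡ᵇ v) * x + bit (arrs σ′ TGT N ≡ᵇ v) * x
            ≡⟨ solve 4 (λ g a c x → g :+ a :* x :+ c :* x := g :+ x :* (a :+ c)) refl
                 (arrs σ′ DEG v) (bit (arrs σ′ SRC N ≡ᵇ v)) (bit (arrs σ′ TGT N ≡ᵇ v)) x ⟩
          arrs σ′ DEG v + x * (bit (arrs σ′ SRC N ≡ᵇ v) + bit (arrs σ′ TGT N ≡ᵇ v))
            ≡⟨ cong₂ _+_ (p v v<n) (cong₂ _*_ x≡ (cong₂ (λ a c → bit (a ≡ᵇ v) + bit (c ≡ᵇ v))
                 (src-ok R′ N N<m) (tgt-ok R′ N N<m))) ⟩
          degree M (suc N) v ∎
          where
          open ≡-Reasoning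
          open +-*-Solver
        cnt′ : ∀ i → i < s → (arrs σ′ CNT [ arrs σ′ COL N ↦ arrs σ′ CNT (arrs σ′ COL N) + x ]) i ≡ colours M (suc N) i
        cnt′ i i<s = trans (add-at (arrs σ′ CNT) (arrs σ′ COL N) x i)
          (cong₂ _+_ (q i i<s) (trans (ℕ.*-comm (bit (arrs σ′ COL N ≡ᵇ i)) x)
            (cong₂ _*_ x≡ (cong (λ a → bit (a ≡ᵇ i)) (col-ok R′ N N<m)))))

    defect : ℕ
    defect = ∑< n (λ v → degree M m v ∸ 1 + (1 ∸ degree M m v)) +
             ∑< s (λ i → colours M m i ∸ need i + (need i ∸ colours M m i))

    inspect-correct : ∀ σ → Ready σ → Tallied σ → vars (exec ρ inspect σ) vBad ≡ defect
    inspect-correct σ R (deg , cnt) = for-inv ρ vI pS _ σ₂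
        (λ N σ′ → vars σ′ vBad ≡ ∑< n (λ v → degree M m v ∸ 1 + (1 ∸ degree M m v)) +
                    ∑< N (λ i → colours M m i ∸ need i + (need i ∸ colours M m i)))
        (trans vertices (sym (ℕ.+-identityʳ _))) next₂
      where
      loop₁ loop₂ : Cmd
      loop₁ = for vV < pN repeat (vBad ↤ var vBad ⊞ distance (DEG ! vV) (lit 1))
      loop₂ = for vI < pS repeat (vBad ↤ var vBad ⊞ distance (CNT ! vI) (NEED ! vI))
      σ₁ σ₂ : State
      σ₁ = setVar vBad 0 σ
      σ₂ = exec ρ loop₁ σ₁
      next₁ : ∀ N σ′ → N < n → Kept loop₁ σ₁ σ′ →
        vars σ′ vBad ≡ ∑< N (λ v → degree M m v ∸ 1 + (1 ∸ degree M m v)) →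
        vars σ′ vBad + (arrs σ′ DEG N ∸ 1 + (1 ∸ arrs σ′ DEG N)) ≡
        ∑< (suc N) (λ v → degree M m v ∸ 1 + (1 ∸ degree M m v))
      next₁ N σ′ N<n K p = cong₂ _+_ p (cong (λ x → x ∸ 1 + (1 ∸ x))
        (trans (cong (λ f → f N) (arr-kept K DEG refl)) (deg N N<n)))
      vertices : vars σ₂ vBad ≡ ∑< n (λ v → degree M m v ∸ 1 + (1 ∸ degree M m v))
      vertices = for-inv ρ vV pN _ σ₁
        (λ N σ′ → vars σ′ vBad ≡ ∑< N (λ v → degree M m v ∸ 1 + (1 ∸ degree M m v))) refl next₁
      next₂ : ∀ N σ′ → N < s → Kept loop₂ σ₂ σ′ →
        vars σ′ vBad ≡ ∑< n (λ v → degree M m v ∸ 1 + (1 ∸ degree M m v)) +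
          ∑< N (λ i → colours M m i ∸ need i + (need i ∸ colours M m i)) →
        vars σ′ vBad + (arrs σ′ CNT N ∸ arrs σ′ NEED N + (arrs σ′ NEED N ∸ arrs σ′ CNT N)) ≡
        ∑< n (λ v → degree M m v ∸ 1 + (1 ∸ degree M m v)) +
          ∑< (suc N) (λ i → colours M m i ∸ need i + (need i ∸ colours M m i))
      next₂ N σ′ N<s K p = trans (cong₂ _+_ p (cong₂ (λ x y → x ∸ y + (y ∸ x))
          (trans (cong (λ f → f N) (trans (arr-kept K CNT refl) (arr-kept (exec-kept loop₁ ρ σ₁) CNT refl))) (cnt N N<s))
          (need-ok (ready-kept K refl (ready-kept (exec-kept loop₁ ρ σ₁) refl (ready-setVar vBad 0 R))) N N<s)))
        (ℕ.+-assoc (∑< n (λ v → degree M m v ∸ 1 + (1 ∸ degree M m v))) _ _)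

    distance-zero : ∀ x y → x ∸ y + (y ∸ x) ≡ 0 → x ≡ y
    distance-zero zero    zero    p = refl
    distance-zero (suc x) (suc y) p = cong suc (distance-zero x y p)

    distance-same : ∀ {x y} → x ≡ y → x ∸ y + (y ∸ x) ≡ 0
    distance-same {x} refl rewrite ℕ.n∸n≡0 x = refl

    defect-zero : defect ≡ 0 → Solves M
    defect-zero p =
      (λ v v<n → distance-zero _ 1 (∑<-zero n _ (ℕ.m+n≡0⇒m≡0 _ p) v v<n)) ,
      (λ i i<s → distance-zero _ (need i) (∑<-zero s _ (ℕ.m+n≡0⇒n≡0
        (∑< n (λ v → degree M m v ∸ 1 + (1 ∸ degree M m v))) p) i i<s))

    solves-defect : Solves M → defect ≡ 0
    solves-defect (p , q) = cong₂ _+_ (∑<-zeros n _ (λ v v<n → distance-same (p v v<n)))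
                                      (∑<-zeros s _ (λ i i<s → distance-same (q i i<s)))

  module Publishing (m≤l : m ≤ ρ 0) where

    Found : State → Set
    Found σ = cells σ 0 ≡ 1 × ∃[ M ] Solves M × (∀ e → e < m → cells σ (suc e) ≡ bit (M e))

    Sound : State → Set
    Sound σ = cells σ 0 ≡ 0 ⊎ Found σ

    found-≗ : ∀ σ σ′ → (∀ x → cells σ′ x ≡ cells σ x) → Found σ → Found σ′
    found-≗ σ σ′ p (q , M , sol , r) = trans (p 0) q , M , sol , λ e e<m → trans (p (suc e)) (r e e<m)

    sound-≗ : ∀ σ σ′ → (∀ x → cells σ′ x ≡ cells σ x) → Sound σ → Sound σ′
    sound-≗ σ σ′ p (inj₁ q) = inj₁ (trans (p 0) q)
    sound-≗ σ σ′ p (inj₂ q) = inj₂ (found-≗ σ σ′ p q)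

    loop₀ : Cmd
    loop₀ = for vE < pM repeat (inp⟨ lit 1 ⊞ var vE ⟩↤ var vBad ¿ inp (lit 1 ⊞ var vE) ∶ CAND ! vE)

    publish-bad : ∀ σ {k} → vars σ vBad ≡ suc k → ∀ x → cells (exec ρ publish σ) x ≡ cells σ x
    publish-bad σ {k} bad x = trans (cong (λ z → (cells σ₁ [ clamp ρ 0 ↦ choose z (cells σ₁ (clamp ρ 0)) 1 ]) x)
        (trans (var-unset (exec-kept loop₀ ρ σ) vBad refl) bad)) (trans (unchanged (cells σ₁) (clamp ρ 0) x) (before x))
      where
      σ₁ : State
      σ₁ = exec ρ loop₀ σ
      unchanged : ∀ f i x → (f [ i ↦ f i ]) x ≡ f x
      unchanged f i x with x ≟ i
      ... | yes refl = ↦-same f x (f x)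
      ... | no  x≢i  = ↦-other f (f i) x≢i
      before : ∀ x → cells σ₁ x ≡ cells σ x
      before = for-inv ρ vE pM _ σ (λ N σ′ → ∀ x → cells σ′ x ≡ cells σ x) (λ _ → refl) next
        where
        next : ∀ N σ′ → N < m → Kept loop₀ σ σ′ → (∀ x → cells σ′ x ≡ cells σ x) → ∀ x →
          (cells σ′ [ clamp ρ (suc N) ↦ choose (vars σ′ vBad) (cells σ′ (clamp ρ (suc N))) (arrs σ′ CAND N) ]) x ≡ cells σ x
        next N σ′ _ K p x = trans (cong (λ z → (cells σ′ [ clamp ρ (suc N) ↦ choose z (cells σ′ (clamp ρ (suc N))) (arrs σ′ CAND N) ]) x)
            (trans (var-unset K vBad refl) bad)) (trans (unchanged (cells σ′) (clamp ρ (suc N)) x) (p x))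

    publish-good : ∀ σ → vars σ vBad ≡ 0 → cells (exec ρ publish σ) 0 ≡ 1 ×
      (∀ e → e < m → cells (exec ρ publish σ) (suc e) ≡ arrs σ CAND e)
    publish-good σ good =
        trans (top 0) (↦-same (cells σ₁) 0 1)
      , λ e e<m → trans (top (suc e)) (trans (↦-other (cells σ₁) {0} {suc e} 1 (λ ())) (before e e<m))
      where
      σ₁ : State
      σ₁ = exec ρ loop₀ σ
      top : ∀ x → cells (exec ρ publish σ) x ≡ (cells σ₁ [ 0 ↦ 1 ]) x
      top x = cong₂ (λ i z → (cells σ₁ [ i ↦ choose z (cells σ₁ (clamp ρ 0)) 1 ]) x) (clamp-≡ ρ 0 z≤n)
        (trans (var-unset (exec-kept loop₀ ρ σ) vBad refl) good)
      before : ∀ e → e < m → cells σ₁ (suc e) ≡ arrs σ CAND e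
      before = for-inv ρ vE pM _ σ (λ N σ′ → ∀ e → e < N → cells σ′ (suc e) ≡ arrs σ CAND e) (λ _ ()) next
        where
        next : ∀ N σ′ → N < m → Kept loop₀ σ σ′ → (∀ e → e < N → cells σ′ (suc e) ≡ arrs σ CAND e) →
          ∀ e → e < suc N →
          (cells σ′ [ clamp ρ (suc N) ↦ choose (vars σ′ vBad) (cells σ′ (clamp ρ (suc N))) (arrs σ′ CAND N) ]) (suc e)
            ≡ arrs σ CAND e
        next N σ′ N<m K p e e<1+N = trans
          (cong₂ (λ i z → (cells σ′ [ i ↦ choose z (cells σ′ (clamp ρ (suc N))) (arrs σ′ CAND N) ]) (suc e))
            (clamp-≡ ρ (suc N) (ℕ.≤-trans N<m m≤l)) (trans (var-unset K vBad refl) good)) (updated (e ≟ N))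
          where
          updated : Dec (e ≡ N) → (cells σ′ [ suc N ↦ arrs σ′ CAND N ]) (suc e) ≡ arrs σ CAND e
          updated (yes refl) = trans (↦-same (cells σ′) (suc e) _) (cong (λ f → f e) (arr-kept K CAND refl))
          updated (no  e≢N)  = trans (↦-other (cells σ′) {suc N} (arrs σ′ CAND N) (λ eq → e≢N (ℕ.suc-injective eq)))
                              (p e (ℕ.≤∧≢⇒< (ℕ.≤-pred e<1+N) e≢N))

    -- Whatever is written has passed the test, so errors can only be one-sided, and a solution once
    -- published is only ever replaced by another solution.
    check-correct : ∀ σ M → Ready σ → (∀ e → e < m → arrs σ CAND e ≡ bit (M e)) →
      (Solves M → Found (exec ρ check σ)) ×
      (Sound σ → Sound (exec ρ check σ)) × (Found σ → Found (exec ρ check σ))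
    check-correct σ M R C = decide (vars σ₂ vBad) refl
      where
      open Checking M
      σ₁ σ₂ : State
      σ₁ = exec ρ tally σ
      σ₂ = exec ρ inspect σ₁
      K₁ : Kept tally σ σ₁
      K₁ = exec-kept tally ρ σ
      K₂ : Kept inspect σ₁ σ₂
      K₂ = exec-kept inspect ρ σ₁
      bad≡ : vars σ₂ vBad ≡ defect
      bad≡ = inspect-correct σ₁ (ready-kept K₁ refl R) (tally-correct σ R C)
      same : ∀ x → cells σ₂ x ≡ cells σ x
      same x = cong (λ f → f x) (trans (cell-kept K₂ refl) (cell-kept K₁ refl))
      decide : ∀ z → vars σ₂ vBad ≡ z → (Solves M → Found (exec ρ publish σ₂)) ×
               (Sound σ → Sound (exec ρ publish σ₂)) × (Found σ → Found (exec ρ publish σ₂))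
      decide zero    z≡ = (λ _ → found) , (λ _ → inj₂ found) , (λ _ → found)
        where
        found : Found (exec ρ publish σ₂)
        found = let p , q = publish-good σ₂ z≡ in p , M , defect-zero (trans (sym bad≡) z≡) ,
          λ e e<m → trans (q e e<m) (candidate-kept K₂ refl (candidate-kept K₁ refl C) e e<m)
      decide (suc k) z≡ =
        (λ sol → contradiction (trans (sym z≡) (trans bad≡ (solves-defect sol))) λ ()) , sound-≗ σ (exec ρ publish σ₂) kept-cells , found-≗ σ (exec ρ publish σ₂) kept-cells
        where
        kept-cells : ∀ x → cells (exec ρ publish σ₂) x ≡ cells σ x
        kept-cells x = trans (publish-bad σ₂ z≡ x) (same x)

    Good : Vec (Vec Bool b) m → Set
    Good c = ∃[ T ] T < S × Solves (selected (fullWeight c) T)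

    record Outcome (σ σ′ : State) (success : Set) : Set where
      constructor outcome
      field
        still-ready : Ready σ′
        still-sound : Sound σ′
        still-found : Found σ → Found σ′
        succeeds    : success → Found σ′
    open Outcome

    trial-correct : ∀ σ c rest → Ready σ → Sound σ → coins σ ≡ flatten Vec.toList c List.++ rest →
      Outcome σ (exec ρ trial σ) (Good c) × coins (exec ρ trial σ) ≡ rest
    trial-correct σ c rest R snd cs =
        outcome (ready-kept (exec-kept search ρ σ₁) refl R₁) (proj₁ Pm) (proj₁ (proj₂ Pm) ∘ found-≗ σ σ₁ same)
          (λ { (T , T<S , sol) → proj₂ (proj₂ Pm) T T<S sol })
      , trans (coin-kept (exec-kept search ρ σ₁) refl) (proj₂ W₁)
      where
      wt : ℕ → ℕ
      wt = fullWeight c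
      search : Cmd
      search = for vT < pBound repeat (candidate ︔ check)
      σ₁ : State
      σ₁ = exec ρ weighEdges σ
      R₁ : Ready σ₁
      R₁ = ready-kept (exec-kept weighEdges ρ σ) refl R
      W₁ = weighEdges-correct σ R c rest cs
      same : ∀ x → cells σ₁ x ≡ cells σ x
      same x = cong (λ f → f x) (cell-kept (exec-kept weighEdges ρ σ) refl)
      P : ℕ → State → Set
      P N σ′ = Sound σ′ × (Found σ₁ → Found σ′) × (∀ T → T < N → Solves (selected wt T) → Found σ′)
      next : ∀ N σ′ → N < S → Kept search σ₁ σ′ → P N σ′ → P (suc N) (exec ρ (candidate ︔ check) (setVar vT N σ′))
      next N σ′ N<S K (snd′ , fnd , hit) =
          proj₁ (proj₂ C₃) (sound-≗ σ′ σ₂ same₂ snd′)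
        , (λ f → proj₂ (proj₂ C₃) (found-≗ σ′ σ₂ same₂ (fnd f)))
        , hit′
        where
        σ₀ σ₂ : State
        σ₀ = setVar vT N σ′
        σ₂ = exec ρ candidate σ₀
        R₀ : Ready σ₀
        R₀ = ready-setVar vT N (ready-kept K refl R₁)
        wt>0 : ∀ e → 0 < wt e
        wt>0 e = ℕ.≤-trans (pow>0 (col e)) (ℕ.m≤n+m (pow (col e)) (weightOf c e))
        same₂ : ∀ x → cells σ₂ x ≡ cells σ′ x
        same₂ x = cong (λ f → f x) (cell-kept (exec-kept candidate ρ σ₀) refl)
        C₃ = check-correct σ₂ (selected wt N) (ready-kept (exec-kept candidate ρ σ₀) refl R₀)
               (candidate-correct σ₀ wt N wt>0 N<S R₀ (weights-kept K refl (proj₁ W₁)) refl)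
        hit′ : ∀ T → T < suc N → Solves (selected wt T) → Found (exec ρ check σ₂)
        hit′ T T<1+N sol with T ≟ N
        ... | yes refl = proj₁ C₃ sol
        ... | no  T≢N  = proj₂ (proj₂ C₃) (found-≗ σ′ σ₂ same₂ (hit T (ℕ.≤∧≢⇒< (ℕ.≤-pred T<1+N) T≢N) sol))
      Pm = for-inv ρ vT pBound _ σ₁ P (sound-≗ σ σ₁ same snd , id , λ _ ()) next

    SomeGood : ∀ {t} → Vec (Vec (Vec Bool b) m) t → Set
    SomeGood []      = ⊥
    SomeGood (c ∷ v) = Good c ⊎ SomeGood v

    trials-correct : ∀ t σ (v : Vec (Vec (Vec Bool b) m) t) → Ready σ → Sound σ →
      coins σ ≡ flatten (flatten Vec.toList) v →
      Outcome σ (exec ρ (trials t) σ) (SomeGood v)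
    trials-correct zero    σ []      R snd cs = outcome R snd id λ ()
    trials-correct (suc t) σ (c ∷ v) R snd cs =
      let O₁ , cs₁ = trial-correct σ c (flatten (flatten Vec.toList) v) R snd cs
          O₂ = trials-correct t (exec ρ trial σ) v (still-ready O₁) (still-sound O₁) cs₁
      in outcome (still-ready O₂) (still-sound O₂) (still-found O₂ ∘ still-found O₁)
           [ still-found O₂ ∘ succeeds O₁ , succeeds O₂ ]′

-- From isolated solutions to successful trials

extend : ∀ {m} {A : Set} → A → (Fin m → A) → ℕ → A
extend {zero}  d f e       = d
extend {suc m} d f zero    = f Fin.zero
extend {suc m} d f (suc e) = extend d (f ∘ Fin.suc) e

extend-toℕ : ∀ {m} {A : Set} (d : A) (f : Fin m → A) i → extend d f (toℕ i) ≡ f i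
extend-toℕ d f Fin.zero    = refl
extend-toℕ d f (Fin.suc i) = extend-toℕ d (f ∘ Fin.suc) i

extend-fromℕ< : ∀ {m} {A : Set} (d : A) (f : Fin m → A) {e} (p : e < m) → extend d f e ≡ f (fromℕ< p)
extend-fromℕ< d f p = trans (cong (extend d f) (sym (Fin.toℕ-fromℕ< p))) (extend-toℕ d f (fromℕ< p))

extend-related : ∀ {m} {A : Set} (P : A → A → Set) d d′ (f f′ : Fin m → A) →
                 P d d′ → (∀ i → P (f i) (f′ i)) → ∀ e → P (extend d f e) (extend d′ f′ e)
extend-related {zero}  P d d′ f f′ p q e       = p
extend-related {suc m} P d d′ f f′ p q zero    = q Fin.zero
extend-related {suc m} P d d′ f f′ p q (suc e) = extend-related P d d′ (f ∘ Fin.suc) (f′ ∘ Fin.suc) p (q ∘ Fin.suc) e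

member : ∀ {m} → Subset m → ℕ → Bool
member M = extend false (Vec.lookup M)

member-tabulate : ∀ {m} (N : ℕ → Bool) e → e < m → member (Vec.tabulate {n = m} (N ∘ toℕ)) e ≡ N e
member-tabulate {m} N e e<m = trans (extend-fromℕ< false _ e<m)
  (trans (Vec.lookup∘tabulate (N ∘ toℕ) (fromℕ< e<m)) (cong N (Fin.toℕ-fromℕ< e<m)))

does-≟ : ∀ {n} (i j : Fin n) → does (i Fin.≟ j) ≡ (toℕ i ≡ᵇ toℕ j)
does-≟ i j with i Fin.≟ j
... | yes refl = sym (≡ᵇ-refl (toℕ i))
... | no  i≢j  = sym (≢⇒≡ᵇ (i≢j ∘ Fin.toℕ-injective))

card : ∀ {m} (p : Fin m → Bool) (q : ℕ → Bool) (M : Subset m) → (∀ i → p i ≡ q (toℕ i)) →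
       ∣ Vec.tabulate p ∩ M ∣ ≡ ∑< m (λ e → bit (member M e) * bit (q e))
card {zero}  p q []      _   = refl
card {suc m} p q (b ∷ M) p≡q = trans (head-term (p Fin.zero) b)
  (trans (cong₂ (λ x y → bit b * bit x + y) (p≡q Fin.zero) (card (p ∘ Fin.suc) (q ∘ suc) M (p≡q ∘ Fin.suc)))
         (sym (∑<-shift m (λ e → bit (member (b ∷ M) e) * bit (q e)))))
  where
  head-term : ∀ x b → ∣ (x ∧ b) ∷ (Vec.tabulate (p ∘ Fin.suc) ∩ M) ∣ ≡
                      bit b * bit x + ∣ Vec.tabulate (p ∘ Fin.suc) ∩ M ∣
  head-term false false = refl
  head-term false true  = refl
  head-term true  false = refl
  head-term true  true  = refl

∑<-≤-const : ∀ m f c → (∀ i → i < m → f i ≤ c) → ∑< m f ≤ m * c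
∑<-≤-const m f c p = ℕ.≤-trans (∑<-mono m p) (ℕ.≤-reflexive (∑<-const m c))

digits : ℕ → ℕ → (ℕ → ℕ) → ℕ
digits B s x = ∑< s (λ i → x i * B ^ i)

digits-< : ∀ B s x → (∀ i → i < s → x i < B) → digits B s x < B ^ s
digits-< B zero    x p = s≤s z≤n
digits-< B (suc s) x p = begin-strict
  digits B s x + x s * B ^ s   <⟨ ℕ.+-monoˡ-< (x s * B ^ s) (digits-< B s x (λ i i<s → p i (ℕ.m<n⇒m<1+n i<s))) ⟩
  suc (x s) * B ^ s            ≤⟨ ℕ.*-monoˡ-≤ (B ^ s) (p s (ℕ.n<1+n s)) ⟩
  B ^ suc s                    ∎
  where open ℕ.≤-Reasoning

digits-injective : ∀ B s x y → (∀ i → i < s → x i < B) → (∀ i → i < s → y i < B) →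
                   digits B s x ≡ digits B s y → ∀ i → i < s → x i ≡ y i
digits-injective B (suc s) x y p q eq i i<1+s =
  let p′ = λ i i<s → p i (ℕ.m<n⇒m<1+n i<s)
      q′ = λ i i<s → q i (ℕ.m<n⇒m<1+n i<s)
      top , low = row-injective (B ^ s) (x s) (y s) (digits-< B s x p′) (digits-< B s y q′)
        (trans (ℕ.+-comm (x s * B ^ s) _) (trans eq (ℕ.+-comm _ (y s * B ^ s))))
  in case i ≟ s of λ
    { (yes refl) → top
    ; (no  i≢s)  → digits-injective B s x y p′ q′ low i (ℕ.≤∧≢⇒< (ℕ.≤-pred i<1+s) i≢s) }

weigh-∑ : ∀ {b m} (c : Vec (Vec Bool b) m) (M : Subset m) (w : ℕ → ℕ) →
  (∀ i → w (toℕ i) ≡ value (Vec.lookup c i)) →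
  weigh value c M ≡ ∑< m (λ e → bit (member M e) * w e)
weigh-∑ []      []      w p = refl
weigh-∑ {m = suc m} (x ∷ c) (b ∷ M) w p = trans
  (cong₂ (λ y z → bit b * y + z) (sym (p Fin.zero)) (weigh-∑ c M (w ∘ suc) (p ∘ Fin.suc)))
  (sym (∑<-shift m (λ e → bit (member (b ∷ M) e) * w e)))

module Encoding {s n : ℕ} (I : Instance s n) (l b : ℕ) where
  open Instance I

  srcℕ tgtℕ colℕ needℕ powℕ : ℕ → ℕ
  -- The default ends 0 and 1 differ, so the indices beyond the last edge are loopless too.
  srcℕ  = extend 0 (toℕ ∘ src)
  tgtℕ  = extend 1 (toℕ ∘ tgt)
  colℕ  = extend 0 (toℕ ∘ c)
  needℕ = extend 0 k
  powℕ i = suc (m * 2 ^ b) * suc m ^ i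

  -- With D = `suc (m * 2 ^ b)`, the random part of a weight is below D and the colour part is D
  -- times a number of s digits in base m + 1; hence every weight is below D (m + 1)^s.
  bound : ℕ
  bound = suc (m * 2 ^ b) * suc m ^ s

  ρ : Params
  ρ = contents (l ∷ n ∷ s ∷ m ∷ b ∷ bound ∷ [])

  src<n : ∀ e → e < m → srcℕ e < n
  src<n e e<m = subst (_< n) (sym (extend-fromℕ< 0 (toℕ ∘ src) e<m)) (Fin.toℕ<n (src (fromℕ< e<m)))

  tgt<n : ∀ e → e < m → tgtℕ e < n
  tgt<n e e<m = subst (_< n) (sym (extend-fromℕ< 1 (toℕ ∘ tgt) e<m)) (Fin.toℕ<n (tgt (fromℕ< e<m)))

  col<s : ∀ e → e < m → colℕ e < s
  col<s e e<m = subst (_< s) (sym (extend-fromℕ< 0 (toℕ ∘ c) e<m)) (Fin.toℕ<n (c (fromℕ< e<m)))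

  loopless : ∀ e → srcℕ e ≢ tgtℕ e
  loopless = extend-related _≢_ 0 1 (toℕ ∘ src) (toℕ ∘ tgt) (λ ()) (λ i → ℕ.<⇒≢ (src<tgt i))

  pow>0 : ∀ i → 0 < powℕ i
  pow>0 i = ℕ.≤-trans (ℕ.m^n>0 (suc m) i) (ℕ.m≤m+n (suc m ^ i) _)

  open Search ρ srcℕ tgtℕ colℕ needℕ powℕ src<n tgt<n col<s loopless pow>0
    hiding (n; s; m; b) public

  bit-∨ : ∀ p q → (p ≡ true → q ≡ true → ⊥) → bit (p ∨ q) ≡ bit p + bit q
  bit-∨ false q     _ = refl
  bit-∨ true  false _ = refl
  bit-∨ true  true  f = contradiction refl (f refl)

  -- Incidence is a disjunction on one side and a sum of two bits on the other; they agree because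
  -- no edge has both ends at v.
  degree-card : ∀ M v → ∣ δ v ∩ M ∣ ≡ degree (member M) m (toℕ v)
  degree-card M v = trans
    (card (λ e → does ((src e Fin.≟ v) ⊎-dec (tgt e Fin.≟ v)))
      (λ e → (srcℕ e ≡ᵇ toℕ v) ∨ (tgtℕ e ≡ᵇ toℕ v)) M
      (λ i → cong₂ _∨_
        (trans (does-≟ (src i) v) (cong (_≡ᵇ toℕ v) (sym (extend-toℕ 0 (toℕ ∘ src) i))))
        (trans (does-≟ (tgt i) v) (cong (_≡ᵇ toℕ v) (sym (extend-toℕ 1 (toℕ ∘ tgt) i))))))
    (∑<-cong m λ e _ → cong (bit (member M e) *_)
      (bit-∨ (srcℕ e ≡ᵇ toℕ v) (tgtℕ e ≡ᵇ toℕ v) λ p q →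
        loopless e (trans (≡ᵇ-true (srcℕ e) (toℕ v) p) (sym (≡ᵇ-true (tgtℕ e) (toℕ v) q)))))

  colours-card : ∀ M i → ∣ c⁻¹ i ∩ M ∣ ≡ colours (member M) m (toℕ i)
  colours-card M i = card (λ e → does (c e Fin.≟ i)) (λ e → colℕ e ≡ᵇ toℕ i) M
    (λ e → trans (does-≟ (c e) i) (cong (_≡ᵇ toℕ i) (sym (extend-toℕ 0 (toℕ ∘ c) e))))

  solution⇒solves : ∀ M → IsSolution M → Solves (member M)
  solution⇒solves M (perfect , coloured) =
    (λ v v<n → trans (cong (degree (member M) m) (sym (Fin.toℕ-fromℕ< v<n)))
      (trans (sym (degree-card M (fromℕ< v<n))) (perfect (fromℕ< v<n)))) ,
    (λ i i<s → trans (cong (colours (member M) m) (sym (Fin.toℕ-fromℕ< i<s)))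
      (trans (sym (colours-card M (fromℕ< i<s)))
        (trans (coloured (fromℕ< i<s)) (sym (extend-fromℕ< 0 k i<s)))))

  solves⇒solution : ∀ M → Solves (member M) → IsSolution M
  solves⇒solution M (deg , cols) =
    (λ v → trans (degree-card M v) (deg (toℕ v) (Fin.toℕ<n v))) ,
    (λ i → trans (colours-card M i) (trans (cols (toℕ i) (Fin.toℕ<n i)) (extend-toℕ 0 k i)))

  solves-cong : ∀ {M N} → (∀ e → e < m → M e ≡ N e) → Solves M → Solves N
  solves-cong p (deg , cols) =
    (λ v v<n → trans (∑<-cong m λ e e<m →
      cong (λ b → bit b * (bit (srcℕ e ≡ᵇ v) + bit (tgtℕ e ≡ᵇ v))) (sym (p e e<m))) (deg v v<n)) ,
    (λ i i<s → trans (∑<-cong m λ e e<m → cong (λ b → bit b * bit (colℕ e ≡ᵇ i)) (sym (p e e<m))) (cols i i<s))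

  edgeSet : (ℕ → Bool) → EdgeSet
  edgeSet N = Vec.tabulate (N ∘ toℕ)

  solves⇒edgeSet : ∀ N → Solves N → IsSolution (edgeSet N)
  solves⇒edgeSet N sol = solves⇒solution (edgeSet N)
    (solves-cong (λ e e<m → sym (member-tabulate N e e<m)) sol)

  -- Both sides are twice the number of edges, counted by ends and by colours. Equal colour counts
  -- thus force equal degree sums.
  handshake : ∀ M → ∑< n (degree M m) ≡ 2 * ∑< s (colours M m)
  handshake M = begin
    ∑< n (λ v → ∑< m (λ e → bit (M e) * (bit (srcℕ e ≡ᵇ v) + bit (tgtℕ e ≡ᵇ v))))
      ≡⟨ ∑<-swap n m (λ v e → bit (M e) * (bit (srcℕ e ≡ᵇ v) + bit (tgtℕ e ≡ᵇ v))) ⟩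
    ∑< m (λ e → ∑< n (λ v → bit (M e) * (bit (srcℕ e ≡ᵇ v) + bit (tgtℕ e ≡ᵇ v))))
      ≡⟨ ∑<-cong m (λ e e<m → trans (∑<-* n (bit (M e)) _) (cong (bit (M e) *_)
           (trans (∑<-+ n _ _) (cong₂ _+_ (ends (srcℕ e) n (src<n e e<m)) (ends (tgtℕ e) n (tgt<n e e<m)))))) ⟩
    ∑< m (λ e → bit (M e) * 2)
      ≡⟨ ∑<-cong m (λ e e<m → trans (ℕ.*-comm (bit (M e)) 2) (cong (2 *_)
           (sym (trans (∑<-* s (bit (M e)) _) (trans (cong (bit (M e) *_) (ends (colℕ e) s (col<s e e<m)))
             (ℕ.*-identityʳ (bit (M e)))))))) ⟩
    ∑< m (λ e → 2 * ∑< s (λ i → bit (M e) * bit (colℕ e ≡ᵇ i)))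
      ≡⟨ ∑<-* m 2 _ ⟩
    2 * ∑< m (λ e → ∑< s (λ i → bit (M e) * bit (colℕ e ≡ᵇ i)))
      ≡⟨ cong (2 *_) (∑<-swap m s (λ e i → bit (M e) * bit (colℕ e ≡ᵇ i))) ⟩
    2 * ∑< s (colours M m) ∎
    where
    open ≡-Reasoning
    ends : ∀ a n → a < n → ∑< n (λ v → bit (a ≡ᵇ v)) ≡ 1
    ends a n a<n = trans (∑<-cong n (λ v _ → sym (ℕ.*-identityʳ _))) (∑<-delta n a a<n (λ _ → 1))

  module _ (c : Vec (Vec Bool b) m) where
    open Weighted srcℕ tgtℕ (fullWeight c) using (weight; matchingIn; module MatchingIn; MatchingIn)

    light : (ℕ → Bool) → ℕ
    light M = ∑< m (λ e → bit (M e) * weightOf c e)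

    bit*≤ : ∀ b x → bit b * x ≤ x
    bit*≤ b x = ℕ.≤-trans (ℕ.*-monoˡ-≤ x (bit≤1 b)) (ℕ.≤-reflexive (ℕ.*-identityˡ x))

    light-< : ∀ M → light M < suc (m * 2 ^ b)
    light-< M = s≤s (∑<-≤-const m _ (2 ^ b) λ e _ →
      ℕ.≤-trans (bit*≤ (M e) (weightOf c e)) (ℕ.<⇒≤ (weightOf-≤ c e)))

    colours-< : ∀ M i → i < s → colours M m i < suc m
    colours-< M i _ = s≤s (ℕ.≤-trans (∑<-≤-const m _ 1 λ e _ →
      ℕ.*-mono-≤ (bit≤1 (M e)) (bit≤1 (colℕ e ≡ᵇ i))) (ℕ.≤-reflexive (ℕ.*-identityʳ m)))

    -- A division with remainder by `suc (m * 2 ^ b)`: the remainder is the random weight, and the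
    -- quotient has the colour counts as its digits in base m + 1.
    weight-≡ : ∀ M → weight M m ≡ digits (suc m) s (colours M m) * suc (m * 2 ^ b) + light M
    weight-≡ M = begin
      ∑< m (λ e → bit (M e) * (weightOf c e + powℕ (colℕ e)))
        ≡⟨ ∑<-cong m (λ e _ → trans (ℕ.*-distribˡ-+ (bit (M e)) (weightOf c e) (powℕ (colℕ e))) (ℕ.+-comm (bit (M e) * weightOf c e) _)) ⟩
      ∑< m (λ e → bit (M e) * (D * suc m ^ colℕ e) + bit (M e) * weightOf c e)
        ≡⟨ ∑<-+ m _ _ ⟩
      ∑< m (λ e → bit (M e) * (D * suc m ^ colℕ e)) + light M
        ≡⟨ cong (_+ light M) heavy ⟩
      digits (suc m) s (colours M m) * D + light M ∎
      where
      open ≡-Reasoning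
      D : ℕ
      D = suc (m * 2 ^ b)
      swap : ∀ x y z → x * (y * z) ≡ y * (x * z)
      swap = solve 3 (λ x y z → x :* (y :* z) := y :* (x :* z)) refl
        where open +-*-Solver
      heavy : ∑< m (λ e → bit (M e) * (D * suc m ^ colℕ e)) ≡ digits (suc m) s (colours M m) * D
      heavy = begin
        ∑< m (λ e → bit (M e) * (D * suc m ^ colℕ e))
          ≡⟨ ∑<-cong m (λ e _ → swap (bit (M e)) D _) ⟩
        ∑< m (λ e → D * (bit (M e) * suc m ^ colℕ e))
          ≡⟨ ∑<-* m D _ ⟩
        D * ∑< m (λ e → bit (M e) * suc m ^ colℕ e)
          ≡⟨ cong (D *_) (∑<-cong m (λ e e<m → trans
               (cong (bit (M e) *_) (sym (∑<-delta s (colℕ e) (col<s e e<m) (suc m ^_))))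
               (sym (∑<-* s (bit (M e)) _)))) ⟩
        D * ∑< m (λ e → ∑< s (λ i → bit (M e) * (bit (colℕ e ≡ᵇ i) * suc m ^ i)))
          ≡⟨ cong (D *_) (∑<-swap m s _) ⟩
        D * ∑< s (λ i → ∑< m (λ e → bit (M e) * (bit (colℕ e ≡ᵇ i) * suc m ^ i)))
          ≡⟨ cong (D *_) (∑<-cong s (λ i _ → trans
               (∑<-cong m (λ e _ → trans (sym (ℕ.*-assoc (bit (M e)) (bit (colℕ e ≡ᵇ i)) (suc m ^ i)))
                 (ℕ.*-comm (bit (M e) * bit (colℕ e ≡ᵇ i)) (suc m ^ i))))
               (trans (∑<-* m (suc m ^ i) _) (ℕ.*-comm (suc m ^ i) _)))) ⟩
        D * digits (suc m) s (colours M m)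
          ≡⟨ ℕ.*-comm D _ ⟩
        digits (suc m) s (colours M m) * D ∎

    weight-< : ∀ M → weight M m < bound
    weight-< M = begin-strict
      weight M m
        ≡⟨ weight-≡ M ⟩
      digits (suc m) s (colours M m) * suc (m * 2 ^ b) + light M
        <⟨ ℕ.+-monoʳ-< (digits (suc m) s (colours M m) * suc (m * 2 ^ b)) (light-< M) ⟩
      digits (suc m) s (colours M m) * suc (m * 2 ^ b) + suc (m * 2 ^ b)
        ≡⟨ ℕ.+-comm _ (suc (m * 2 ^ b)) ⟩
      suc (digits (suc m) s (colours M m)) * suc (m * 2 ^ b)
        ≤⟨ ℕ.*-monoˡ-≤ (suc (m * 2 ^ b)) (digits-< (suc m) s _ (colours-< M)) ⟩
      suc m ^ s * suc (m * 2 ^ b)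
        ≡⟨ ℕ.*-comm (suc m ^ s) _ ⟩
      bound ∎
      where open ℕ.≤-Reasoning

    decode : ∀ M N → weight N m ≡ weight M m →
             light N ≡ light M × (∀ i → i < s → colours N m i ≡ colours M m i)
    decode M N eq =
      let heavy , light≡ = row-injective (suc (m * 2 ^ b)) _ _ (light-< N) (light-< M)
            (trans (sym (weight-≡ N)) (trans eq (weight-≡ M)))
      in light≡ , digits-injective (suc m) s _ _ (colours-< N) (colours-< M) heavy

    -- A matching with the colours of a solution has as many edges, hence is perfect.
    same-weight : ∀ M N → Solves M → MatchingIn (λ _ → true) m (below n) (weight M m) N →
                  Solves N × light N ≡ light M
    same-weight M N (deg , cols) q =
      let light≡ , cols≡ = decode M N (MatchingIn.weighs q) in
      ((λ v v<n → trans (∑<-≤-eq n (degree N m) (degree M m)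
            (λ v v<n → ℕ.≤-trans (MatchingIn.degrees q v)
              (ℕ.≤-trans (bit≤1 (below n v)) (ℕ.≤-reflexive (sym (deg v v<n)))))
            (trans (handshake N) (trans (cong (2 *_) (∑<-cong s cols≡)) (sym (handshake M)))) v v<n)
          (deg v v<n)) ,
       (λ i i<s → trans (cols≡ i i<s) (cols i i<s))) , light≡

    solves⇒matching : ∀ M → Solves M → MatchingIn (λ _ → true) m (below n) (weight M m) M
    solves⇒matching M (deg , _) = matchingIn within (λ _ _ _ → refl) refl
      where
      within : ∀ v → degree M m v ≤ bit (below n v)
      within v with v <? n
      ... | yes v<n rewrite <⇒<ᵇ-true v<n = ℕ.≤-reflexive (deg v v<n)
      ... | no  v≮n rewrite ≮⇒<ᵇ-false v≮n = ℕ.≤-reflexive (∑<-zeros m _ λ e e<m →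
        trans (cong₂ (λ x y → bit (M e) * (bit x + bit y))
          (≢⇒≡ᵇ {srcℕ e} {v} (λ { refl → v≮n (src<n e e<m) }))
          (≢⇒≡ᵇ {tgtℕ e} {v} (λ { refl → v≮n (tgt<n e e<m) })))
          (ℕ.*-zeroʳ (bit (M e))))

    weightOf-toℕ : ∀ {a m} (c : Vec (Vec Bool a) m) i → weightOf c (toℕ i) ≡ value (Vec.lookup c i)
    weightOf-toℕ (x ∷ c) Fin.zero    = refl
    weightOf-toℕ (x ∷ c) (Fin.suc i) = weightOf-toℕ c i

  open Isolation {A = Vec Bool b} value value-injective {m = m} {F = IsSolution} IsSolution? public

  module _ (m≤l : m ≤ l) where
    open Publishing m≤l

    -- Isolation compares M with solutions only. By `same-weight` every matching of the full weight
    -- of M is itself a solution and has the same random weight, so it equals M, and the parities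
    -- spell out M.
    isolated⇒good : ∀ c → Isolated c → Good c
    isolated⇒good c (M , sol , unique) =
        weight M′ m , weight-< c M′ , solves-cong (λ d d<m → sym (read d d<m)) (solution⇒solves M sol)
      where
      open Weighted srcℕ tgtℕ (fullWeight c) using (weight; MatchingIn; μ-others)
      M′ : ℕ → Bool
      M′ = member M
      only : ∀ N → MatchingIn (λ _ → true) m (below n) (weight M′ m) N → ∀ e → e < m → N e ≡ M′ e
      only N q e e<m =
        let solN , light≡ = same-weight c M′ N (solution⇒solves M sol) q
            eq = trans (weigh-∑ c (edgeSet N) (weightOf c) (weightOf-toℕ c c))
                 (trans (∑<-cong m (λ e e<m → cong (λ b → bit b * weightOf c e) (member-tabulate N e e<m)))
                 (trans light≡ (sym (weigh-∑ c M (weightOf c) (weightOf-toℕ c c)))))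
        in trans (sym (member-tabulate N e e<m)) (cong (λ X → member X e) (unique (edgeSet N) (solves⇒edgeSet N solN) eq))
      read : ∀ d → d < m → selected (fullWeight c) (weight M′ m) d ≡ M′ d
      read d d<m = trans (cong not (μ-others loopless m (below n) (weight M′ m) M′
        (solves⇒matching c M′ (solution⇒solves M sol)) only d d<m)) (Bool.not-involutive (M′ d))

-- Reading the input

prelude : Program
prelude =
  tmpR 0 ≔const 0 ⨾ parR pN ≔mem[ tmpR 0 ] ⨾
  tmpR 0 ≔const 1 ⨾ parR pS ≔mem[ tmpR 0 ] ⨾
  tmpR 0 ≔const 2 ⨾ parR pM ≔mem[ tmpR 0 ] ⨾
  -- `tmpR 0` still holds 2. The input occupies 3 + s + 3m cells, so its last address is 2 + s + 3m.
  parR 0 ≔ tmpR 0 ⊕ parR pS ⨾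
  parR 0 ≔ parR 0 ⊕ parR pM ⨾
  parR 0 ≔ parR 0 ⊕ parR pM ⨾
  parR 0 ≔ parR 0 ⊕ parR pM

readEdges readNeeds chooseBits scale multiply setup offsets : Cmd
readEdges =
    vp ↤ lit 3 ⊞ par pS
  ︔ for vE < pM repeat
      ( SRC ⟨ var vE ⟩↤ inp (var vp)
      ︔ TGT ⟨ var vE ⟩↤ inp (lit 1 ⊞ var vp)
      ︔ COL ⟨ var vE ⟩↤ inp (lit 2 ⊞ var vp)
      ︔ vp ↤ lit 3 ⊞ var vp )
readNeeds = for vI < pS repeat (NEED ⟨ var vI ⟩↤ inp (lit 3 ⊞ var vI))
chooseBits =
    vR ↤ lit 1
  ︔ vb ↤ lit 0
  ︔ for vE < pM repeat
      ( vb ↤ (par pM ⊞ par pM ⊟ var vR) ¿ lit 1 ⊞ var vb ∶ var vb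
      ︔ vR ↤ (par pM ⊞ par pM ⊟ var vR) ¿ var vR ⊞ var vR ∶ var vR )
-- Started with `vq` equal to `vS`, the m additions multiply `vS` by m + 1.
multiply = for vE < pM repeat (vS ↤ var vq ⊞ var vS)
scale =
    vS ↤ lit 1
  ︔ for vE < pM repeat (vS ↤ var vR ⊞ var vS)
  ︔ for vI < pS repeat
      ( POW ⟨ var vI ⟩↤ var vS
      ︔ vq ↤ var vS
      ︔ multiply )
-- Cell 0 held n, which has been copied; cleared, it is the answer that there is no solution, valid
-- until a check succeeds.
setup = readEdges ︔ readNeeds ︔ inp⟨ lit 0 ⟩↤ lit 0 ︔ chooseBits ︔ scale
offsets =
    vp ↤ lit 0
  ︔ for vV < pN repeat
      ( OFF ⟨ var vV ⟩↤ var vp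
      ︔ vp ↤ par pBound ⊞ var vp )

-- The least b with q ≤ 2 ^ b, if N is large enough.
bits : ℕ → ℕ → ℕ
bits q zero    = 0
bits q (suc N) = choose (q ∸ 2 ^ bits q N) (suc (bits q N)) (bits q N)

bits-≤ : ∀ q N → bits q N ≤ N
bits-≤ q zero    = z≤n
bits-≤ q (suc N) with q ∸ 2 ^ bits q N
... | zero  = ℕ.m≤n⇒m≤1+n (bits-≤ q N)
... | suc _ = s≤s (bits-≤ q N)

-- Doubling happens only while the power is below q, so it ends at most at 2q; the successor covers
-- q = 0. This keeps the random weights polynomial in m.
2^bits-≤ : ∀ q N → 2 ^ bits q N ≤ suc (q + q)
2^bits-≤ q zero    = s≤s z≤n
2^bits-≤ q (suc N) with q ∸ 2 ^ bits q N in eq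
... | zero  = 2^bits-≤ q N
... | suc _ = ℕ.m≤n⇒m≤1+n (ℕ.+-mono-≤ small (ℕ.≤-trans (ℕ.≤-reflexive (ℕ.+-identityʳ _)) small))
  where
  small : 2 ^ bits q N ≤ q
  small = ℕ.≰⇒≥ λ q≤ → contradiction (trans (sym eq) (ℕ.m≤n⇒m∸n≡0 q≤)) λ ()

2^bits-≥ : ∀ q N → q ≤ 2 ^ bits q N ⊎ bits q N ≡ N
2^bits-≥ q zero    = inj₂ refl
2^bits-≥ q (suc N) with q ∸ 2 ^ bits q N in eq
... | zero  = inj₁ (ℕ.m∸n≡0⇒m≤n eq)
... | suc _ with 2^bits-≥ q N
...   | inj₁ q≤ = contradiction (trans (sym eq) (ℕ.m≤n⇒m∸n≡0 q≤)) λ ()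
...   | inj₂ b≡ = inj₂ (cong suc b≡)

n<2^n : ∀ n → n < 2 ^ n
n<2^n zero    = s≤s z≤n
n<2^n (suc n) = begin-strict
  suc n              ≤⟨ n<2^n n ⟩
  2 ^ n              <⟨ ℕ.m<m+n (2 ^ n) (ℕ.≤-trans (s≤s z≤n) (n<2^n n)) ⟩
  2 ^ n + 2 ^ n      ≡⟨ cong (2 ^ n +_) (sym (ℕ.+-identityʳ _)) ⟩
  2 ^ suc n          ∎
  where open ℕ.≤-Reasoning

-- Either the doubling stopped because 2m was reached, or it took place in all m rounds, and 2m is
-- at most 2^m.
bits-enough : ∀ m → m + m ≤ 2 ^ bits (m + m) m
bits-enough m with 2^bits-≥ (m + m) m
... | inj₁ p = p
... | inj₂ p = subst (λ b → m + m ≤ 2 ^ b) (sym p) (double≤ m)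
  where
  double≤ : ∀ m → m + m ≤ 2 ^ m
  double≤ zero    = z≤n
  double≤ (suc m) = ℕ.+-mono-≤ (n<2^n m) (ℕ.≤-trans (n<2^n m) (ℕ.≤-reflexive (sym (ℕ.+-identityʳ _))))

contents-++ˡ : ∀ {s} (f : Fin s → ℕ) xs i → i < s → contents (List.tabulate f List.++ xs) i ≡ extend 0 f i
contents-++ˡ {suc s} f xs zero    _       = refl
contents-++ˡ {suc s} f xs (suc i) (s≤s p) = contents-++ˡ (f ∘ Fin.suc) xs i p

contents-++ʳ : ∀ {s} (f : Fin s → ℕ) xs i → contents (List.tabulate f List.++ xs) (s + i) ≡ contents xs i
contents-++ʳ {zero}  f xs i = refl
contents-++ʳ {suc s} f xs i = contents-++ʳ (f ∘ Fin.suc) xs i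

triples : ∀ {m} (f g h : Fin m → ℕ) → List ℕ
triples f g h = List.concat (List.tabulate λ e → f e ∷ g e ∷ h e ∷ [])

contents-triples : ∀ {m} (f g h : Fin m → ℕ) d e → e < m →
  contents (triples f g h) (e * 3) ≡ extend 0 f e ×
  contents (triples f g h) (suc (e * 3)) ≡ extend d g e ×
  contents (triples f g h) (suc (suc (e * 3))) ≡ extend 0 h e
contents-triples {suc m} f g h d zero    _       = refl , refl , refl
contents-triples {suc m} f g h d (suc e) (s≤s p) = contents-triples (f ∘ Fin.suc) (g ∘ Fin.suc) (h ∘ Fin.suc) d e p

module Initialisation {s n : ℕ} (I : Instance s n) where
  open Instance I

  l b : ℕ
  l = 2 + s + m + m + m
  b = bits (m + m) m

  open Encoding I l b public

  m≤l : m ≤ l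
  m≤l = ℕ.m≤n+m m (2 + s + m + m)

  -- The parameters during setup, when the number of bits and the weight bound are not yet known and
  -- read as 0.
  ρ₀ : Params
  ρ₀ = contents (l ∷ n ∷ s ∷ m ∷ [])

  Reading : State → Set
  Reading h = cells h ≡ contents (input I)

  edge-address : ∀ N → N < m → 3 + s + N * 3 + 2 ≤ l
  edge-address N N<m = begin
    3 + s + N * 3 + 2     ≡⟨ solve 2 (λ s x → con 3 :+ s :+ x :+ con 2 := con 2 :+ s :+ (con 3 :+ x)) refl s (N * 3) ⟩
    2 + s + suc N * 3     ≤⟨ ℕ.+-monoʳ-≤ (2 + s) (ℕ.*-monoˡ-≤ 3 N<m) ⟩
    2 + s + m * 3         ≡⟨ solve 2 (λ s m → con 2 :+ s :+ m :* con 3 := con 2 :+ s :+ m :+ m :+ m) refl s m ⟩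
    l                     ∎
    where
    open ℕ.≤-Reasoning
    open +-*-Solver

  Edges : ℕ → State → Set
  Edges N h = ∀ e → e < N → arrs h SRC e ≡ srcℕ e × arrs h TGT e ≡ tgtℕ e × arrs h COL e ≡ colℕ e

  readEdges-correct : ∀ h → Reading h → Edges m (exec ρ₀ readEdges h)
  readEdges-correct h R = proj₁ (for-inv ρ₀ vE pM _ h₁ P ((λ _ ()) , sym (ℕ.+-identityʳ (3 + s))) next)
    where
    h₁ : State
    h₁ = setVar vp (3 + s) h
    body : Cmd
    body = SRC ⟨ var vE ⟩↤ inp (var vp) ︔ TGT ⟨ var vE ⟩↤ inp (lit 1 ⊞ var vp)
         ︔ COL ⟨ var vE ⟩↤ inp (lit 2 ⊞ var vp) ︔ vp ↤ lit 3 ⊞ var vp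
    P : ℕ → State → Set
    P N h′ = Edges N h′ × vars h′ vp ≡ 3 + s + N * 3
    next : ∀ N h′ → N < m → Kept (for vE < pM repeat body) h₁ h′ → P N h′ → P (suc N) (exec ρ₀ body (setVar vE N h′))
    next N h′ N<m K (E , p≡) = edges , trans (cong (3 +_) p≡)
        (solve 2 (λ s x → con 3 :+ (con 3 :+ s :+ x) := con 3 :+ s :+ (con 3 :+ x)) refl s (N * 3))
      where
      open +-*-Solver
      at : ∀ i → i ≤ 2 → cells h′ (clamp ρ₀ (i + vars h′ vp)) ≡ contents (triples (toℕ ∘ src) (toℕ ∘ tgt) (toℕ ∘ c)) (i + N * 3)
      at i i≤2 = begin
        cells h′ (clamp ρ₀ (i + vars h′ vp))
          ≡⟨ cong (cells h′) (clamp-≡ ρ₀ (i + vars h′ vp) (ℕ.≤-trans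
               (ℕ.≤-reflexive (trans (cong (i +_) p≡) (ℕ.+-comm i _)))
               (ℕ.≤-trans (ℕ.+-monoʳ-≤ (3 + s + N * 3) i≤2) (edge-address N N<m)))) ⟩
        cells h′ (i + vars h′ vp)
          ≡⟨ cong₂ (λ f x → f x) (trans (cell-kept K refl) R) (trans (cong (i +_) p≡)
               (solve 3 (λ i s x → i :+ (con 3 :+ s :+ x) := con 3 :+ (s :+ (i :+ x))) refl i s (N * 3))) ⟩
        contents (input I) (3 + (s + (i + N * 3)))
          ≡⟨ contents-++ʳ k (triples (toℕ ∘ src) (toℕ ∘ tgt) (toℕ ∘ c)) (i + N * 3) ⟩
        contents (triples (toℕ ∘ src) (toℕ ∘ tgt) (toℕ ∘ c)) (i + N * 3) ∎
        where open ≡-Reasoning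
      vals = contents-triples (toℕ ∘ src) (toℕ ∘ tgt) (toℕ ∘ c) 1 N N<m
      written : ∀ (f : ℕ → ℕ) x (g : ℕ → ℕ) → x ≡ g N → (∀ e → e < N → f e ≡ g e) → ∀ e → e < suc N → (f [ N ↦ x ]) e ≡ g e
      written f x g x≡ p e e<1+N with e ≟ N
      ... | yes refl = trans (↦-same f e x) x≡
      ... | no  e≢N  = trans (↦-other f x e≢N) (p e (ℕ.≤∧≢⇒< (ℕ.≤-pred e<1+N) e≢N))
      edges : Edges (suc N) (exec ρ₀ body (setVar vE N h′))
      edges e e<1+N =
          written (arrs h′ SRC) _ srcℕ (trans (at 0 z≤n) (proj₁ vals)) (λ e q → proj₁ (E e q)) e e<1+N
        , written (arrs h′ TGT) _ tgtℕ (trans (at 1 (s≤s z≤n)) (proj₁ (proj₂ vals))) (λ e q → proj₁ (proj₂ (E e q))) e e<1+N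
        , written (arrs h′ COL) _ colℕ (trans (at 2 (s≤s (s≤s z≤n))) (proj₂ (proj₂ vals))) (λ e q → proj₂ (proj₂ (E e q))) e e<1+N

  readNeeds-correct : ∀ h → Reading h → ∀ i → i < s → arrs (exec ρ₀ readNeeds h) NEED i ≡ needℕ i
  readNeeds-correct h R = for-inv ρ₀ vI pS _ h (λ N h′ → ∀ i → i < N → arrs h′ NEED i ≡ needℕ i) (λ _ ()) next
    where
    next : ∀ N h′ → N < s → Kept readNeeds h h′ → (∀ i → i < N → arrs h′ NEED i ≡ needℕ i) →
           ∀ i → i < suc N → (arrs h′ NEED [ N ↦ cells h′ (clamp ρ₀ (3 + N)) ]) i ≡ needℕ i
    next N h′ N<s K p i i<1+N with i ≟ N
    ... | no  i≢N  = trans (↦-other (arrs h′ NEED) _ i≢N) (p i (ℕ.≤∧≢⇒< (ℕ.≤-pred i<1+N) i≢N))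
    ... | yes refl = trans (↦-same (arrs h′ NEED) i _) (trans (cong (cells h′) (clamp-≡ ρ₀ (3 + i) (in-range)))
        (trans (cong (λ f → f (3 + i)) (trans (cell-kept K refl) R)) (contents-++ˡ k _ i N<s)))
      where
      in-range : 3 + i ≤ l
      in-range = ℕ.≤-trans (s≤s (s≤s N<s)) (ℕ.≤-trans (ℕ.m≤m+n (2 + s) m)
        (ℕ.≤-trans (ℕ.m≤m+n (2 + s + m) m) (ℕ.m≤m+n (2 + s + m + m) m)))

  chooseBits-correct : ∀ h → vars (exec ρ₀ chooseBits h) vb ≡ b × vars (exec ρ₀ chooseBits h) vR ≡ 2 ^ b
  chooseBits-correct h = for-inv ρ₀ vE pM _ h₁ P (refl , refl) next
    where
    h₁ : State
    h₁ = setVar vb 0 (setVar vR 1 h)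
    body : Cmd
    body = vb ↤ (par pM ⊞ par pM ⊟ var vR) ¿ lit 1 ⊞ var vb ∶ var vb
         ︔ vR ↤ (par pM ⊞ par pM ⊟ var vR) ¿ var vR ⊞ var vR ∶ var vR
    P : ℕ → State → Set
    P N h′ = vars h′ vb ≡ bits (m + m) N × vars h′ vR ≡ 2 ^ bits (m + m) N
    next : ∀ N h′ → N < m → Kept (for vE < pM repeat body) h₁ h′ → P N h′ → P (suc N) (exec ρ₀ body (setVar vE N h′))
    next N h′ _ _ (p , q) =
        cong₂ (λ x y → choose (m + m ∸ x) (suc y) y) q p
      , trans (cong (λ x → choose (m + m ∸ x) (x + x) x) q) (power (m + m ∸ 2 ^ bits (m + m) N) (bits (m + m) N))
      where
      power : ∀ x b → choose x (2 ^ b + 2 ^ b) (2 ^ b) ≡ 2 ^ choose x (suc b) b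
      power zero    b = refl
      power (suc x) b = cong (2 ^ b +_) (sym (ℕ.+-identityʳ (2 ^ b)))

  multiply-correct : ∀ ρ h → vars (exec ρ multiply h) vS ≡ ρ pM * vars h vq + vars h vS
  multiply-correct ρ h = for-inv ρ vE pM _ h (λ N h′ → vars h′ vS ≡ N * vars h vq + vars h vS) refl
    λ N h′ _ K p → trans (cong₂ _+_ (var-unset K vq refl) p) (sym (ℕ.+-assoc (vars h vq) _ _))

  scale-correct : ∀ h → vars h vR ≡ 2 ^ b →
    (∀ i → i < s → arrs (exec ρ₀ scale h) POW i ≡ powℕ i) × vars (exec ρ₀ scale h) vS ≡ bound
  scale-correct h R≡ = for-inv ρ₀ vI pS _ h₂ P ((λ _ ()) , trans D≡ (sym (ℕ.*-identityʳ _))) next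
    where
    D : ℕ
    D = suc (m * 2 ^ b)
    loop₁ body : Cmd
    loop₁ = for vE < pM repeat (vS ↤ var vR ⊞ var vS)
    body = POW ⟨ var vI ⟩↤ var vS ︔ vq ↤ var vS ︔ multiply
    h₁ h₂ : State
    h₁ = setVar vS 1 h
    h₂ = exec ρ₀ loop₁ h₁
    D≡ : vars h₂ vS ≡ D
    D≡ = trans (for-inv ρ₀ vE pM _ h₁ (λ N h′ → vars h′ vS ≡ N * 2 ^ b + 1) refl
      (λ N h′ _ K p → trans (cong₂ _+_ (trans (var-unset K vR refl) R≡) p) (sym (ℕ.+-assoc (2 ^ b) _ 1))))
      (ℕ.+-comm (m * 2 ^ b) 1)
    P : ℕ → State → Set
    P N h′ = (∀ i → i < N → arrs h′ POW i ≡ powℕ i) × vars h′ vS ≡ D * suc m ^ N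
    next : ∀ N h′ → N < s → Kept (for vI < pS repeat body) h₂ h′ → P N h′ → P (suc N) (exec ρ₀ body (setVar vI N h′))
    next N h′ N<s K (p , q) = pow′ , trans (multiply-correct ρ₀ h₃) (trans (cong (λ x → m * x + x) q)
        (solve 3 (λ m d x → m :* (d :* x) :+ d :* x := d :* ((con 1 :+ m) :* x)) refl m D (suc m ^ N)))
      where
      open +-*-Solver
      h₃ : State
      h₃ = exec ρ₀ (POW ⟨ var vI ⟩↤ var vS ︔ vq ↤ var vS) (setVar vI N h′)
      pow′ : ∀ i → i < suc N → arrs (exec ρ₀ multiply h₃) POW i ≡ powℕ i
      pow′ i i<1+N = trans (cong (λ f → f i) (arr-kept (exec-kept multiply ρ₀ h₃) POW refl)) (updated (i ≟ N))
        where
        updated : Dec (i ≡ N) → (arrs h′ POW [ N ↦ vars h′ vS ]) i ≡ powℕ i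
        updated (yes refl) = trans (↦-same (arrs h′ POW) i _) q
        updated (no  i≢N)  = trans (↦-other (arrs h′ POW) _ i≢N) (p i (ℕ.≤∧≢⇒< (ℕ.≤-pred i<1+N) i≢N))

  record Prepared (h : State) : Set where
    constructor prepared
    field
      edges : Edges m h
      needs : ∀ i → i < s → arrs h NEED i ≡ needℕ i
      pows  : ∀ i → i < s → arrs h POW i ≡ powℕ i
      b≡    : vars h vb ≡ b
      S≡    : vars h vS ≡ bound
      none  : cells h 0 ≡ 0
  open Prepared

  setup-correct : ∀ h → Reading h → Prepared (exec ρ₀ setup h)
  setup-correct h R = prepared
    (λ e e<m → let p , q , r = readEdges-correct h R e e<m in
       trans (cong (λ f → f e) (arr-kept K₁ SRC refl)) p ,
       trans (cong (λ f → f e) (arr-kept K₁ TGT refl)) q ,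
       trans (cong (λ f → f e) (arr-kept K₁ COL refl)) r)
    (λ i i<s → trans (cong (λ f → f i) (arr-kept K₂ NEED refl))
       (readNeeds-correct h₁ (trans (cell-kept (exec-kept readEdges ρ₀ h) refl) R) i i<s))
    (proj₁ scaled)
    (trans (var-unset (exec-kept scale ρ₀ h₄) vb refl) (proj₁ (chooseBits-correct h₃)))
    (proj₂ scaled)
    (trans (cong (λ f → f 0) (cell-kept (exec-kept (chooseBits ︔ scale) ρ₀ h₃) refl))
       (trans (cong (λ i → (cells h₂ [ i ↦ 0 ]) 0) (clamp-≡ ρ₀ 0 z≤n)) (↦-same (cells h₂) 0 0)))
    where
    h₁ h₂ h₃ h₄ : State
    h₁ = exec ρ₀ readEdges h
    h₂ = exec ρ₀ readNeeds h₁
    h₃ = exec ρ₀ (inp⟨ lit 0 ⟩↤ lit 0) h₂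
    h₄ = exec ρ₀ chooseBits h₃
    K₁ : Kept (readNeeds ︔ inp⟨ lit 0 ⟩↤ lit 0 ︔ chooseBits ︔ scale) h₁ (exec ρ₀ setup h)
    K₁ = exec-kept (readNeeds ︔ inp⟨ lit 0 ⟩↤ lit 0 ︔ chooseBits ︔ scale) ρ₀ h₁
    K₂ : Kept (inp⟨ lit 0 ⟩↤ lit 0 ︔ chooseBits ︔ scale) h₂ (exec ρ₀ setup h)
    K₂ = exec-kept (inp⟨ lit 0 ⟩↤ lit 0 ︔ chooseBits ︔ scale) ρ₀ h₂
    scaled = scale-correct h₄ (proj₂ (chooseBits-correct h₃))

  offsets-correct : ∀ h → Prepared h → Ready (exec ρ offsets h)
  offsets-correct h P = ready
    (λ e e<m → trans (cong (λ f → f e) (arr-kept K SRC refl)) (proj₁ (edges P e e<m)))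
    (λ e e<m → trans (cong (λ f → f e) (arr-kept K TGT refl)) (proj₁ (proj₂ (edges P e e<m))))
    (λ e e<m → trans (cong (λ f → f e) (arr-kept K COL refl)) (proj₂ (proj₂ (edges P e e<m))))
    (λ i i<s → trans (cong (λ f → f i) (arr-kept K NEED refl)) (needs P i i<s))
    (λ i i<s → trans (cong (λ f → f i) (arr-kept K POW refl)) (pows P i i<s))
    (proj₁ (for-inv ρ vV pN _ (setVar vp 0 h) Q ((λ _ ()) , refl) next))
    where
    K : Kept offsets h (exec ρ offsets h)
    K = exec-kept offsets ρ h
    body : Cmd
    body = OFF ⟨ var vV ⟩↤ var vp ︔ vp ↤ par pBound ⊞ var vp
    Q : ℕ → State → Set
    Q N h′ = (∀ v → v < N → arrs h′ OFF v ≡ v * bound) × vars h′ vp ≡ N * bound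
    next : ∀ N h′ → N < n → Kept (for vV < pN repeat body) (setVar vp 0 h) h′ → Q N h′ → Q (suc N) (exec ρ body (setVar vV N h′))
    next N h′ N<n _ (p , q) = off′ , cong (bound +_) q
      where
      off′ : ∀ v → v < suc N → (arrs h′ OFF [ N ↦ vars h′ vp ]) v ≡ v * bound
      off′ v v<1+N with v ≟ N
      ... | yes refl = trans (↦-same (arrs h′ OFF) v _) q
      ... | no  v≢N  = trans (↦-other (arrs h′ OFF) _ v≢N) (p v (ℕ.≤∧≢⇒< (ℕ.≤-pred v<1+N) v≢N))

  startStore : Store
  startStore = store (λ _ → 0) (contents (input I))

  -- The 19 steps are ten instructions and nine compositions. The coin list is left arbitrary so
  -- that the coins of any run can be supplied as prophecy.
  prelude-runs : ∃[ σ ] Runs prelude 19 startStore σ × (∀ cs → ∃[ h ] Sim ρ₀ h σ × Reading h × coins h ≡ cs)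
  prelude-runs = σ , runs , λ cs → state (λ x → reg σ (varR x)) (λ k x → contents (input I) (location ρ₀ k x)) (contents (input I)) cs ,
      sim (λ _ → refl) pars (λ _ _ → refl) (λ _ _ → refl) , refl , refl
    where
    σ : Store
    σ = proj₂ (run (quiet {19}) (prelude ∷ [] , startStore))
    runs : Runs prelude 19 startStore σ
    runs (_ ∷ _ ∷ _ ∷ _ ∷ _ ∷ _ ∷ _ ∷ _ ∷ _ ∷ _ ∷ _ ∷ _ ∷ _ ∷ _ ∷ _ ∷ _ ∷ _ ∷ _ ∷ _ ∷ []) K = refl
    pars : ∀ y → reg σ (parR y) ≡ ρ₀ y
    pars 0 = refl
    pars 1 = refl
    pars 2 = refl
    pars 3 = refl
    pars (suc (suc (suc (suc y)))) = refl

-- The running time and the success probability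

decomposes-vectors : ∀ {A : Set} n (g : A → List Bool) → (∀ (x : Vec Bool n) → ∃[ a ] g a ≡ Vec.toList x) →
  ∀ m (x : Vec Bool (m * n)) → ∃[ v ] flatten g {m} v ≡ Vec.toList x
decomposes-vectors n g dec zero    []  = [] , refl
decomposes-vectors n g dec (suc m) x with Vec.splitAt n x
... | y , z , refl =
  let a , p = dec y
      v , q = decomposes-vectors n g dec m z
  in a ∷ v , trans (cong₂ List._++_ p q) (sym (Vec.toList-++ y z))

extract-vec : ∀ {n} (M ω : Vec Bool n) → ∃[ x ] Vec.toList {n = trues M} x ≡ extract M ω
extract-vec []          []      = [] , refl
extract-vec (true  ∷ M) (b ∷ ω) = let x , p = extract-vec M ω in b ∷ x , cong (b ∷_) p
extract-vec (false ∷ M) (b ∷ ω) = extract-vec M ω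

-- Parameter 0 is excluded because it determines where the arrays lie; changing it would move every
-- `location`.
sim-setPar : ∀ {ρ h σ} y a → Sim ρ h σ → Sim (ρ [ suc y ↦ a ]) h (σ [ parR (suc y) ⇐ a ])
sim-setPar {ρ} {h} {σ} y a S = sim
  (λ x → trans (↦-other (reg σ) {parR (suc y)} {varR x} a (λ eq → quad≢1 x (suc y) (cong (_∸ 1) eq))) (vars-sim S x))
  at-par (cells-sim S) (arrs-sim S)
  where
  at-par : ∀ z → (reg σ [ parR (suc y) ↦ a ]) (parR z) ≡ (ρ [ suc y ↦ a ]) z
  at-par z with z ≟ suc y
  ... | yes refl = trans (↦-same (reg σ) (parR (suc y)) a) (sym (↦-same ρ (suc y) a))
  ... | no  z≢   = trans (↦-other (reg σ) {parR (suc y)} {parR z} a (λ eq → z≢ (quad-injective z (suc y) (cong (_∸ 2) eq))))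
                   (trans (pars-sim S z) (sym (↦-other ρ a z≢)))

sim-≗ : ∀ {ρ ρ′ h σ} → (∀ y → ρ y ≡ ρ′ y) → Sim ρ h σ → Sim ρ′ h σ
sim-≗ {ρ} {ρ′} {h} {σ} p S = sim (vars-sim S) (λ y → trans (pars-sim S y) (p y))
  (λ x q → cells-sim S x (subst (x ≤_) (sym (p 0)) q))
  (λ k x → trans (cong (λ l → mem σ (double (double (double (double x))) + l + suc (toℕ k))) (sym (p 0))) (arrs-sim S k x))

*-^ : ∀ a b t → (a * b) ^ t ≡ a ^ t * b ^ t
*-^ a b zero    = refl
*-^ a b (suc t) = trans (cong (a * b *_) (*-^ a b t))
  (solve 4 (λ a b x y → a :* b :* (x :* y) := a :* x :* (b :* y)) refl a b (a ^ t) (b ^ t))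
  where open +-*-Solver

run-halted : ∀ {x} (ω : Vec Bool x) σ → run ω ([] , σ) ≡ ([] , σ)
run-halted []      σ = refl
run-halted (b ∷ ω) σ = run-halted ω σ

-- If one trial fails on X of its 2^N coin blocks, all t fail on at most X^t strings, and 2^t X^t is
-- at most (2^N)^t. The coins not read contribute the same factor to both sides.
repeated-failure : ∀ {T} (M : Vec Bool T) t N (f : Vec Bool T → ℕ) (g : List Bool → ℕ) →
  (∀ ω → f ω ≤ g (extract M ω)) → trues M ≡ t * N → ∀ X → 2 * X ≤ 2 ^ N →
  total (coinStrings (t * N)) (g ∘ Vec.toList) ≤ X ^ t → 2 ^ t * total (coinStrings T) f ≤ 2 ^ T
repeated-failure {T} M t N f g f≤g trues≡ X 2X≤ few = begin
  2 ^ t * total (coinStrings T) f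
    ≤⟨ ℕ.*-monoʳ-≤ (2 ^ t) (total-mono (coinStrings T) f≤g) ⟩
  2 ^ t * total (coinStrings T) (g ∘ extract M)
    ≡⟨ cong (2 ^ t *_) (total-extract M g) ⟩
  2 ^ t * (2 ^ falses M * total (coinStrings (trues M)) (g ∘ Vec.toList))
    ≡⟨ cong (λ k → 2 ^ t * (2 ^ falses M * total (coinStrings k) (g ∘ Vec.toList))) trues≡ ⟩
  2 ^ t * (2 ^ falses M * total (coinStrings (t * N)) (g ∘ Vec.toList))
    ≤⟨ ℕ.*-monoʳ-≤ (2 ^ t) (ℕ.*-monoʳ-≤ (2 ^ falses M) few) ⟩
  2 ^ t * (2 ^ falses M * X ^ t)
    ≡⟨ solve 3 (λ a f y → a :* (f :* y) := f :* (a :* y)) refl (2 ^ t) (2 ^ falses M) (X ^ t) ⟩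
  2 ^ falses M * (2 ^ t * X ^ t)
    ≡⟨ cong (2 ^ falses M *_) (sym (*-^ 2 X t)) ⟩
  2 ^ falses M * (2 * X) ^ t
    ≤⟨ ℕ.*-monoʳ-≤ (2 ^ falses M) (ℕ.^-monoˡ-≤ t 2X≤) ⟩
  2 ^ falses M * (2 ^ N) ^ t
    ≡⟨ cong (2 ^ falses M *_) (trans (ℕ.^-*-assoc 2 N t) (cong (2 ^_) (ℕ.*-comm N t))) ⟩
  2 ^ falses M * 2 ^ (t * N)
    ≡⟨ sym (ℕ.^-distribˡ-+-* 2 (falses M) (t * N)) ⟩
  2 ^ (falses M + t * N)
    ≡⟨ cong (2 ^_) (trans (ℕ.+-comm (falses M) _) (trans (cong (_+ falses M) (sym trues≡)) (trues+falses M))) ⟩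
  2 ^ T ∎
  where
  open ℕ.≤-Reasoning
  open +-*-Solver

by-splitting : ∀ a {x} (P : Vec Bool (a + x) → Set) → (∀ ω₁ ω₂ → P (ω₁ ++ ω₂)) → ∀ ω → P ω
by-splitting a P p ω with Vec.splitAt a ω
... | ω₁ , ω₂ , refl = p ω₁ ω₂

mainPart : ℕ → Cmd
mainPart t = offsets ︔ trials t

setPar : ℕ → ℕ → Program
setPar y x = move (parR y) (varR x)

-- Loop bounds must be parameters, which commands cannot set. The two bounds computed by the first
-- stage therefore become parameters through moves outside the loop language.
staged : Cmd → Cmd → Program
staged A B = prelude ⨾ compile A 0 ⨾ setPar pB vb ⨾ setPar pBound vS ⨾ compile B 0

algorithm : ℕ → Program
algorithm t = staged setup (mainPart t)

module Stages (A B : Cmd) (ρ₀ ρ : Params) where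

  steps : ℕ
  steps = suc (19 + suc (cost A ρ₀ + suc (3 + suc (3 + cost B ρ))))

  coinMask : Vec Bool steps
  coinMask = false ∷ (quiet {19} ++ (false ∷ (mask A ρ₀ ++ (false ∷ (quiet {3} ++ (false ∷ (quiet {3} ++ mask B ρ)))))))

  trues-coinMask : trues coinMask ≡ uses A ρ₀ + uses B ρ
  trues-coinMask = trans (trues-++ (mask A ρ₀) _) (cong₂ _+_ (trues-mask A ρ₀) (trues-mask B ρ))

  silent : ∀ {a b} (ω : Vec Bool a) (m : Vec Bool b) ω′ → extract (quiet ++ m) (ω ++ ω′) ≡ extract m ω′
  silent ω m ω′ = trans (extract-++ quiet m ω ω′) (cong (List._++ extract m ω′) (extract-quiet ω))

  module _ {σ₀ σ₁ : Store} (first : Runs prelude 19 σ₀ σ₁) (start : List Bool → State)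
           (start-sim : ∀ cs → Sim ρ₀ (start cs) σ₁) (start-coins : ∀ cs → coins (start cs) ≡ cs)
           (params : ∀ cs y → ((((ρ₀ [ 4 ↦ 0 ]) [ 4 ↦ vars (exec ρ₀ A (start cs)) vb ]) [ 5 ↦ 0 ])
                                [ 5 ↦ vars (exec ρ₀ A (start cs)) vS ]) y ≡ ρ y) where

    machine-runs : ∀ (ω : Vec Bool steps) → ∃[ σ ] run ω (staged A B ∷ [] , σ₀) ≡ ([] , σ) ×
      Sim ρ (exec ρ B (exec ρ₀ A (start (extract coinMask ω)))) σ
    machine-runs (b₀ ∷ ω) with Vec.splitAt 19 ω
    ... | ω₁ , b₁ ∷ ω′ , refl with Vec.splitAt (cost A ρ₀) ω′
    ... | ω₂ , b₂ ∷ ω″ , refl with Vec.splitAt 3 ω″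
    ... | ω₃ , b₃ ∷ ω‴ , refl with Vec.splitAt 3 ω‴
    ... | ω₄ , ω₅ , refl =
      σ₅ , runs , subst (λ z → Sim ρ (exec ρ B (exec ρ₀ A (start z))) σ₅) (sym extracted) S₅
      where
      c₂ c₅ cs : List Bool
      c₂ = extract (mask A ρ₀) ω₂
      c₅ = extract (mask B ρ) ω₅
      cs = c₂ List.++ c₅
      extracted : extract coinMask (b₀ ∷ (ω₁ ++ (b₁ ∷ (ω₂ ++ (b₂ ∷ (ω₃ ++ (b₃ ∷ (ω₄ ++ ω₅)))))))) ≡ cs
      extracted = trans (silent ω₁ _ _) (trans (extract-++ (mask A ρ₀) _ ω₂ _)
          (cong (c₂ List.++_) (trans (silent ω₃ _ _) (silent ω₄ _ _))))
      step₂ = compile-correct A 0 (start-sim cs) ω₂ c₅ (start-coins cs)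
      σ₂ : Store
      σ₂ = proj₁ (proj₁ step₂)
      h₂ : State
      h₂ = exec ρ₀ A (start cs)
      S₂ : Sim ρ₀ h₂ σ₂
      S₂ = proj₁ (proj₂ (proj₂ (proj₁ step₂)))
      σ₃ σ₄ : Store
      σ₃ = σ₂ [ parR pB ⇐ 0 ] [ parR pB ⇐ reg σ₂ (varR vb) ]
      σ₄ = σ₃ [ parR pBound ⇐ 0 ] [ parR pBound ⇐ reg σ₃ (varR vS) ]
      S₄ : Sim ρ h₂ σ₄
      S₄ = sim-≗ (λ y → trans
          (cong₂ (λ p q → ((((ρ₀ [ 4 ↦ 0 ]) [ 4 ↦ p ]) [ 5 ↦ 0 ]) [ 5 ↦ q ]) y) (vars-sim S₂ vb) (vars-sim S₂ vS))
          (params cs y))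
        (sim-setPar 4 (reg σ₃ (varR vS)) (sim-setPar 4 0
          (sim-setPar 3 (reg σ₂ (varR vb)) (sim-setPar 3 0 S₂))))
      step₅ = compile-correct B 0 S₄ ω₅ [] (trans (proj₂ step₂) (sym (List.++-identityʳ c₅)))
      σ₅ : Store
      σ₅ = proj₁ (proj₁ step₅)
      S₅ : Sim ρ (exec ρ B h₂) σ₅
      S₅ = proj₁ (proj₂ (proj₂ (proj₁ step₅)))
      runs : run (b₀ ∷ (ω₁ ++ (b₁ ∷ (ω₂ ++ (b₂ ∷ (ω₃ ++ (b₃ ∷ (ω₄ ++ ω₅)))))))) (staged A B ∷ [] , σ₀) ≡ ([] , σ₅)
      runs = trans (run-++ ω₁ _ _) (trans (cong (run (b₁ ∷ (ω₂ ++ (b₂ ∷ (ω₃ ++ (b₃ ∷ (ω₄ ++ ω₅))))))) (first ω₁ _))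
        (trans (run-++ ω₂ _ _) (trans (cong (run (b₂ ∷ (ω₃ ++ (b₃ ∷ (ω₄ ++ ω₅))))) (proj₁ (proj₂ (proj₁ step₂)) _))
        (trans (run-++ ω₃ _ _) (trans (cong (run (b₃ ∷ (ω₄ ++ ω₅))) (move-runs (parR pB) (varR vb) σ₂ (λ ()) ω₃ _))
        (trans (run-++ ω₄ _ _) (trans (cong (run ω₅) (move-runs (parR pBound) (varR vS) σ₃ (λ ()) ω₄ _))
        (proj₁ (proj₂ (proj₁ step₅)) []))))))))

module Analysis {s n : ℕ} (I : Instance s n) (t : ℕ) where
  open Instance I
  open Initialisation I
  open Publishing m≤l

  open Stages setup (mainPart t) ρ₀ ρ public

  Chunks : Set
  Chunks = Vec (Vec (Vec Bool b) m) t

  startState : List Bool → State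
  startState cs = proj₁ (proj₂ (proj₂ prelude-runs) cs)

  final : List Bool → State
  final cs = exec ρ (mainPart t) (exec ρ₀ setup (startState cs))

  start-coins : ∀ cs → coins (startState cs) ≡ cs
  start-coins cs = proj₂ (proj₂ (proj₂ (proj₂ (proj₂ prelude-runs) cs)))

  params-≗ : ∀ {b′ S′} → b′ ≡ b → S′ ≡ bound → ∀ y →
             ((((ρ₀ [ 4 ↦ 0 ]) [ 4 ↦ b′ ]) [ 5 ↦ 0 ]) [ 5 ↦ S′ ]) y ≡ ρ y
  params-≗ refl refl 0 = refl
  params-≗ refl refl 1 = refl
  params-≗ refl refl 2 = refl
  params-≗ refl refl 3 = refl
  params-≗ refl refl 4 = refl
  params-≗ refl refl 5 = refl
  params-≗ refl refl (suc (suc (suc (suc (suc (suc y)))))) = refl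

  prepared-final : ∀ cs → Prepared (exec ρ₀ setup (startState cs))
  prepared-final cs = setup-correct (startState cs) (proj₁ (proj₂ (proj₂ (proj₂ (proj₂ prelude-runs) cs))))

  machine : ∀ (ω : Vec Bool steps) →
    ∃[ σ ] run ω (initial I (algorithm t)) ≡ ([] , σ) × Sim ρ (final (extract coinMask ω)) σ
  machine = machine-runs (proj₁ (proj₂ prelude-runs)) startState
    (λ cs → proj₁ (proj₂ (proj₂ (proj₂ prelude-runs) cs))) start-coins
    (λ cs → params-≗ (Prepared.b≡ (prepared-final cs)) (Prepared.S≡ (prepared-final cs)))

  final-outcome : ∀ cs (v : Chunks) → cs ≡ flatten (flatten Vec.toList) v → Sound (final cs) × (SomeGood v → Found (final cs))
  final-outcome cs v cs≡ = Outcome.still-sound O , Outcome.succeeds O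
    where
    h₂ h₃ : State
    h₂ = exec ρ₀ setup (startState cs)
    h₃ = exec ρ offsets h₂
    P₂ : Prepared h₂
    P₂ = prepared-final cs
    coins₃ : coins h₃ ≡ flatten (flatten Vec.toList) v
    coins₃ = trans (coin-kept (exec-kept offsets ρ h₂) refl)
      (trans (coin-kept (exec-kept setup ρ₀ (startState cs)) refl) (trans (start-coins cs) cs≡))
    O : Outcome h₃ (final cs) (SomeGood v)
    O = trials-correct t h₃ v (offsets-correct h₂ P₂)
      (inj₁ (trans (cong (λ f → f 0) (cell-kept (exec-kept offsets ρ h₂) refl)) (Prepared.none P₂))) coins₃

  uses-trials : ∀ t → uses (trials t) ρ ≡ t * (m * b)
  uses-trials zero    = refl
  uses-trials (suc t) = cong₂ _+_ one (uses-trials t)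
    where
    one : uses trial ρ ≡ m * b
    one = trans (cong (m * (b * 1 + 0) +_) (uses-none (for vT < pBound repeat (candidate ︔ check)) ρ refl))
      (trans (ℕ.+-identityʳ _) (cong (m *_) (trans (ℕ.+-identityʳ _) (ℕ.*-identityʳ b))))

  coins-used : trues coinMask ≡ t * (m * b)
  coins-used = trans trues-coinMask
    (cong₂ _+_ (uses-none setup ρ₀ refl) (cong₂ _+_ (uses-none offsets ρ refl) (uses-trials t)))

  chunks-of : ∀ ω → Σ[ v ∈ Chunks ] extract coinMask ω ≡ flatten (flatten Vec.toList) v
  chunks-of ω = let x , p = extract-vec coinMask ω in go coins-used x p
    where
    go : ∀ {N} → N ≡ t * (m * b) → (x : Vec Bool N) → Vec.toList x ≡ extract coinMask ω →
         Σ[ v ∈ Chunks ] extract coinMask ω ≡ flatten (flatten Vec.toList) v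
    go refl x p =
      let v , q = decomposes-vectors (m * b) (flatten Vec.toList)
                    (decomposes-vectors b Vec.toList (λ y → y , refl) m) t x
      in v , sym (trans q p)

  answer-none : ∀ σ → mem σ 0 ≡ 0 → output I ([] , σ) ≡ nothing
  answer-none σ p rewrite p = refl

  answer-some : ∀ σ {a} → mem σ 0 ≡ suc a →
    output I ([] , σ) ≡ just (Vec.tabulate λ e → not (mem σ (suc (toℕ e)) ≡ᵇ 0))
  answer-some σ p rewrite p = refl

  found-answer : ∀ h σ → Sim ρ h σ → Found h → Maybe.Any IsSolution (output I ([] , σ))
  found-answer h σ S (one , M , sol , written) = subst (Maybe.Any IsSolution)
    (sym (trans (answer-some σ (trans (cells-sim S 0 z≤n) one)) (cong just same)))
    (Maybe.just (solves⇒edgeSet M sol))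
    where
    read-bit : ∀ b → not (bit b ≡ᵇ 0) ≡ b
    read-bit false = refl
    read-bit true  = refl
    same : Vec.tabulate (λ e → not (mem σ (suc (toℕ e)) ≡ᵇ 0)) ≡ edgeSet M
    same = Vec.tabulate-cong λ e → trans (cong (λ z → not (z ≡ᵇ 0))
      (trans (cells-sim S (suc (toℕ e)) (ℕ.≤-trans (Fin.toℕ<n e) m≤l)) (written (toℕ e) (Fin.toℕ<n e))))
      (read-bit (M (toℕ e)))

  module _ (x : ℕ) where

    -- The final claim concerns runs of a prescribed length, so x idle steps in a halted
    -- configuration are appended; their coins are masked out.
    longMask : Vec Bool (steps + x)
    longMask = coinMask ++ quiet {x}

    Longer : Vec Bool (steps + x) → Set
    Longer ω = ∃[ σ ] run ω (initial I (algorithm t)) ≡ ([] , σ) × Sim ρ (final (extract longMask ω)) σ ×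
      Sound (final (extract longMask ω))

    runs-longer : ∀ ω → Longer ω
    runs-longer = by-splitting steps Longer λ ω₁ ω₂ →
      let σ , r , S = machine ω₁
          same = trans (extract-++ coinMask quiet ω₁ ω₂)
                 (trans (cong (extract coinMask ω₁ List.++_) (extract-quiet ω₂)) (List.++-identityʳ _))
          v , p = chunks-of ω₁
      in σ , trans (run-++ ω₁ ω₂ _) (trans (cong (run ω₂) r) (run-halted ω₂ σ)) ,
         subst (λ z → Sim ρ (final z) σ) (sym same) S ,
         subst (λ z → Sound (final z)) (sym same) (proj₁ (final-outcome _ v p))

    halts : HaltsWithin I (algorithm t) (steps + x)
    halts ω = cong proj₁ (proj₁ (proj₂ (runs-longer ω)))

    concludes : ¬ Solvable → (ω : Vec Bool (steps + x)) → ConcludesNone I (algorithm t) ω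
    concludes unsolvable ω = conclude (runs-longer ω)
      where
      conclude : Longer ω → ConcludesNone I (algorithm t) ω
      conclude (σ , r , S , inj₁ zero₀) = trans (cong (output I) r) (answer-none σ (trans (cells-sim S 0 z≤n) zero₀))
      conclude (σ , r , S , inj₂ (_ , M , sol , _)) = contradiction (edgeSet M , solves⇒edgeSet M sol) unsolvable

    missed : Vec Bool (steps + x) → ℕ
    missed ω = bit (not (does (findsSolution? I (algorithm t) ω)))

    silentRun : List Bool → ℕ
    silentRun cs = bit (cells (final cs) 0 ≡ᵇ 0)

    -- By soundness a nonzero cell 0 means that a solution is published. Failure is thus dominated
    -- by an event that depends only on the coins read.
    missed-≤ : ∀ ω → missed ω ≤ silentRun (extract longMask ω)
    missed-≤ ω = compare (runs-longer ω)
      where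
      compare : Longer ω → missed ω ≤ silentRun (extract longMask ω)
      compare (σ , r , S , inj₁ zero₀) = ℕ.≤-trans (bit≤1 _) (ℕ.≤-reflexive (cong (λ z → bit (z ≡ᵇ 0)) (sym zero₀)))
      compare (σ , r , S , inj₂ found) = ℕ.≤-trans (ℕ.≤-reflexive (cong (bit ∘ not)
        (dec-true (findsSolution? I (algorithm t) ω) (subst (Maybe.Any IsSolution) (cong (output I) (sym r)) (found-answer _ σ S found))))) z≤n

    module _ (solvable : Solvable) where

      someGood : ∀ {t} (v : Vec (Vec (Vec Bool b) m) t) → SomeGood v ⊎ allOf (fails solvable) v ≡ 1
      someGood []      = inj₂ refl
      someGood (c ∷ v) = combine (fails-or-isolated solvable c) (someGood v)
        where
        combine : Isolated c ⊎ fails solvable c ≡ 1 → SomeGood v ⊎ allOf (fails solvable) v ≡ 1 →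
                  SomeGood (c ∷ v) ⊎ allOf (fails solvable) (c ∷ v) ≡ 1
        combine (inj₁ iso) _        = inj₁ (inj₁ (isolated⇒good m≤l c iso))
        combine (inj₂ _)   (inj₁ g) = inj₁ (inj₂ g)
        combine (inj₂ p)   (inj₂ q) = inj₂ (cong₂ _*_ p q)

      silentRun-≤ : ∀ (v : Chunks) → silentRun (flatten (flatten Vec.toList) v) ≤ allOf (fails solvable) v
      silentRun-≤ v = compare (someGood v)
        where
        compare : SomeGood v ⊎ allOf (fails solvable) v ≡ 1 → silentRun (flatten (flatten Vec.toList) v) ≤ allOf (fails solvable) v
        compare (inj₂ p) = ℕ.≤-trans (bit≤1 _) (ℕ.≤-reflexive (sym p))
        compare (inj₁ g) = ℕ.≤-trans (ℕ.≤-reflexive (cong (λ z → bit (z ≡ᵇ 0)) (proj₁ (proj₂ (final-outcome _ v refl) g)))) z≤n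

      chunkList : List (Vec (Vec Bool b) m)
      chunkList = vectors (coinStrings b) m

      -- A random weight has 2^b values, at least 2m of them, so the bound m / 2^b from the
      -- isolation lemma is at most 1/2.
      half-fail : 2 * total chunkList (fails solvable) ≤ 2 ^ (m * b)
      half-fail = ℕ.*-cancelˡ-≤ (2 ^ b) {{>-nonZero (ℕ.m^n>0 2 b)}} (begin
        2 ^ b * (2 * X)               ≡⟨ solve 2 (λ l x → l :* (con 2 :* x) := con 2 :* (l :* x)) refl (2 ^ b) X ⟩
        2 * (2 ^ b * X)               ≤⟨ ℕ.*-monoʳ-≤ 2 iso ⟩
        2 * (m * (2 ^ b) ^ m)         ≡⟨ solve 2 (λ m y → con 2 :* (m :* y) := (m :+ m) :* y) refl m ((2 ^ b) ^ m) ⟩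
        (m + m) * (2 ^ b) ^ m         ≤⟨ ℕ.*-monoˡ-≤ ((2 ^ b) ^ m) (bits-enough m) ⟩
        2 ^ b * (2 ^ b) ^ m           ≡⟨ cong (2 ^ b *_) (trans (ℕ.^-*-assoc 2 b m) (cong (2 ^_) (ℕ.*-comm b m))) ⟩
        2 ^ b * 2 ^ (m * b)           ∎)
        where
        open ℕ.≤-Reasoning
        open +-*-Solver
        X : ℕ
        X = total chunkList (fails solvable)
        iso : 2 ^ b * X ≤ m * (2 ^ b) ^ m
        iso = subst (λ L → L * X ≤ m * L ^ m) (length-coinStrings b)
          (isolation solvable (coinStrings b) quiet (at-most-one b))

      failure : 2 ^ t * total (coinStrings (steps + x)) missed ≤ 2 ^ (steps + x)
      failure = repeated-failure longMask t (m * b) missed silentRun missed-≤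
        (trans (trues-++ coinMask quiet) (trans (cong₂ _+_ coins-used (trues-quiet x)) (ℕ.+-identityʳ _)))
        (total chunkList (fails solvable)) half-fail
        (ℕ.≤-trans (ℕ.≤-reflexive (blocks-vectors chunkList (flatten Vec.toList)
            (blocks-vectors (coinStrings b) Vec.toList (λ _ → refl) m) t silentRun))
          (ℕ.≤-trans (total-mono (vectors chunkList t) silentRun-≤)
            (ℕ.≤-reflexive (total-allOf chunkList (fails solvable) t))))

-- Real numbers and the error bound

frac : ℕ → ℕ → ℚᵘ.ℚᵘ
frac a d = ℚᵘ.mkℚᵘ (ℤ.+ a) d

/2^-≡ : ∀ a t d → 2 ^ t ≡ suc d → a /2^ t ≡ fromℚᵘ (frac a d)
/2^-≡ a t d p = go (2 ^ t) {{ℕ.m^n≢0 2 t}} p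
  where
  go : ∀ D .{{_ : NonZero D}} → D ≡ suc d → (ℤ.+ a) ℚ./ D ≡ fromℚᵘ (frac a d)
  go .(suc d) refl = refl

2^-suc : ∀ t → ∃[ d ] 2 ^ t ≡ suc d
2^-suc t with 2 ^ t | ℕ.m^n>0 2 t
... | suc d | _ = d , refl

frac-≤ : ∀ a d b e → a * suc e ≤ b * suc d → fromℚᵘ (frac a d) ℚ.≤ fromℚᵘ (frac b e)
frac-≤ a d b e p = ℚ.toℚᵘ-cancel-≤ (ℚᵘ.≤-trans (ℚᵘ.≤-reflexive (ℚ.toℚᵘ-fromℚᵘ (frac a d)))
  (ℚᵘ.≤-trans (ℚᵘ.*≤* (subst₂ ℤ._≤_ (ℤ.pos-* a (suc e)) (ℤ.pos-* b (suc d)) (ℤ.+≤+ p)))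
    (ℚᵘ.≤-reflexive (ℚᵘ.≃-sym (ℚ.toℚᵘ-fromℚᵘ (frac b e))))))

frac-< : ∀ a d b e → a * suc e < b * suc d → fromℚᵘ (frac a d) ℚ.< fromℚᵘ (frac b e)
frac-< a d b e p = ℚ.toℚᵘ-cancel-< (ℚᵘ.<-respˡ-≃ (ℚᵘ.≃-sym (ℚ.toℚᵘ-fromℚᵘ (frac a d)))
  (ℚᵘ.<-respʳ-≃ (ℚᵘ.≃-sym (ℚ.toℚᵘ-fromℚᵘ (frac b e)))
    (ℚᵘ.*<* (subst₂ ℤ._<_ (ℤ.pos-* a (suc e)) (ℤ.pos-* b (suc d)) (ℤ.+<+ p)))))

power-≤ : ∀ {s t} → s ≤ t → 1 /2^ t ℚ.≤ 1 /2^ s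
power-≤ {s} {t} s≤t with 2^-suc s | 2^-suc t
... | d , p | e , q = subst₂ ℚ._≤_ (sym (/2^-≡ 1 t e q)) (sym (/2^-≡ 1 s d p))
  (frac-≤ 1 e 1 d (ℕ.*-monoʳ-≤ 1 (subst₂ _≤_ p q (ℕ.^-monoʳ-≤ 2 s≤t))))

power-< : ∀ t → 1 /2^ suc t ℚ.< 1 /2^ t
power-< t with 2^-suc t | 2^-suc (suc t)
... | d , p | e , q = subst₂ ℚ._<_ (sym (/2^-≡ 1 (suc t) e q)) (sym (/2^-≡ 1 t d p))
  (frac-< 1 e 1 d (ℕ.*-monoʳ-< 1 (subst₂ _<_ p q (ℕ.^-monoʳ-< 2 (s≤s (s≤s z≤n)) (ℕ.n<1+n t)))))

error-bound : ∀ a f t T → a + f ≡ 2 ^ T → 2 ^ t * f ≤ 2 ^ T → 1ℚ ℚ.- (a /2^ T) ℚ.≤ 1 /2^ t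
error-bound a f t T a+f p with 2^-suc t | 2^-suc T
... | d , t≡ | D , T≡ = subst₂ (λ x y → 1ℚ ℚ.- x ℚ.≤ y) (sym (/2^-≡ a T D T≡)) (sym (/2^-≡ 1 t d t≡))
    (subst (ℚ._≤ fromℚᵘ (frac 1 d)) (sym difference) (frac-≤ f D 1 d f≤))
  where
  f≤ : f * suc d ≤ 1 * suc D
  f≤ = begin
    f * suc d    ≡⟨ ℕ.*-comm f (suc d) ⟩
    suc d * f    ≡⟨ cong (_* f) (sym t≡) ⟩
    2 ^ t * f    ≤⟨ p ⟩
    2 ^ T        ≡⟨ trans T≡ (sym (ℕ.*-identityˡ (suc D))) ⟩
    1 * suc D    ∎
    where open ℕ.≤-Reasoning
  sum : fromℚᵘ (frac f D) ℚ.+ fromℚᵘ (frac a D) ≡ 1ℚ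
  sum = ℚ.toℚᵘ-injective (ℚᵘ.≃-trans (ℚ.toℚᵘ-homo-+ (fromℚᵘ (frac f D)) (fromℚᵘ (frac a D)))
    (ℚᵘ.≃-trans (ℚᵘ.+-cong (ℚ.toℚᵘ-fromℚᵘ (frac f D)) (ℚ.toℚᵘ-fromℚᵘ (frac a D)))
      (ℚᵘ.*≡* (begin
        (ℤ.+ f ℤ.* ℤ.+ suc D ℤ.+ ℤ.+ a ℤ.* ℤ.+ suc D) ℤ.* ℤ.+ 1
          ≡⟨ ℤ.*-identityʳ _ ⟩
        ℤ.+ f ℤ.* ℤ.+ suc D ℤ.+ ℤ.+ a ℤ.* ℤ.+ suc D
          ≡⟨ sym (ℤ.*-distribʳ-+ (ℤ.+ suc D) (ℤ.+ f) (ℤ.+ a)) ⟩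
        (ℤ.+ f ℤ.+ ℤ.+ a) ℤ.* ℤ.+ suc D
          ≡⟨ cong (λ x → ℤ.+ x ℤ.* ℤ.+ suc D) (trans (ℕ.+-comm f a) (trans a+f T≡)) ⟩
        ℤ.+ suc D ℤ.* ℤ.+ suc D
          ≡⟨ sym (ℤ.pos-* (suc D) (suc D)) ⟩
        ℤ.+ (suc D * suc D)
          ≡⟨ sym (ℤ.*-identityˡ _) ⟩
        ℤ.+ 1 ℤ.* ℤ.+ (suc D * suc D) ∎))))
    where open ≡-Reasoning
  difference : 1ℚ ℚ.- fromℚᵘ (frac a D) ≡ fromℚᵘ (frac f D)
  difference = trans (cong (ℚ._- fromℚᵘ (frac a D)) (sym sum))
    (trans (ℚ.+-assoc (fromℚᵘ (frac f D)) (fromℚᵘ (frac a D)) _)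
    (trans (cong (fromℚᵘ (frac f D) ℚ.+_) (ℚ.+-inverseʳ (fromℚᵘ (frac a D)))) (ℚ.+-identityʳ _)))

module _ (p : ℝ) where
  open ℝ p

  L-down : ∀ {q r} → q ℚ.≤ r → L r → L q
  L-down {q} {r} q≤r Lr with Equivalence.to (roundedˡ r) Lr
  ... | r′ , r<r′ , Lr′ = Equivalence.from (roundedˡ q) (r′ , ℚ.≤-<-trans q≤r r<r′ , Lr′)

  U-up : ∀ {q r} → q ℚ.≤ r → U q → U r
  U-up {q} {r} q≤r Uq with Equivalence.to (roundedʳ q) Uq
  ... | q′ , q′<q , Uq′ = Equivalence.from (roundedʳ r) (q′ , ℚ.<-≤-trans q′<q q≤r , Uq′)

  below-positive : ∀ r → 0ℚ ℚ.< r → ∃[ j ] 1 /2^ j ℚ.≤ r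
  below-positive (ℚ.mkℚ (ℤ.+ zero) d c) (ℚ.*<* 0<r) =
    contradiction 0<r (ℤ.<-irrefl (sym (ℤ.*-zeroˡ (ℤ.+ 1))))
  below-positive (ℚ.mkℚ ℤ.-[1+ a ] d c) (ℚ.*<* ())
  below-positive r@(ℚ.mkℚ (ℤ.+ suc a) d c) _ with 2^-suc (suc d)
  -- The denominator itself serves as exponent: it is smaller than 2 to its power.
  ... | e , q = suc d , subst₂ ℚ._≤_ (sym (/2^-≡ 1 (suc d) e q)) (ℚ.fromℚᵘ-toℚᵘ r)
    (frac-≤ 1 e (suc a) d (begin
      1 * suc d       ≡⟨ ℕ.*-identityˡ (suc d) ⟩
      suc d           ≤⟨ ℕ.<⇒≤ (n<2^n (suc d)) ⟩
      2 ^ suc d       ≡⟨ q ⟩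
      suc e           ≤⟨ ℕ.m≤m+n (suc e) (a * suc e) ⟩
      suc a * suc e   ∎))
    where open ℕ.≤-Reasoning

  -- An upper approximation to log₂ (1/p): large enough for the error bound, yet at most twice any t
  -- that the time bound may be stated with.
  Trials : ℕ → Set
  Trials t₀ = L (1 /2^ t₀) × 1 ≤ t₀ × (∀ t → log₂[1/ p ]≤ t → t₀ ≤ 2 * t)

  -- Locatedness between 2^(-j-1) and 2^(-j) either permits a smaller exponent or shows p < 2^(-j).
  -- In the latter case every admissible t is at least j + 1, and j + 2 is at most 2 (j + 1).
  search : U 1ℚ → ∀ j → L (1 /2^ j) → ∃ Trials
  search U1 zero          Lj = contradiction (Lj , U1) (disjoint 1ℚ)
  search U1 (suc zero)    Lj = 1 , Lj , s≤s z≤n , λ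
    { zero    ok → contradiction U1 ok
    ; (suc t) ok → s≤s z≤n }
  search U1 (suc (suc j)) Lj =
    [ search U1 (suc j) , (λ Uj → suc (suc j) , Lj , s≤s z≤n , bounded Uj) ]′ (located (power-< j))
    where
    bounded : U (1 /2^ j) → ∀ t → log₂[1/ p ]≤ t → suc (suc j) ≤ 2 * t
    bounded Uj t ok = ℕ.≤-trans (s≤s (ℕ.≤-trans (ℕ.m≤n+m (suc j) j) ℕ.≤-refl))
      (ℕ.≤-trans (ℕ.≤-reflexive (cong (suc j +_) (sym (ℕ.+-identityʳ (suc j))))) (ℕ.*-monoʳ-≤ 2 j<t))
      where
      j<t : suc j ≤ t
      j<t = ℕ.≰⇒> λ t≤j → ok (U-up (power-≤ t≤j) Uj)

  number-of-trials : 0ℚ <ʳ p → p ʳ< 1ℚ → ∃ Trials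
  number-of-trials L0 U1 with Equivalence.to (roundedˡ 0ℚ) L0
  ... | r , 0<r , Lr = let j , j≤r = below-positive r 0<r in search U1 j (L-down j≤r Lr)

filter-complement : ∀ {A : Set} {P : A → Set} (P? : ∀ x → Dec (P x)) xs →
  length (filter P? xs) + total xs (λ x → bit (not (does (P? x)))) ≡ length xs
filter-complement P? []       = refl
filter-complement P? (x ∷ xs) with P? x
... | yes _ = cong suc (filter-complement P? xs)
... | no  _ = trans (ℕ.+-suc _ _) (cong suc (filter-complement P? xs))

-- The failure probability is at most 2^(-t₀), which lies strictly below p, so p cannot lie below
-- the failure probability.
probable : ∀ (p : ℝ) t₀ {T} {P : Vec Bool T → Set} (P? : ∀ ω → Dec (P ω)) → ℝ.L p (1 /2^ t₀) →
  2 ^ t₀ * total (coinStrings T) (λ ω → bit (not (does (P? ω)))) ≤ 2 ^ T → 1- p ≤ Pr P?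
probable p t₀ {T} P? Lt few U = ℝ.disjoint p (1ℚ ℚ.- Pr P?)
  ( L-down p (error-bound (length (filter P? (coinStrings T))) _ t₀ T
      (trans (filter-complement P? (coinStrings T)) (length-coinStrings T)) few) Lt
  , U )

-- The running time is polynomial for fixed s

module Timing {s n : ℕ} (I : Instance s n) where
  open Instance I
  open Initialisation I

  N : ℕ
  N = n ⊔ 2

  2≤N : 2 ≤ N
  2≤N = ℕ.m≤n⊔m n 2

  1≤s : 1 ≤ s
  1≤s = >-nonZero⁻¹ s

  N^-mono : ∀ {a b} → a ≤ b → N ^ a ≤ N ^ b
  N^-mono = ℕ.^-monoʳ-≤ N {{>-nonZero (ℕ.≤-trans (s≤s z≤n) 2≤N)}}

  2^≤N^ : ∀ a → 2 ^ a ≤ N ^ a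
  2^≤N^ a = ℕ.^-monoˡ-≤ a 2≤N

  1≤N^ : ∀ a → 1 ≤ N ^ a
  1≤N^ a = ℕ.≤-trans (ℕ.m^n>0 2 a) (2^≤N^ a)

  add-powers : ∀ {x y} a → x ≤ N ^ a → y ≤ N ^ a → x + y ≤ N ^ suc a
  add-powers a p q = ℕ.≤-trans (ℕ.+-mono-≤ p (ℕ.≤-trans q (ℕ.≤-reflexive (sym (ℕ.+-identityʳ (N ^ a)))))) (ℕ.*-monoˡ-≤ (N ^ a) 2≤N)

  mul-powers : ∀ {x y} a c → x ≤ N ^ a → y ≤ N ^ c → x * y ≤ N ^ (a + c)
  mul-powers a c p q = ℕ.≤-trans (ℕ.*-mono-≤ p q) (ℕ.≤-reflexive (sym (ℕ.^-distribˡ-+-* N a c)))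

  m≤N² : m ≤ N ^ 2
  m≤N² = ℕ.≤-trans (Fin.injective⇒≤ {f = λ e → Fin.combine (src e) (tgt e)} λ {e} {f} eq →
      let p , q = Fin.combine-injective (src e) (tgt e) (src f) (tgt f) eq in simple p q)
    (ℕ.≤-trans (ℕ.*-mono-≤ (ℕ.m≤m⊔n n 2) (ℕ.m≤m⊔n n 2)) (ℕ.≤-reflexive (cong (N *_) (sym (ℕ.*-identityʳ N)))))

  -- From m ≤ N^2 and 2^b ≤ 1 + 4m ≤ N^5; each addition costs one further power of N, as N is at
  -- least 2.
  range≤ : suc (m * 2 ^ b) ≤ N ^ 8
  range≤ = add-powers 7 (1≤N^ 7) (mul-powers 2 5 m≤N² (ℕ.≤-trans (2^bits-≤ (m + m) m)
    (add-powers 4 (1≤N^ 4) (add-powers 3 m+m≤ m+m≤))))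
    where
    m+m≤ : m + m ≤ N ^ 3
    m+m≤ = add-powers 2 m≤N² m≤N²

  bound≤ : bound ≤ N ^ (8 + 3 * s)
  bound≤ = mul-powers 8 (3 * s) range≤ (ℕ.≤-trans (ℕ.^-monoˡ-≤ s (add-powers 2 (1≤N^ 2) m≤N²))
    (ℕ.≤-reflexive (ℕ.^-*-assoc N 3 s)))

  -- The exponent comes from the weight bound: 8 + 3s ≤ 11s because s is at least 1. The estimates
  -- of the other parameters fit below it.
  Q : ℕ
  Q = N ^ (11 * s)

  raise : ∀ {x} a c → x ≤ N ^ (a + c * s) → a + c ≤ 11 → x ≤ Q
  raise a c p a+c≤ = ℕ.≤-trans p (N^-mono (begin
    a + c * s          ≤⟨ ℕ.+-monoˡ-≤ (c * s) (ℕ.≤-trans (ℕ.≤-reflexive (sym (ℕ.*-identityʳ a))) (ℕ.*-monoʳ-≤ a 1≤s)) ⟩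
    a * s + c * s      ≡⟨ sym (ℕ.*-distribʳ-+ s a c) ⟩
    (a + c) * s        ≤⟨ ℕ.*-monoˡ-≤ s a+c≤ ⟩
    11 * s             ∎))
    where open ℕ.≤-Reasoning

  s≤N^s : s ≤ N ^ s
  s≤N^s = ℕ.≤-trans (ℕ.<⇒≤ (n<2^n s)) (2^≤N^ s)

  m≤Q : m ≤ Q
  m≤Q = raise 2 0 m≤N² (ℕ.m≤m+n 2 9)

  n≤Q : n ≤ Q
  n≤Q = raise 1 0 (ℕ.≤-trans (ℕ.m≤m⊔n n 2) (ℕ.≤-reflexive (sym (ℕ.*-identityʳ N)))) (ℕ.m≤m+n 1 10)

  s≤Q : s ≤ Q
  s≤Q = raise 0 1 (subst (λ z → s ≤ N ^ z) (sym (ℕ.+-identityʳ s)) s≤N^s) (ℕ.m≤m+n 1 10)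

  l≤Q : l ≤ Q
  l≤Q = raise 6 1 (add-powers (5 + 1 * s) (add-powers (4 + 1 * s) (add-powers (3 + 1 * s) (add-powers (2 + 1 * s)
      (ℕ.≤-trans 2≤N (ℕ.≤-trans (ℕ.≤-reflexive (sym (ℕ.*-identityʳ N))) (N^-mono (ℕ.m≤m+n 1 (1 + 1 * s)))))
      (ℕ.≤-trans s≤N^s (N^-mono (ℕ.≤-trans (ℕ.≤-reflexive (sym (ℕ.*-identityˡ s))) (ℕ.m≤n+m (1 * s) 2)))))
      (m≤ 1)) (m≤ 2)) (m≤ 3)) (ℕ.m≤m+n 7 4)
    where
    m≤ : ∀ a → m ≤ N ^ (2 + a + 1 * s)
    m≤ a = ℕ.≤-trans m≤N² (N^-mono (ℕ.≤-trans (ℕ.m≤m+n 2 a) (ℕ.m≤m+n (2 + a) (1 * s))))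

  ρ≤Q : ∀ y → ρ y ≤ Q
  ρ≤Q 0 = l≤Q
  ρ≤Q 1 = n≤Q
  ρ≤Q 2 = s≤Q
  ρ≤Q 3 = m≤Q
  ρ≤Q 4 = ℕ.≤-trans (bits-≤ (m + m) m) m≤Q
  ρ≤Q 5 = raise 8 3 bound≤ ℕ.≤-refl
  ρ≤Q (suc (suc (suc (suc (suc (suc y)))))) = z≤n

  ρ₀≤Q : ∀ y → ρ₀ y ≤ Q
  ρ₀≤Q 0 = l≤Q
  ρ₀≤Q 1 = n≤Q
  ρ₀≤Q 2 = s≤Q
  ρ₀≤Q 3 = m≤Q
  ρ₀≤Q (suc (suc (suc (suc y)))) = z≤n

  1≤Q : 1 ≤ Q
  1≤Q = 1≤N^ (11 * s)

cost-trials : ∀ t ρ → cost (trials t) ρ ≡ t * suc (cost trial ρ) + 1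
cost-trials zero    ρ = refl
cost-trials (suc t) ρ = trans (cong (λ z → suc (cost trial ρ + z)) (cost-trials t ρ))
  (cong suc (sym (ℕ.+-assoc (cost trial ρ) (t * suc (cost trial ρ)) 1)))

-- The 31 single steps outside the three costs are charged to P t, which is at least 1.
collect : ∀ {a b c x y z} P t → a ≤ x * P → b ≤ y * P → c ≤ z * P → 1 ≤ P → 1 ≤ t →
  suc (19 + suc (a + suc (3 + suc (3 + suc (b + (t * suc c + 1)))))) ≤ (31 + x + y + suc z) * P * t
collect {a} {b} {c} {x} {y} {z} P t p q r 1≤P 1≤t = begin
  suc (19 + suc (a + suc (3 + suc (3 + suc (b + (t * suc c + 1))))))
    ≡⟨ solve 4 (λ a b c t → con 20 :+ (con 1 :+ (a :+ (con 4 :+ (con 4 :+ (con 1 :+ (b :+ (t :* (con 1 :+ c) :+ con 1)))))))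
         := con 31 :* con 1 :+ a :+ b :+ (con 1 :+ c) :* t) refl a b c t ⟩
  31 * 1 + a + b + suc c * t
    ≤⟨ ℕ.+-mono-≤ (ℕ.+-mono-≤ (ℕ.+-mono-≤ (ℕ.*-monoʳ-≤ 31 (ℕ.*-mono-≤ 1≤P 1≤t))
         (once-more p)) (once-more q)) (ℕ.*-monoˡ-≤ t (ℕ.+-mono-≤ 1≤P r)) ⟩
  31 * (P * t) + x * P * t + y * P * t + (P + z * P) * t
    ≡⟨ solve 5 (λ x y z P t → con 31 :* (P :* t) :+ x :* P :* t :+ y :* P :* t :+ (P :+ z :* P) :* t
         := (con 31 :+ x :+ y :+ (con 1 :+ z)) :* P :* t) refl x y z P t ⟩
  (31 + x + y + suc z) * P * t ∎
  where
  open ℕ.≤-Reasoning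
  open +-*-Solver
  once-more : ∀ {u v} → u ≤ v → u ≤ v * t
  once-more {u} {v} le = ℕ.≤-trans le (ℕ.≤-trans (ℕ.≤-reflexive (sym (ℕ.*-identityʳ v))) (ℕ.*-monoʳ-≤ v 1≤t))

-- The constant 2K, including the factor lost in choosing t₀, is below 2^(2K) and so below N^(2Ks).
-- No multiplicative constant is left and the exponent is a multiple of s.
absorb : ∀ N s K E t₀ t → 2 ≤ N → 1 ≤ s → t₀ ≤ 2 * t →
         K * (N ^ (11 * s)) ^ E * t₀ ≤ N ^ ((2 * K + 11 * E) * s) * t
absorb N s K E t₀ t 2≤N 1≤s t₀≤ = begin
  K * (N ^ (11 * s)) ^ E * t₀
    ≤⟨ ℕ.*-monoʳ-≤ (K * (N ^ (11 * s)) ^ E) t₀≤ ⟩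
  K * (N ^ (11 * s)) ^ E * (2 * t)
    ≡⟨ solve 3 (λ k p t → k :* p :* (con 2 :* t) := con 2 :* k :* p :* t) refl K ((N ^ (11 * s)) ^ E) t ⟩
  2 * K * (N ^ (11 * s)) ^ E * t
    ≤⟨ ℕ.*-monoˡ-≤ t (ℕ.*-mono-≤ constant (ℕ.≤-reflexive (ℕ.^-*-assoc N (11 * s) E))) ⟩
  N ^ (2 * K * s) * N ^ (11 * s * E) * t
    ≡⟨ cong (_* t) (trans (sym (ℕ.^-distribˡ-+-* N (2 * K * s) (11 * s * E))) (cong (N ^_)
         (solve 3 (λ k s e → k :* s :+ con 11 :* s :* e := (k :+ con 11 :* e) :* s) refl (2 * K) s E))) ⟩
  N ^ ((2 * K + 11 * E) * s) * t ∎
  where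
  open ℕ.≤-Reasoning
  open +-*-Solver
  constant : 2 * K ≤ N ^ (2 * K * s)
  constant = ℕ.≤-trans (ℕ.<⇒≤ (n<2^n (2 * K))) (ℕ.≤-trans (ℕ.^-monoˡ-≤ (2 * K) 2≤N)
    (ℕ.^-monoʳ-≤ N {{>-nonZero (ℕ.≤-trans (s≤s z≤n) 2≤N)}}
      (ℕ.≤-trans (ℕ.≤-reflexive (sym (ℕ.*-identityʳ (2 * K)))) (ℕ.*-monoʳ-≤ (2 * K) 1≤s))))

factor nesting : Cmd → Cmd → Cmd → ℕ
factor A B C = 31 + size A + size B + suc (size C)
nesting A B C = depth A ⊔ depth B ⊔ depth C

steps-bound : ∀ A B C D ρ₀ ρ N s t₀ t → cost D ρ ≡ suc (cost B ρ + (t₀ * suc (cost C ρ) + 1)) →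
  (∀ y → ρ₀ y ≤ N ^ (11 * s)) → (∀ y → ρ y ≤ N ^ (11 * s)) → 1 ≤ N ^ (11 * s) →
  2 ≤ N → 1 ≤ s → 1 ≤ t₀ → t₀ ≤ 2 * t →
  Stages.steps A D ρ₀ ρ ≤ N ^ ((2 * factor A B C + 11 * nesting A B C) * s) * t
steps-bound A B C D ρ₀ ρ N s t₀ t D≡ ρ₀≤Q ρ≤Q 1≤Q 2≤N 1≤s 1≤t₀ t₀≤ = ℕ.≤-trans
  (subst (λ z → suc (19 + suc (cost A ρ₀ + suc (3 + suc (3 + z)))) ≤ factor A B C * Q ^ E * t₀) (sym D≡)
    (collect {x = size A} {size B} {size C} (Q ^ E) t₀
      (ℕ.≤-trans (cost-bound ρ₀ Q 1≤Q ρ₀≤Q A) (ℕ.*-monoʳ-≤ (size A)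
        (Q^-mono ρ₀ Q 1≤Q ρ₀≤Q (ℕ.≤-trans (ℕ.m≤m⊔n (depth A) (depth B)) (ℕ.m≤m⊔n _ (depth C))))))
      (ℕ.≤-trans (cost-bound ρ Q 1≤Q ρ≤Q B) (ℕ.*-monoʳ-≤ (size B)
        (Q^-mono ρ Q 1≤Q ρ≤Q (ℕ.≤-trans (ℕ.m≤n⊔m (depth A) (depth B)) (ℕ.m≤m⊔n _ (depth C))))))
      (ℕ.≤-trans (cost-bound ρ Q 1≤Q ρ≤Q C) (ℕ.*-monoʳ-≤ (size C)
        (Q^-mono ρ Q 1≤Q ρ≤Q (ℕ.m≤n⊔m (depth A ⊔ depth B) (depth C)))))
      (1≤Q^ ρ Q 1≤Q ρ≤Q E) 1≤t₀))
  (absorb N s (factor A B C) E t₀ t 2≤N 1≤s t₀≤)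
  where
  Q E : ℕ
  Q = N ^ (11 * s)
  E = nesting A B C

abstract
  -- The constant depends only on the sizes and depths of `setup`, `offsets` and `trial`. None of
  -- them involves the number of trials, so it can be chosen before p.
  in-time : Σ[ C ∈ ℕ ] (∀ {s n} (I : Instance s n) t₀ t → 1 ≤ t₀ → t₀ ≤ 2 * t →
            Analysis.steps I t₀ ≤ (n ⊔ 2) ^ (C * s) * t)
  in-time = 2 * factor setup offsets trial + 11 * nesting setup offsets trial , λ {s} {n} I t₀ t 1≤t₀ t₀≤ →
    let open Initialisation I
        open Timing I
    in steps-bound setup offsets trial (mainPart t₀) ρ₀ ρ (n ⊔ 2) s t₀ t
         (cong (λ z → suc (cost offsets ρ + z)) (cost-trials t₀ ρ)) ρ₀≤Q ρ≤Q 1≤Q 2≤N 1≤s 1≤t₀ t₀≤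

module _ {s n : ℕ} (I : Instance s n) (t₀ x : ℕ) where
  open Instance I using (Solvable)

  halts-by : ∀ {T} → Analysis.steps I t₀ + x ≡ T → HaltsWithin I (algorithm t₀) T
  halts-by refl = Analysis.halts I t₀ x

  concludes-by : ∀ {T} → Analysis.steps I t₀ + x ≡ T → ¬ Solvable → (ω : Vec Bool T) → ConcludesNone I (algorithm t₀) ω
  concludes-by refl = Analysis.concludes I t₀ x

  failure-by : ∀ {T} → Analysis.steps I t₀ + x ≡ T → Solvable →
    2 ^ t₀ * total (coinStrings T) (λ ω → bit (not (does (findsSolution? I (algorithm t₀) ω)))) ≤ 2 ^ T
  failure-by refl = Analysis.failure I t₀ x

  correct : ∀ p {T} → Analysis.steps I t₀ + x ≡ T → ℝ.L p (1 /2^ t₀) →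
    HaltsWithin I (algorithm t₀) T
    × (Solvable → 1- p ≤ Pr (findsSolution? I (algorithm t₀) {T}))
    × (¬ Solvable → (ω : Vec Bool T) → ConcludesNone I (algorithm t₀) ω)
  correct p {T} T≡ Lt = halts-by T≡ ,
    (λ solvable → probable p t₀ (findsSolution? I (algorithm t₀) {T}) Lt (failure-by T≡ solvable)) ,
    concludes-by T≡

-- One program serves all s and n, and p enters it only through the number of trials. The base
-- `n ⊔ 2` keeps the powers meaningful for n at most 1, and t stands for any natural upper bound of
-- log₂ (1/p).
lemma15 :
    Σ[ C ∈ ℕ ] ((p : ℝ) → 0ℚ <ʳ p → p ʳ< 1ℚ →
      Σ[ A ∈ Program ] (∀ {s n} (I : Instance s n) (t : ℕ) → log₂[1/ p ]≤ t →
        let T = (n ⊔ 2) ^ (C * s) * t in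
        HaltsWithin I A T
        × (Instance.Solvable I → 1- p ≤ Pr (findsSolution? I A {T}))
        × (¬ Instance.Solvable I → (ω : Vec Bool T) → ConcludesNone I A ω)))
lemma15 = proj₁ in-time , λ p 0<p p<1 →
  let t₀ , Lt , 1≤t₀ , small = number-of-trials p 0<p p<1 in
  algorithm t₀ , λ {s} {n} I t ok →
  let T = (n ⊔ 2) ^ (proj₁ in-time * s) * t in
  correct I t₀ (T ∸ Analysis.steps I t₀) p {T} (ℕ.m+[n∸m]≡n (proj₂ in-time I t₀ t 1≤t₀ (small t ok))) Lt
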